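{- For $n\ge1$ let $N_n(t,q,r)=\sum_{\sigma\in\mathfrak{S}_n(321)}t^{\mathsf{exc}\,\sigma}q^{\mathsf{inv}\,\sigma}r^{\mathsf{fix}\,\sigma}$. Then for each of the five quadruples $(\tau,\mathsf{stat}_1,\mathsf{stat}_2,\mathsf{stat}_3)\in\{(321,\mathsf{exc},\mathsf{inv},\mathsf{fix}),\ (231,\mathsf{des},\mathsf{des}+(31\text{ - }2),\mathsf{fmax}),\ (132,\mathsf{asc},\mathsf{asc}+(2\text{ - }13),\mathsf{amax}),\ (312,\mathsf{des},\mathsf{des}+(2\text{ - }31),\mathsf{amin}),\ (213,\mathsf{asc},\mathsf{asc}+(13\text{ - }2),\mathsf{fmin})\}$ we have $$N_{n}(t/q, q, 1)=\sum_{\sigma\in\mathfrak{S}_{n-1}(\tau)}t^{\mathsf{stat}_1\sigma}q^{\mathsf{stat}_2\sigma}(1+t)^{\mathsf{stat}_3\sigma},$$ $$N_{n}(t, q, t)=t^n\sum_{\sigma\in\mathfrak{S}_{n-1}(\tau)}(q/t)^{\mathsf{stat}_1\sigma}q^{\mathsf{stat}_2\sigma}(1+q/t)^{\mathsf{stat}_3\sigma}.$$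
   Context: $\mathfrak{S}_m(\tau)$ is the set of permutations of $[m]$ avoiding the classical pattern $\tau$ ($\mathfrak{S}_0$ consists of the empty permutation). For $\sigma\in\mathfrak{S}_m$: $\mathsf{exc}\,\sigma=\#\{i:\sigma(i)>i\}$, $\mathsf{fix}\,\sigma=\#\{i:\sigma(i)=i\}$, $\mathsf{inv}$ is the number of inversions, $\mathsf{des}\,\sigma=\#\{i\in[m-1]:\sigma(i)>\sigma(i+1)\}$, $\mathsf{asc}\,\sigma=\#\{i\in[m-1]:\sigma(i)<\sigma(i+1)\}$. Vincular pattern counts: $(31\text{ - }2)\sigma=\#\{(i,j):i+1<j\le m,\ \sigma(i+1)<\sigma(j)<\sigma(i)\}$, $(2\text{ - }31)\sigma=\#\{(i,j):j<i<m,\ \sigma(i+1)<\sigma(j)<\sigma(i)\}$, $(2\text{ - }13)\sigma=\#\{(i,j):j<i<m,\ \sigma(i)<\sigma(j)<\sigma(i+1)\}$, $(13\text{ - }2)\sigma=\#\{(i,j):i+1<j\le m,\ \sigma(i)<\sigma(j)<\sigma(i+1)\}$. With the convention $\sigma(0)=0,\sigma(m+1)=\infty$, a value $\sigma(i)$ ($1\le i\le m$) is a double ascent if $\sigma(i-1)<\sigma(i)<\sigma(i+1)$; $\mathsf{fmax}\,\sigma$ (resp. $\mathsf{amin}\,\sigma$) is the number of such double ascents that are also left-to-right maxima (resp. right-to-left minima). With the convention $\sigma(0)=\infty,\sigma(m+1)=0$, $\sigma(i)$ is a double descent if $\sigma(i-1)>\sigma(i)>\sigma(i+1)$; $\mathsf{amax}\,\sigma$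 (resp. $\mathsf{fmin}\,\sigma$) is the number of such double descents that are also right-to-left maxima (resp. left-to-right minima). -}

module Defs where

open import Algebra.Bundles using (CommutativeRing)
open import Data.Fin using (Fin; zero; suc; toℕ; inject₁; _<_; _<?_)
open import Data.Fin.Properties using (_≟_; all?)
open import Data.List using (List; []; _∷_; allFin; cartesianProduct; cartesianProductWith; filter; foldr; length)
open import Data.Nat as ℕ using (ℕ; zero; suc; _+_)
open import Data.Product using (_×_; _,_; ∃; uncurry)
open import Data.Vec as Vec using (Vec; []; _∷_; _∷ʳ_; lookup)
open import Data.Vec.Relation.Unary.AllPairs using (allPairs?)
open import Data.Vec.Relation.Unary.Unique.Propositional using (Unique)
open import Relation.Binary.PropositionalEquality using (_≡_)
open import Relation.Nullary using (Dec; ¬_; ¬?; _×-dec_; _→-dec_)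
open import Relation.Nullary.Decidable using (map′)
open import Relation.Unary using (Decidable)
import Data.Fin.Properties as Fin
import Algebra.Properties.Semiring.Exp as Exp

-- One-line notation σ(1) … σ(m).  Positions and values in [m] are represented
-- by Fin m, so both are shifted down by one.

Word : ℕ → Set
Word m = Vec (Fin m) m

words : ∀ v k → List (Vec (Fin v) k)
words v zero    = [] ∷ []
words v (suc k) = cartesianProductWith _∷_ (allFin v) (words v k)

IsPermutation : ∀ {m} → Word m → Set
IsPermutation = Unique

isPermutation? : ∀ {m} → Decidable (IsPermutation {m})
isPermutation? = allPairs? (λ x y → ¬? (x ≟ y))

-- ι lists the positions, in increasing order, of a subsequence of σ that is
-- order-isomorphic to the pattern τ.

Occurrence : ∀ {k m} → Vec ℕ k → Word m → Vec (Fin m) k → Set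
Occurrence {k} τ σ ι = ∀ (a b : Fin k) →
  (a < b → lookup ι a < lookup ι b) ×
  (lookup τ a ℕ.< lookup τ b → lookup σ (lookup ι a) < lookup σ (lookup ι b)) ×
  (lookup σ (lookup ι a) < lookup σ (lookup ι b) → lookup τ a ℕ.< lookup τ b)

occurrence? : ∀ {k m} (τ : Vec ℕ k) (σ : Word m) → Decidable (Occurrence τ σ)
occurrence? τ σ ι = all? λ a → all? λ b →
  ((a <? b) →-dec (lookup ι a <? lookup ι b)) ×-dec
  ((lookup τ a ℕ.<? lookup τ b) →-dec (lookup σ (lookup ι a) <? lookup σ (lookup ι b))) ×-dec
  ((lookup σ (lookup ι a) <? lookup σ (lookup ι b)) →-dec (lookup τ a ℕ.<? lookup τ b))

Contains : ∀ {k m} → Vec ℕ k → Word m → Set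
Contains {k} {m} τ σ = ∃ λ (ι : Vec (Fin m) k) → Occurrence τ σ ι

anyVec? : ∀ {v k} {P : Vec (Fin v) k → Set} → Decidable P → Dec (∃ P)
anyVec? {k = zero}  P? = map′ ([] ,_) (λ { ([] , p) → p }) (P? [])
anyVec? {k = suc k} P? =
  map′ (λ { (x , xs , p) → (x ∷ xs) , p }) (λ { (x ∷ xs , p) → x , xs , p })
       (Fin.any? λ x → anyVec? λ xs → P? (x ∷ xs))

contains? : ∀ {k m} (τ : Vec ℕ k) → Decidable (Contains {k} {m} τ)
contains? τ σ = anyVec? (occurrence? τ σ)

𝔖 : ∀ {k} (m : ℕ) → Vec ℕ k → List (Word m)
𝔖 m τ = filter (λ σ → isPermutation? σ ×-dec ¬? (contains? τ σ)) (words m m)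

♯ : ∀ {m} {P : Fin m → Set} → (∀ i → Dec (P i)) → ℕ
♯ {m} P? = length (filter P? (allFin m))

♯₂ : ∀ {m n} {P : Fin m → Fin n → Set} → (∀ i j → Dec (P i j)) → ℕ
♯₂ {m} {n} P? = length (filter (λ (i , j) → P? i j) (cartesianProduct (allFin m) (allFin n)))

exc fix inv : ∀ {m} → Word m → ℕ
exc σ = ♯ λ i → i <? lookup σ i
fix σ = ♯ λ i → lookup σ i ≟ i
inv σ = ♯₂ λ i j → (i <? j) ×-dec (lookup σ j <? lookup σ i)

-- Below, i : Fin k indexes the pairs of adjacent positions of a word of
-- length k + 1: inject₁ i and suc i are what the usual definitions call i and
-- i + 1.

des asc : ∀ {m} → Word m → ℕ
des {zero}  σ = 0
des {suc k} σ = ♯ λ (i : Fin k) → lookup σ (suc i) <? lookup σ (inject₁ i)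
asc {zero}  σ = 0
asc {suc k} σ = ♯ λ (i : Fin k) → lookup σ (inject₁ i) <? lookup σ (suc i)

[31-2] [2-31] [2-13] [13-2] : ∀ {m} → Word m → ℕ
[31-2] {zero}  σ = 0
[31-2] {suc k} σ = ♯₂ λ (i : Fin k) (j : Fin (suc k)) →
  (suc i <? j) ×-dec (lookup σ (suc i) <? lookup σ j) ×-dec (lookup σ j <? lookup σ (inject₁ i))
[2-31] {zero}  σ = 0
[2-31] {suc k} σ = ♯₂ λ (i : Fin k) (j : Fin (suc k)) →
  (j <? inject₁ i) ×-dec (lookup σ (suc i) <? lookup σ j) ×-dec (lookup σ j <? lookup σ (inject₁ i))
[2-13] {zero}  σ = 0
[2-13] {suc k} σ = ♯₂ λ (i : Fin k) (j : Fin (suc k)) →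
  (j <? inject₁ i) ×-dec (lookup σ (inject₁ i) <? lookup σ j) ×-dec (lookup σ j <? lookup σ (suc i))
[13-2] {zero}  σ = 0
[13-2] {suc k} σ = ♯₂ λ (i : Fin k) (j : Fin (suc k)) →
  (suc i <? j) ×-dec (lookup σ (inject₁ i) <? lookup σ j) ×-dec (lookup σ j <? lookup σ (suc i))

-- extend a b σ is a, σ(1), …, σ(m), b with the values of σ taken in {1, …, m},
-- so that a boundary value ∞ can be represented by m + 1.

extend : ∀ {m} → ℕ → ℕ → Word m → Vec ℕ (2 + m)
extend a b σ = a ∷ (Vec.map (λ x → suc (toℕ x)) σ ∷ʳ b)

doubleAscent? : ∀ {m} (σ : Word m) (i : Fin m) → let e = extend 0 (suc m) σ in
  Dec (lookup e (inject₁ (inject₁ i)) ℕ.< lookup e (inject₁ (suc i)) ×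
       lookup e (inject₁ (suc i)) ℕ.< lookup e (suc (suc i)))
doubleAscent? σ i = (_ ℕ.<? _) ×-dec (_ ℕ.<? _)

doubleDescent? : ∀ {m} (σ : Word m) (i : Fin m) → let e = extend (suc m) 0 σ in
  Dec (lookup e (inject₁ (inject₁ i)) ℕ.> lookup e (inject₁ (suc i)) ×
       lookup e (inject₁ (suc i)) ℕ.> lookup e (suc (suc i)))
doubleDescent? σ i = (_ ℕ.<? _) ×-dec (_ ℕ.<? _)

leftToRightMax? : ∀ {m} (σ : Word m) (i : Fin m) → Dec (∀ j → j < i → lookup σ j < lookup σ i)
leftToRightMax? σ i = all? λ j → (j <? i) →-dec (lookup σ j <? lookup σ i)

leftToRightMin? : ∀ {m} (σ : Word m) (i : Fin m) → Dec (∀ j → j < i → lookup σ i < lookup σ j)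
leftToRightMin? σ i = all? λ j → (j <? i) →-dec (lookup σ i <? lookup σ j)

rightToLeftMax? : ∀ {m} (σ : Word m) (i : Fin m) → Dec (∀ j → i < j → lookup σ j < lookup σ i)
rightToLeftMax? σ i = all? λ j → (i <? j) →-dec (lookup σ j <? lookup σ i)

rightToLeftMin? : ∀ {m} (σ : Word m) (i : Fin m) → Dec (∀ j → i < j → lookup σ i < lookup σ j)
rightToLeftMin? σ i = all? λ j → (i <? j) →-dec (lookup σ i <? lookup σ j)

fmax amin amax fmin : ∀ {m} → Word m → ℕ
fmax σ = ♯ λ i → doubleAscent?  σ i ×-dec leftToRightMax? σ i
amin σ = ♯ λ i → doubleAscent?  σ i ×-dec rightToLeftMin? σ i
amax σ = ♯ λ i → doubleDescent? σ i ×-dec rightToLeftMax? σ i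
fmin σ = ♯ λ i → doubleDescent? σ i ×-dec leftToRightMin? σ i

record Quadruple : Set where
  constructor quadruple
  field
    τ                 : Vec ℕ 3
    stat₁ stat₂ stat₃ : ∀ {m} → Word m → ℕ

quadruples : List Quadruple
quadruples =
  quadruple (3 ∷ 2 ∷ 1 ∷ []) exc inv                       fix  ∷
  quadruple (2 ∷ 3 ∷ 1 ∷ []) des (λ σ → des σ + [31-2] σ) fmax ∷
  quadruple (1 ∷ 3 ∷ 2 ∷ []) asc (λ σ → asc σ + [2-13] σ) amax ∷
  quadruple (3 ∷ 1 ∷ 2 ∷ []) des (λ σ → des σ + [2-31] σ) amin ∷
  quadruple (2 ∷ 1 ∷ 3 ∷ []) asc (λ σ → asc σ + [13-2] σ) fmin ∷
  []

-- An identity between Laurent polynomials over ℤ is stated as an identity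
-- between elements of an arbitrary commutative ring, those elements that occur
-- in a denominator being invertible.

module GeneratingFunctions {c ℓ} (R : CommutativeRing c ℓ) where
  open CommutativeRing R using (Carrier; 0#; semiring) renaming (_+_ to _⊕_; _*_ to _⊗_)
  open Exp semiring using (_^_) public

  ∑ : ∀ {a} {A : Set a} → List A → (A → Carrier) → Carrier
  ∑ xs f = foldr (λ x acc → f x ⊕ acc) 0# xs

  N : ℕ → Carrier → Carrier → Carrier → Carrier
  N n t q r = ∑ (𝔖 n (3 ∷ 2 ∷ 1 ∷ [])) λ σ → ((t ^ exc σ) ⊗ (q ^ inv σ)) ⊗ (r ^ fix σ)

{-# OPTIONS --safe #-}
module Submission where

-- Let S = S(u; z) and T = T(u; z) be the power series in z with
--   S = 1 + u z S T   and   T = 1 + q z T S(u; q z),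
-- and let F(u, r) be the solution of F = 1 + z (r - 1 + S(u)) F.  All the sums over
-- pattern-avoiding permutations are the coefficients of F(t q, r):
-- * a 231-avoiding word is a α β with α < a < β, and in this decomposition as a
--   binary tree the statistics are additive;
-- * a 321-avoiding word is read from left to right, keeping the queue of the letters
--   that were skipped, which leads to S(u) = 1 + z (u - 1 + S(u q)) S(u);
-- * 132, 213 and 312 follow from 231 by reversal and complement.
-- The second description of S amounts to S(u q) + u = u T(u) + 1, which is proved by
-- comparing the linear equations of the products S(u q) T(u q) and T(u) S(u; q z).
-- The two identities are then contractions of continued fractions:
--   F(t, 1) = 1 + z F(t q, 1 + t)   and
--   F(t q, t) = S(t) = 1 + t z S(t) T(t),  where S(t) T(t) is F(q² / t, 1 + q / t) at t z.

open import Defs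
open import Algebra.Bundles using (CommutativeRing)
open import Data.List.Membership.Propositional using (_∈_)
open import Data.Nat using (ℕ; _≤_; _∸_)
open import Data.Product using (_×_)

open import Data.Bool using (if_then_else_)
open import Data.Empty using (⊥)
open import Data.Fin as Fin using (Fin; toℕ; fromℕ<; inject₁; opposite)
open import Data.Fin.Patterns using (0F; 1F; 2F)
open import Data.Fin.Base using (zero; suc)
open import Data.List as List
  using (List; []; _∷_; [_]; _++_; _∷ʳ_; map; length; filter; iterate; tabulate; allFin; cartesianProduct; cartesianProductWith)
open import Data.List.Membership.Propositional.Properties
  using (∈-++⁺ˡ; ∈-++⁺ʳ; ∈-++⁻; ∈-map⁺; ∈-map⁻; ∈-∃++; ∈-filter⁺; ∈-filter⁻; ∈-cartesianProductWith⁺; ∈-cartesianProductWith⁻; ∈-allFin)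
open import Data.List.Membership.Propositional.Properties.WithK using (unique∧set⇒bag)
open import Data.List.Relation.Binary.BagAndSetEquality using (∼bag⇒↭)
open import Data.List.Relation.Binary.Permutation.Propositional
  using (_↭_; ↭-refl; ↭-prep; ↭-trans; ↭-sym; ↭-reflexive; ↭⇒↭ₛ)
open import Data.List.Relation.Binary.Permutation.Propositional.Properties
  using (∈-resp-↭; drop-mid; drop-∷; shift; ↭-length; filter-↭; ↭-empty-inv; All-resp-↭; ++⁺)
open import Data.List.Relation.Binary.Permutation.Setoid.Properties using (Unique-resp-↭)
open import Data.List.Relation.Unary.All as All using (All; []; _∷_)
open import Data.List.Relation.Unary.AllPairs as AllPairs using (AllPairs; []; _∷_)
open import Data.List.Relation.Unary.Any using (here; there)
open import Data.List.Relation.Unary.Unique.Propositional using () renaming (Unique to Uniqueᴸ)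
open import Data.Nat using (zero; suc)
open import Data.Product using (_,_; ∃; ∃₂; proj₁; proj₂)
open import Data.Product.Function.NonDependent.Propositional using (_×-⇔_)
open import Data.Sum using (_⊎_; inj₁; inj₂)
open import Data.Unit using (⊤; tt)
open import Data.Vec as Vec using (Vec; []; _∷_; lookup)
open import Data.Vec.Relation.Unary.AllPairs using ([]; _∷_)
open import Data.Vec.Relation.Unary.Unique.Propositional using (Unique)
open import Function using (_∘_; id; case_of_; _⇔_; mk⇔; Equivalence)
open import Function.Construct.Composition using (_⇔-∘_)
open import Function.Construct.Identity using (⇔-id)
open import Function.Construct.Symmetry using (⇔-sym)
open import Relation.Binary.Definitions using (tri<; tri≈; tri>)
open import Relation.Binary.PropositionalEquality as ≡
  using (_≡_; _≢_; refl; sym; trans; cong; cong₂; subst; subst₂)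
open import Relation.Nullary using (Dec; does; ¬_; ¬?; yes; no; contradiction; _×-dec_; _→-dec_)
open import Relation.Nullary.Decidable using (dec-true; dec-false; from-yes)
open import Relation.Unary using (Decidable)
import Algebra.Construct.Pointwise as Pointwise
import Algebra.Properties.CommutativeMonoid.Sum as MonoidSum
import Algebra.Properties.CommutativeSemigroup as CommutativeSemigroupₚ
import Algebra.Properties.Group as GroupProperties
import Algebra.Properties.Semiring.Exp as Exp
import Algebra.Solver.Ring.NaturalCoefficients.Default as SemiringSolver
import Data.Fin.Permutation as Permutation
import Data.Fin.Properties as Finₚ
import Data.List.Properties as Listₚ
import Data.List.Relation.Unary.All.Properties as Allₚ
import Data.List.Relation.Unary.AllPairs.Properties as AllPairsₚ
import Data.List.Relation.Unary.Unique.Propositional.Properties as Uniqueₚ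
import Data.Nat as ℕ
import Level
import Data.Nat.Properties as ℕₚ
import Data.Vec.Properties as Vecₚ
import Data.Vec.Relation.Unary.All.Properties as Allᵛₚ
import Data.Vec.Relation.Unary.Unique.Propositional.Properties as Uniqueᵛₚ
import Relation.Binary.Reasoning.Setoid as SetoidReasoning

-- Over an arbitrary commutative ring neither `u` nor `q` can be cancelled, so no relation between S
-- and T comes from solving their equations for one of them. What remains is that an equation X = 1
-- + z c X determines X one degree further than c is known. The product of two consecutive levels of
-- a continued fraction satisfies such an equation. In each of the two relations needed between
-- different parameters, the sides A and B have the form e + z m X and e + z m Y with common e and
-- m, where X and Y are such products whose coefficients are q A(q z) and q B(q z). Agreement of A
-- and B therefore climbs from degree to degree.
--
-- The weight 1 + t arises in the first identity because the coefficient of the contracted fraction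
-- is 1 + t T(t) = t + S(t q), to be read as r - 1 + S(t q). The parameter q² / t arises in the
-- second one because the continued fractions of S(t; q z) and S(q² / t; t z) have the same
-- coefficients, up to an exchange within each pair of neighbours.
--
-- Equations are written without subtraction wherever possible, so that they stay within reach of a
-- solver for commutative semirings.

module ProductLemma {c ℓ} (R : CommutativeRing c ℓ) where
  open CommutativeRing R renaming (refl to ≈-refl)
  open SemiringSolver commutativeSemiring using (solve; _:=_; _:+_; _:*_; con)

  -- Formally s = 1 / (1 - z a t) and t = 1 / (1 - z b d), so 1 / (s t) = 1 / t - z a = 1 - z (a + b
  -- d). This contracts two levels of a continued fraction into one; substituting the equation of
  -- `t` and then that of `s` avoids the division.
  product-equation : ∀ z a b {s t d} →
    s ≈ 1# + z * (a * (s * t)) → t ≈ 1# + z * (b * (t * d)) →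
    s * t ≈ 1# + z * ((a + b * d) * (s * t))
  product-equation z a b {s} {t} {d} s≈ t≈ = begin
    s * t                                                    ≈⟨ *-congˡ t≈ ⟩
    s * (1# + z * (b * (t * d)))                             ≈⟨ solve 5 (λ z b s t d →
      s :* (con 1 :+ z :* (b :* (t :* d))) := s :+ z :* (b :* d :* (s :* t))) ≈-refl z b s t d ⟩
    s + z * (b * d * (s * t))                                ≈⟨ +-congʳ s≈ ⟩
    1# + z * (a * (s * t)) + z * (b * d * (s * t))           ≈⟨ solve 6 (λ z a b s t d →
      con 1 :+ z :* (a :* (s :* t)) :+ z :* (b :* d :* (s :* t)) :=
      con 1 :+ z :* ((a :+ b :* d) :* (s :* t))) ≈-refl z a b s t d ⟩
    1# + z * ((a + b * d) * (s * t))                         ∎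
    where open SetoidReasoning setoid

-- Formal power series and linear equations for them

module PowerSeries {c ℓ} (R : CommutativeRing c ℓ) where
  open CommutativeRing R renaming (refl to ≈-refl; sym to ≈-sym; trans to ≈-trans)
  open Exp semiring using (_^_)
  open SetoidReasoning setoid
  open SemiringSolver commutativeSemiring using (solve; _:=_; _:+_; _:*_; con)

  Series : Set c
  Series = ℕ → Carrier

  tail : Series → Series
  tail f n = f (suc n)

  infixl 7 _⊛_
  _⊛_ : Series → Series → Series
  (f ⊛ g) zero    = f 0 * g 0
  (f ⊛ g) (suc n) = f 0 * g (suc n) + (tail f ⊛ g) n

  infixl 6 _⊞_
  _⊞_ : Series → Series → Series
  (f ⊞ g) n = f n + g n

  infix 4 _≋_ _≋[_]_
  _≋_ : Series → Series → Set ℓ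
  f ≋ g = ∀ n → f n ≈ g n

  _≋[_]_ : Series → ℕ → Series → Set ℓ
  f ≋[ k ] g = ∀ n → n ℕ.< k → f n ≈ g n

  ι : Carrier → Series
  ι a zero    = a
  ι a (suc n) = 0#

  z : Series
  z zero    = 0#
  z (suc n) = ι 1# n

  -- The substitution of a z for z.
  δ : Carrier → Series → Series
  δ a f n = a ^ n * f n

  ⊛-cong-≋[] : ∀ {f f′ g g′} k → f ≋[ k ] f′ → g ≋[ k ] g′ → f ⊛ g ≋[ k ] f′ ⊛ g′
  ⊛-cong-≋[] k f≈ g≈ zero    n<k = *-cong (f≈ 0 n<k) (g≈ 0 n<k)
  ⊛-cong-≋[] (suc k) f≈ g≈ (suc n) (ℕ.s≤s n<k) =
    +-cong (*-cong (f≈ 0 ℕ.z<s) (g≈ (suc n) (ℕ.s≤s n<k)))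
           (⊛-cong-≋[] k (λ i i<k → f≈ (suc i) (ℕ.s≤s i<k))
                         (λ i i<k → g≈ i (ℕₚ.m≤n⇒m≤1+n i<k)) n n<k)

  ⊛-cong : ∀ {f f′ g g′} → f ≋ f′ → g ≋ g′ → f ⊛ g ≋ f′ ⊛ g′
  ⊛-cong f≈ g≈ n = ⊛-cong-≋[] (suc n) (λ i _ → f≈ i) (λ i _ → g≈ i) n ℕₚ.≤-refl

  0⊛ : ∀ {f} g → (∀ n → f n ≈ 0#) → ∀ n → (f ⊛ g) n ≈ 0#
  0⊛ g f≈0 zero    = ≈-trans (*-congʳ (f≈0 0)) (zeroˡ _)
  0⊛ {f} g f≈0 (suc n) = begin
    f 0 * g (suc n) + (tail f ⊛ g) n ≈⟨ +-cong (*-congʳ (f≈0 0)) (0⊛ g (λ i → f≈0 (suc i)) n) ⟩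
    0# * g (suc n) + 0#              ≈⟨ ≈-trans (+-identityʳ _) (zeroˡ _) ⟩
    0#                               ∎

  ι⊛ : ∀ a f n → (ι a ⊛ f) n ≈ a * f n
  ι⊛ a f zero    = ≈-refl
  ι⊛ a f (suc n) = ≈-trans (+-congˡ (0⊛ f (λ _ → ≈-refl) n)) (+-identityʳ _)

  z⊛-zero : ∀ f → (z ⊛ f) 0 ≈ 0#
  z⊛-zero f = zeroˡ _

  z⊛-suc : ∀ f n → (z ⊛ f) (suc n) ≈ f n
  z⊛-suc f n = begin
    0# * f (suc n) + (ι 1# ⊛ f) n ≈⟨ +-cong (zeroˡ _) (ι⊛ 1# f n) ⟩
    0# + 1# * f n                 ≈⟨ ≈-trans (+-identityˡ _) (*-identityˡ _) ⟩
    f n                           ∎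

  -- The Cauchy product is defined by peeling off the constant term of the left factor. Peeling it
  -- off the right factor instead is what makes commutativity an induction.
  ⊛-suc′ : ∀ f g n → (f ⊛ g) (suc n) ≈ (f ⊛ tail g) n + f (suc n) * g 0
  ⊛-suc′ f g zero    = ≈-refl
  ⊛-suc′ f g (suc n) = begin
    f 0 * g (2 ℕ.+ n) + (tail f ⊛ g) (suc n)
      ≈⟨ +-congˡ (⊛-suc′ (tail f) g n) ⟩
    f 0 * g (2 ℕ.+ n) + ((tail f ⊛ tail g) n + f (2 ℕ.+ n) * g 0)
      ≈⟨ +-assoc _ _ _ ⟨
    f 0 * g (2 ℕ.+ n) + (tail f ⊛ tail g) n + f (2 ℕ.+ n) * g 0 ∎

  ⊛-comm : ∀ f g → f ⊛ g ≋ g ⊛ f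
  ⊛-comm f g zero    = *-comm _ _
  ⊛-comm f g (suc n) = begin
    f 0 * g (suc n) + (tail f ⊛ g) n ≈⟨ +-cong (*-comm _ _) (⊛-comm (tail f) g n) ⟩
    g (suc n) * f 0 + (g ⊛ tail f) n ≈⟨ +-comm _ _ ⟩
    (g ⊛ tail f) n + g (suc n) * f 0 ≈⟨ ⊛-suc′ g f n ⟨
    (g ⊛ f) (suc n)                  ∎

  ⊛-distribʳ : ∀ h f g → (f ⊞ g) ⊛ h ≋ f ⊛ h ⊞ g ⊛ h
  ⊛-distribʳ h f g zero    = distribʳ _ _ _
  ⊛-distribʳ h f g (suc n) = begin
    (f 0 + g 0) * h (suc n) + ((tail f ⊞ tail g) ⊛ h) n
      ≈⟨ +-cong (distribʳ _ _ _) (⊛-distribʳ h (tail f) (tail g) n) ⟩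
    f 0 * h (suc n) + g 0 * h (suc n) + ((tail f ⊛ h) n + (tail g ⊛ h) n)
      ≈⟨ solve 4 (λ a b c d → a :+ b :+ (c :+ d) := a :+ c :+ (b :+ d)) ≈-refl _ _ _ _ ⟩
    f 0 * h (suc n) + (tail f ⊛ h) n + (g 0 * h (suc n) + (tail g ⊛ h) n) ∎

  scale-⊛ : ∀ a f g n → ((λ i → a * f i) ⊛ g) n ≈ a * (f ⊛ g) n
  scale-⊛ a f g zero    = *-assoc _ _ _
  scale-⊛ a f g (suc n) = begin
    a * f 0 * g (suc n) + ((λ i → a * f (suc i)) ⊛ g) n ≈⟨ +-cong (*-assoc _ _ _) (scale-⊛ a (tail f) g n) ⟩
    a * (f 0 * g (suc n)) + a * (tail f ⊛ g) n          ≈⟨ distribˡ _ _ _ ⟨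
    a * (f 0 * g (suc n) + (tail f ⊛ g) n)              ∎

  ⊛-assoc : ∀ f g h → (f ⊛ g) ⊛ h ≋ f ⊛ (g ⊛ h)
  ⊛-assoc f g h zero    = *-assoc _ _ _
  ⊛-assoc f g h (suc n) = begin
    f 0 * g 0 * h (suc n) + (((λ i → f 0 * tail g i) ⊞ (tail f ⊛ g)) ⊛ h) n
      ≈⟨ +-congˡ (⊛-distribʳ h _ _ n) ⟩
    f 0 * g 0 * h (suc n) + (((λ i → f 0 * tail g i) ⊛ h) n + ((tail f ⊛ g) ⊛ h) n)
      ≈⟨ +-congˡ (+-cong (scale-⊛ (f 0) (tail g) h n) (⊛-assoc (tail f) g h n)) ⟩
    f 0 * g 0 * h (suc n) + (f 0 * (tail g ⊛ h) n + (tail f ⊛ (g ⊛ h)) n)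
      ≈⟨ solve 5 (λ a b c d e → a :* b :* c :+ (a :* d :+ e) := a :* (b :* c :+ d) :+ e) ≈-refl _ _ _ _ _ ⟩
    f 0 * (g 0 * h (suc n) + (tail g ⊛ h) n) + (tail f ⊛ (g ⊛ h)) n ∎

  ⊛-identityˡ : ∀ f → ι 1# ⊛ f ≋ f
  ⊛-identityˡ f n = ≈-trans (ι⊛ 1# f n) (*-identityˡ _)

  -- With this structure `product-equation` and the semiring solver apply to series as they stand.
  seriesRing : CommutativeRing c ℓ
  seriesRing = record
    { Carrier = Series
    ; _≈_ = _≋_
    ; _+_ = _⊞_
    ; _*_ = _⊛_
    ; -_ = λ f n → - f n
    ; 0# = λ _ → 0#
    ; 1# = ι 1#
    ; isCommutativeRing = record
      { isRing = record
        { +-isAbelianGroup = Pointwise.isAbelianGroup ℕ +-isAbelianGroup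
        ; *-cong = ⊛-cong
        ; *-assoc = ⊛-assoc
        ; *-identity = ⊛-identityˡ , λ f n → ≈-trans (⊛-comm f (ι 1#) n) (⊛-identityˡ f n)
        ; distrib = (λ f g h n → ≈-trans (⊛-comm f (g ⊞ h) n)
                      (≈-trans (⊛-distribʳ f g h n) (+-cong (⊛-comm g f n) (⊛-comm h f n)))) , ⊛-distribʳ
        }
      ; *-comm = ⊛-comm
      }
    }

  ι-cong : ∀ {a b} → a ≈ b → ι a ≋ ι b
  ι-cong a≈b zero    = a≈b
  ι-cong a≈b (suc n) = ≈-refl

  ι-+ : ∀ a b → ι (a + b) ≋ ι a ⊞ ι b
  ι-+ a b zero    = ≈-refl
  ι-+ a b (suc n) = ≈-sym (+-identityʳ _)

  ι-* : ∀ a b → ι (a * b) ≋ ι a ⊛ ι b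
  ι-* a b n = ≈-sym (≈-trans (ι⊛ a (ι b) n) (helper n))
    where
    helper : ∀ n → a * ι b n ≈ ι (a * b) n
    helper zero    = ≈-refl
    helper (suc n) = zeroʳ _

  δ-cong : ∀ a {f g} → f ≋ g → δ a f ≋ δ a g
  δ-cong a f≋g n = *-congˡ (f≋g n)

  δ-cong-≋[] : ∀ a k {f g} → f ≋[ k ] g → δ a f ≋[ k ] δ a g
  δ-cong-≋[] a k f≋g n n<k = *-congˡ (f≋g n n<k)

  δ-⊞ : ∀ a f g → δ a (f ⊞ g) ≋ δ a f ⊞ δ a g
  δ-⊞ a f g n = distribˡ _ _ _

  δ-ι : ∀ a b → δ a (ι b) ≋ ι b
  δ-ι a b zero    = *-identityˡ _
  δ-ι a b (suc n) = zeroʳ _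

  δ-⊛ : ∀ a f g → δ a (f ⊛ g) ≋ δ a f ⊛ δ a g
  δ-⊛ a f g zero    = solve 2 (λ x y → con 1 :* (x :* y) := con 1 :* x :* (con 1 :* y)) ≈-refl (f 0) (g 0)
  δ-⊛ a f g (suc n) = begin
    a ^ suc n * (f 0 * g (suc n) + (tail f ⊛ g) n)
      ≈⟨ solve 5 (λ a p x y w → a :* p :* (x :* y :+ w) :=
           con 1 :* x :* (a :* p :* y) :+ a :* (p :* w)) ≈-refl a (a ^ n) (f 0) (g (suc n)) ((tail f ⊛ g) n) ⟩
    1# * f 0 * (a ^ suc n * g (suc n)) + a * (a ^ n * (tail f ⊛ g) n)
      ≈⟨ +-congˡ (*-congˡ (δ-⊛ a (tail f) g n)) ⟩
    1# * f 0 * (a ^ suc n * g (suc n)) + a * (δ a (tail f) ⊛ δ a g) n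
      ≈⟨ +-congˡ (scale-⊛ a _ _ n) ⟨
    1# * f 0 * (a ^ suc n * g (suc n)) + ((λ i → a * (a ^ i * f (suc i))) ⊛ δ a g) n
      ≈⟨ +-congˡ (⊛-cong (λ i → *-assoc a (a ^ i) (f (suc i))) (λ _ → ≈-refl) n) ⟨
    1# * f 0 * (a ^ suc n * g (suc n)) + (tail (δ a f) ⊛ δ a g) n ∎

  δ-z : ∀ a → δ a z ≋ ι a ⊛ z
  δ-z a n = ≈-trans (helper n) (≈-sym (ι⊛ a z n))
    where
    helper : ∀ n → a ^ n * z n ≈ a * z n
    helper zero          = ≈-trans (zeroʳ _) (≈-sym (zeroʳ _))
    helper (suc zero)    = *-congʳ (*-identityʳ _)
    helper (suc (suc n)) = ≈-trans (zeroʳ _) (≈-sym (zeroʳ _))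

  δ-comm : ∀ a b f → δ a (δ b f) ≋ δ b (δ a f)
  δ-comm a b f n = solve 3 (λ x y w → x :* (y :* w) := y :* (x :* w)) ≈-refl _ _ _

  z⊛-cong-≋[] : ∀ k {f g} → f ≋[ k ] g → z ⊛ f ≋[ suc k ] z ⊛ g
  z⊛-cong-≋[] k {f} {g} f≋g zero _    = ≈-trans (z⊛-zero f) (≈-sym (z⊛-zero g))
  z⊛-cong-≋[] k f≋g (suc n) (ℕ.s≤s n<k) = ≈-trans (z⊛-suc _ n) (≈-trans (f≋g n n<k) (≈-sym (z⊛-suc _ n)))

  -- Because of the factor `z`, the coefficient of degree n in f depends only on the coefficients of
  -- `a` and f in degrees below n. One degree is gained with respect to `a`, and this gain drives
  -- every later comparison of series.
  solution-≋[] : ∀ k {f g a b} → f ≋ ι 1# ⊞ z ⊛ (a ⊛ f) → g ≋ ι 1# ⊞ z ⊛ (b ⊛ g) →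
                 a ≋[ k ] b → f ≋[ suc k ] g
  solution-≋[] k {f} {g} {a} {b} f≋ g≋ a≋b = go (suc k) ℕₚ.≤-refl
    where
    go : ∀ j → j ℕ.≤ suc k → f ≋[ j ] g
    go (suc j) (ℕ.s≤s j≤k) n n<j = begin
      f n                       ≈⟨ f≋ n ⟩
      ι 1# n + (z ⊛ (a ⊛ f)) n  ≈⟨ +-congˡ (z⊛-cong-≋[] j (⊛-cong-≋[] {a} {b} {f} {g} j
        (λ i i<j → a≋b i (ℕₚ.<-≤-trans i<j j≤k)) (go j (ℕₚ.m≤n⇒m≤1+n j≤k))) n n<j) ⟩
      ι 1# n + (z ⊛ (b ⊛ g)) n  ≈⟨ g≋ n ⟨
      g n                       ∎

  solution-unique : ∀ {f g a} → f ≋ ι 1# ⊞ z ⊛ (a ⊛ f) → g ≋ ι 1# ⊞ z ⊛ (a ⊛ g) → f ≋ g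
  solution-unique f≋ g≋ n = solution-≋[] n f≋ g≋ (λ _ _ → ≈-refl) n ℕₚ.≤-refl

-- Functional equations of S, T and F, and the two contractions

module FunctionalEquations {c ℓ} (R : CommutativeRing c ℓ) where
  open PowerSeries R
  open CommutativeRing R using (Carrier; 1#; 0#) renaming (_*_ to _·_; _+_ to _∔_; _≈_ to _≈ᴿ_)
  private module R = CommutativeRing R
  open CommutativeRing seriesRing using (setoid; +-congˡ; +-congʳ; +-cong; *-congˡ; *-congʳ; *-cong; +-comm; +-identityˡ; commutativeSemiring) renaming (refl to ≋-refl; sym to ≋-sym; trans to ≋-trans)
  open ProductLemma seriesRing using (product-equation)
  open SetoidReasoning setoid
  open SemiringSolver commutativeSemiring using (solve; _:=_; _:+_; _:*_; con)

  open GroupProperties (CommutativeRing.+-group seriesRing) using () renaming (∙-cancelʳ to cancelʳ)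

  δ-equation : ∀ a b {f g} → f ≋ ι 1# ⊞ z ⊛ (ι b ⊛ g) → δ a f ≋ ι 1# ⊞ z ⊛ (ι (a · b) ⊛ δ a g)
  δ-equation a b {f} {g} f≋ = begin
    δ a f                                  ≈⟨ δ-cong a f≋ ⟩
    δ a (ι 1# ⊞ z ⊛ (ι b ⊛ g))             ≈⟨ δ-⊞ a _ _ ⟩
    δ a (ι 1#) ⊞ δ a (z ⊛ (ι b ⊛ g))       ≈⟨ +-cong (δ-ι a 1#) (δ-⊛ a z (ι b ⊛ g)) ⟩
    ι 1# ⊞ δ a z ⊛ δ a (ι b ⊛ g)           ≈⟨ +-congˡ {ι 1#} (*-cong (δ-z a) (≋-trans (δ-⊛ a (ι b) g) (*-congʳ (δ-ι a b)))) ⟩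
    ι 1# ⊞ ι a ⊛ z ⊛ (ι b ⊛ δ a g)         ≈⟨ +-congˡ {ι 1#} (solve 4 (λ x y w v → (x :* y) :* (w :* v) :=
                                                y :* ((x :* w) :* v)) ≋-refl (ι a) z (ι b) (δ a g)) ⟩
    ι 1# ⊞ z ⊛ ((ι a ⊛ ι b) ⊛ δ a g)       ≈⟨ +-congˡ {ι 1#} (*-congˡ {z} (*-congʳ (≋-sym (ι-* a b)))) ⟩
    ι 1# ⊞ z ⊛ (ι (a · b) ⊛ δ a g)         ∎

  -- S and T are the two interleaved tails of the Stieltjes continued fraction
  -- 1 / (1 - uz / (1 - qz / (1 - uqz / (1 - q²z / ⋯)))).
  record StieltjesPair (q u : Carrier) (S T : Series) : Set ℓ where
    field
      S-equation : S ≋ ι 1# ⊞ z ⊛ (ι u ⊛ (S ⊛ T))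
      T-equation : T ≋ ι 1# ⊞ z ⊛ (ι q ⊛ (T ⊛ δ q S))

  -- The equation F = 1 + z (r - 1 + S) F with its negative term moved to the left.
  WeightedBy : Carrier → Series → Series → Set ℓ
  WeightedBy r S F = F ⊞ z ⊛ F ≋ ι 1# ⊞ z ⊛ ((ι r ⊞ S) ⊛ F)

  open StieltjesPair public

  δ-equation′ : ∀ a b {f g h} → f ≋ ι 1# ⊞ z ⊛ (ι b ⊛ (g ⊛ h)) →
                δ a f ≋ ι 1# ⊞ z ⊛ (ι (a · b) ⊛ (δ a g ⊛ δ a h))
  δ-equation′ a b {f} {g} {h} f≋ = ≋-trans (δ-equation a b f≋)
    (+-congˡ {ι 1#} (*-congˡ {z} (*-congˡ {ι (a · b)} (δ-⊛ a g h))))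

  coefficient-cong : ∀ {f g a b} → f ≋ ι 1# ⊞ z ⊛ (a ⊛ g) → a ≋ b → f ≋ ι 1# ⊞ z ⊛ (b ⊛ g)
  coefficient-cong {g = g} f≋ a≋b = ≋-trans f≋ (+-congˡ {ι 1#} (*-congˡ {z} (*-congʳ {g} a≋b)))

  δ-affine : ∀ a b e f → δ a (ι b ⊛ f ⊞ ι e) ≋ ι b ⊛ δ a f ⊞ ι e
  δ-affine a b e f = begin
    δ a (ι b ⊛ f ⊞ ι e)           ≈⟨ δ-⊞ a (ι b ⊛ f) (ι e) ⟩
    δ a (ι b ⊛ f) ⊞ δ a (ι e)     ≈⟨ +-cong (δ-⊛ a (ι b) f) (δ-ι a e) ⟩
    δ a (ι b) ⊛ δ a f ⊞ ι e       ≈⟨ +-congʳ {ι e} (*-congʳ {δ a f} (δ-ι a b)) ⟩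
    ι b ⊛ δ a f ⊞ ι e             ∎

  -- If A and B agree below degree k, then so do the coefficients of the linear
  -- equations of X and Y, hence X and Y agree below degree k + 1.
  bootstrap : ∀ q {A B X Y e m} → A ≋ e ⊞ z ⊛ (m ⊛ X) → B ≋ e ⊞ z ⊛ (m ⊛ Y) →
              X ≋ ι 1# ⊞ z ⊛ ((ι q ⊛ δ q A) ⊛ X) → Y ≋ ι 1# ⊞ z ⊛ ((ι q ⊛ δ q B) ⊛ Y) → A ≋ B
  bootstrap q {A} {B} {X} {Y} {e} {m} A≋ B≋ X≋ Y≋ n = go (suc n) n ℕₚ.≤-refl
    where
    go : ∀ k → A ≋[ k ] B
    go (suc k) i i<k = R.trans (A≋ i) (R.trans (R.+-congˡ
      (z⊛-cong-≋[] (suc k) (⊛-cong-≋[] (suc k) (λ _ _ → R.refl)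
        (solution-≋[] k X≋ Y≋ (⊛-cong-≋[] k (λ _ _ → R.refl) (δ-cong-≋[] q k (go k)))))
        i (ℕₚ.m≤n⇒m≤1+n i<k))) (R.sym (B≋ i)))

  module _ {q u v : Carrier} {S T S′ T′ : Series} (v≈uq : v ≈ᴿ u · q)
           (P : StieltjesPair q u S T) (P′ : StieltjesPair q v S′ T′) where

    private
      ιv≋ : ι v ≋ ι u ⊛ ι q
      ιv≋ = ≋-trans (ι-cong v≈uq) (ι-* u q)

    -- Both sides are 1 + u + z u q X, with X = S′ T′ on the left and X = T S(q z) on the right. By
    -- `product-equation` the linear equations of these products have the coefficients u q + q S′(q
    -- z) and q + q u T(q z), which are q times the two sides at q z; so `bootstrap` applies.
    S-shift : S′ ⊞ ι u ≋ ι u ⊛ T ⊞ ι 1#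
    S-shift = bootstrap q {X = S′ ⊛ T′} {Y = T ⊛ δ q S} {e = ι 1# ⊞ ι u} {m = ι u ⊛ ι q} A≋ B≋ X≋ Y≋
      where
      A≋ : S′ ⊞ ι u ≋ ι 1# ⊞ ι u ⊞ z ⊛ (ι u ⊛ ι q ⊛ (S′ ⊛ T′))
      A≋ = begin
        S′ ⊞ ι u                                        ≈⟨ +-congʳ {ι u} (coefficient-cong (S-equation P′) ιv≋) ⟩
        ι 1# ⊞ z ⊛ (ι u ⊛ ι q ⊛ (S′ ⊛ T′)) ⊞ ι u        ≈⟨ solve 2 (λ x y → con 1 :+ x :+ y := con 1 :+ y :+ x) ≋-refl _ _ ⟩
        ι 1# ⊞ ι u ⊞ z ⊛ (ι u ⊛ ι q ⊛ (S′ ⊛ T′))        ∎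
      B≋ : ι u ⊛ T ⊞ ι 1# ≋ ι 1# ⊞ ι u ⊞ z ⊛ (ι u ⊛ ι q ⊛ (T ⊛ δ q S))
      B≋ = begin
        ι u ⊛ T ⊞ ι 1#                                    ≈⟨ +-congʳ {ι 1#} (*-congˡ {ι u} (T-equation P)) ⟩
        ι u ⊛ (ι 1# ⊞ z ⊛ (ι q ⊛ (T ⊛ δ q S))) ⊞ ι 1#     ≈⟨ solve 4 (λ z u q y →
          u :* (con 1 :+ z :* (q :* y)) :+ con 1 := con 1 :+ u :+ z :* (u :* q :* y)) ≋-refl z (ι u) (ι q) (T ⊛ δ q S) ⟩
        ι 1# ⊞ ι u ⊞ z ⊛ (ι u ⊛ ι q ⊛ (T ⊛ δ q S))        ∎
      X≋ : S′ ⊛ T′ ≋ ι 1# ⊞ z ⊛ ((ι q ⊛ δ q (S′ ⊞ ι u)) ⊛ (S′ ⊛ T′))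
      X≋ = coefficient-cong (product-equation z (ι v) (ι q) {d = δ q S′} (S-equation P′) (T-equation P′)) (begin
        ι v ⊞ ι q ⊛ δ q S′             ≈⟨ +-congʳ {ι q ⊛ δ q S′} ιv≋ ⟩
        ι u ⊛ ι q ⊞ ι q ⊛ δ q S′       ≈⟨ solve 3 (λ u q s → u :* q :+ q :* s := q :* (s :+ u)) ≋-refl (ι u) (ι q) (δ q S′) ⟩
        ι q ⊛ (δ q S′ ⊞ ι u)           ≈⟨ *-congˡ {ι q} (+-congˡ {δ q S′} (δ-ι q u)) ⟨
        ι q ⊛ (δ q S′ ⊞ δ q (ι u))     ≈⟨ *-congˡ {ι q} (δ-⊞ q S′ (ι u)) ⟨
        ι q ⊛ δ q (S′ ⊞ ι u)           ∎)
      Y≋ : T ⊛ δ q S ≋ ι 1# ⊞ z ⊛ ((ι q ⊛ δ q (ι u ⊛ T ⊞ ι 1#)) ⊛ (T ⊛ δ q S))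
      Y≋ = coefficient-cong (product-equation z (ι q) (ι (q · u)) {d = δ q T} (T-equation P)
                               (δ-equation′ q u (S-equation P))) (begin
        ι q ⊞ ι (q · u) ⊛ δ q T               ≈⟨ +-congˡ {ι q} (*-congʳ {δ q T} (ι-* q u)) ⟩
        ι q ⊞ ι q ⊛ ι u ⊛ δ q T               ≈⟨ solve 3 (λ u q s → q :+ q :* u :* s := q :* (u :* s :+ con 1)) ≋-refl (ι u) (ι q) (δ q T) ⟩
        ι q ⊛ (ι u ⊛ δ q T ⊞ ι 1#)            ≈⟨ *-congˡ {ι q} (δ-affine q u 1# T) ⟨
        ι q ⊛ δ q (ι u ⊛ T ⊞ ι 1#)            ∎)

    -- The second description of S, with the parameter multiplied by q on the right. This is the
    -- form in which S meets the queues of 321-avoiding words.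
    S-weighted : WeightedBy u S′ S
    S-weighted = begin
      S ⊞ z ⊛ S                                    ≈⟨ +-congʳ {z ⊛ S} (S-equation P) ⟩
      ι 1# ⊞ z ⊛ (ι u ⊛ (S ⊛ T)) ⊞ z ⊛ S           ≈⟨ solve 4 (λ z u s t → con 1 :+ z :* (u :* (s :* t)) :+ z :* s :=
                                                        con 1 :+ z :* ((u :* t :+ con 1) :* s)) ≋-refl z (ι u) S T ⟩
      ι 1# ⊞ z ⊛ ((ι u ⊛ T ⊞ ι 1#) ⊛ S)            ≈⟨ +-congˡ {ι 1#} (*-congˡ {z} (*-congʳ {S} S-shift)) ⟨
      ι 1# ⊞ z ⊛ ((S′ ⊞ ι u) ⊛ S)                  ≈⟨ +-congˡ {ι 1#} (*-congˡ {z} (*-congʳ {S} (+-comm S′ (ι u)))) ⟩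
      ι 1# ⊞ z ⊛ ((ι u ⊞ S′) ⊛ S)                  ∎

  -- A weight given as 1 + r′ supplies r - 1 without a subtraction. The weights 1, 1 + u and 1 + q /
  -- t of the two contractions are all of this form.
  weighted-cancel : ∀ {r r′ S F} → r ≈ᴿ 1# ∔ r′ → WeightedBy r S F → F ≋ ι 1# ⊞ z ⊛ ((ι r′ ⊞ S) ⊛ F)
  weighted-cancel {r} {r′} {S} {F} r≈ F≋ = cancelʳ (z ⊛ F) _ _ (begin
    F ⊞ z ⊛ F                                        ≈⟨ F≋ ⟩
    ι 1# ⊞ z ⊛ ((ι r ⊞ S) ⊛ F)                       ≈⟨ +-congˡ {ι 1#} (*-congˡ {z} (*-congʳ {F} (+-congʳ {S} (≋-trans (ι-cong r≈) (ι-+ 1# r′))))) ⟩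
    ι 1# ⊞ z ⊛ ((ι 1# ⊞ ι r′ ⊞ S) ⊛ F)               ≈⟨ solve 4 (λ z r s f → con 1 :+ z :* ((con 1 :+ r :+ s) :* f) :=
                                                          con 1 :+ z :* ((r :+ s) :* f) :+ z :* f) ≋-refl z (ι r′) S F ⟩
    ι 1# ⊞ z ⊛ ((ι r′ ⊞ S) ⊛ F) ⊞ z ⊛ F              ∎)

  ι-0 : ι 0# ≋ (λ _ → 0#)
  ι-0 zero    = R.refl
  ι-0 (suc n) = R.refl

  module _ {q u v : Carrier} {S T S′ T′ N F : Series} (v≈uq : v ≈ᴿ u · q)
           (P : StieltjesPair q u S T) (P′ : StieltjesPair q v S′ T′)
           (N≋ : WeightedBy 1# S N) (F≋ : WeightedBy (1# ∔ u) S′ F) where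

    -- With weight 1 the equation of N is N = 1 + z N S, so it remains to see that N S = F. The
    -- coefficient in the linear equation of N S is 1 + u T, which `S-shift` turns into u + S′; that
    -- is the coefficient in the equation of F.
    first-contraction : N ≋ ι 1# ⊞ z ⊛ F
    first-contraction = begin
      N                    ≈⟨ N≋′ ⟩
      ι 1# ⊞ z ⊛ (ι 1# ⊛ (N ⊛ S)) ≈⟨ +-congˡ {ι 1#} (*-congˡ {z} (⊛-identityˡ (N ⊛ S))) ⟩
      ι 1# ⊞ z ⊛ (N ⊛ S)   ≈⟨ +-congˡ {ι 1#} (*-congˡ {z} (solution-unique NS≋ (weighted-cancel R.refl F≋))) ⟩
      ι 1# ⊞ z ⊛ F         ∎
      where
      N≋′ : N ≋ ι 1# ⊞ z ⊛ (ι 1# ⊛ (N ⊛ S))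
      N≋′ = begin
        N                            ≈⟨ weighted-cancel (R.sym (R.+-identityʳ 1#)) N≋ ⟩
        ι 1# ⊞ z ⊛ ((ι 0# ⊞ S) ⊛ N)  ≈⟨ +-congˡ {ι 1#} (*-congˡ {z} (*-congʳ {N} (≋-trans (+-congʳ {S} ι-0) (+-identityˡ S)))) ⟩
        ι 1# ⊞ z ⊛ (S ⊛ N)           ≈⟨ solve 3 (λ z s n → con 1 :+ z :* (s :* n) := con 1 :+ z :* (con 1 :* (n :* s))) ≋-refl z S N ⟩
        ι 1# ⊞ z ⊛ (ι 1# ⊛ (N ⊛ S))  ∎
      NS≋ : N ⊛ S ≋ ι 1# ⊞ z ⊛ ((ι u ⊞ S′) ⊛ (N ⊛ S))
      NS≋ = coefficient-cong (product-equation z (ι 1#) (ι u) N≋′ (S-equation P)) (begin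
        ι 1# ⊞ ι u ⊛ T  ≈⟨ +-comm (ι 1#) (ι u ⊛ T) ⟩
        ι u ⊛ T ⊞ ι 1#  ≈⟨ S-shift v≈uq P P′ ⟨
        S′ ⊞ ι u        ≈⟨ +-comm S′ (ι u) ⟩
        ι u ⊞ S′        ∎)

  module _ {q t p : Carrier} {S T S′ T′ : Series} (tp≈qq : t · p ≈ᴿ q · q)
           (P : StieltjesPair q t S T) (P′ : StieltjesPair q p S′ T′) where

    -- Since t p = q², the continued fractions of S(q z) and S′(t z) have the coefficients qt, q²,
    -- q²t, q³, ... and q², qt, q³, q²t, .... The affine corrections bring both sides to q + t + z
    -- q² t X, where X is the product of the first two levels; the coefficients in the equations of
    -- these products are again q times the sides at q z.
    S-reflect : ι q ⊛ δ q S ⊞ ι t ≋ ι t ⊛ δ t S′ ⊞ ι q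
    S-reflect = bootstrap q {X = δ q S ⊛ δ q T} {Y = δ t S′ ⊛ δ t T′} {e = ι q ⊞ ι t} {m = ι q ⊛ (ι q ⊛ ι t)} A≋ B≋ X≋ Y≋
      where
      ιtp≋ : ι (t · p) ≋ ι q ⊛ ι q
      ιtp≋ = ≋-trans (ι-cong tp≈qq) (ι-* q q)
      A≋ : ι q ⊛ δ q S ⊞ ι t ≋ ι q ⊞ ι t ⊞ z ⊛ (ι q ⊛ (ι q ⊛ ι t) ⊛ (δ q S ⊛ δ q T))
      A≋ = begin
        ι q ⊛ δ q S ⊞ ι t
          ≈⟨ +-congʳ {ι t} (*-congˡ {ι q} (coefficient-cong (δ-equation′ q t (S-equation P)) (ι-* q t))) ⟩
        ι q ⊛ (ι 1# ⊞ z ⊛ (ι q ⊛ ι t ⊛ (δ q S ⊛ δ q T))) ⊞ ι t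
          ≈⟨ solve 4 (λ z q t y → q :* (con 1 :+ z :* (q :* t :* y)) :+ t :=
               q :+ t :+ z :* (q :* (q :* t) :* y)) ≋-refl z (ι q) (ι t) (δ q S ⊛ δ q T) ⟩
        ι q ⊞ ι t ⊞ z ⊛ (ι q ⊛ (ι q ⊛ ι t) ⊛ (δ q S ⊛ δ q T)) ∎
      B≋ : ι t ⊛ δ t S′ ⊞ ι q ≋ ι q ⊞ ι t ⊞ z ⊛ (ι q ⊛ (ι q ⊛ ι t) ⊛ (δ t S′ ⊛ δ t T′))
      B≋ = begin
        ι t ⊛ δ t S′ ⊞ ι q
          ≈⟨ +-congʳ {ι q} (*-congˡ {ι t} (coefficient-cong (δ-equation′ t p (S-equation P′)) ιtp≋)) ⟩
        ι t ⊛ (ι 1# ⊞ z ⊛ (ι q ⊛ ι q ⊛ (δ t S′ ⊛ δ t T′))) ⊞ ι q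
          ≈⟨ solve 4 (λ z q t y → t :* (con 1 :+ z :* (q :* q :* y)) :+ q :=
               q :+ t :+ z :* (q :* (q :* t) :* y)) ≋-refl z (ι q) (ι t) (δ t S′ ⊛ δ t T′) ⟩
        ι q ⊞ ι t ⊞ z ⊛ (ι q ⊛ (ι q ⊛ ι t) ⊛ (δ t S′ ⊛ δ t T′)) ∎
      X≋ : δ q S ⊛ δ q T ≋ ι 1# ⊞ z ⊛ ((ι q ⊛ δ q (ι q ⊛ δ q S ⊞ ι t)) ⊛ (δ q S ⊛ δ q T))
      X≋ = coefficient-cong (product-equation z (ι (q · t)) (ι (q · q)) {d = δ q (δ q S)}
                               (δ-equation′ q t (S-equation P)) (δ-equation′ q q (T-equation P))) (begin
        ι (q · t) ⊞ ι (q · q) ⊛ δ q (δ q S)          ≈⟨ +-cong (ι-* q t) (*-congʳ {δ q (δ q S)} (ι-* q q)) ⟩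
        ι q ⊛ ι t ⊞ ι q ⊛ ι q ⊛ δ q (δ q S)          ≈⟨ solve 3 (λ q t s → q :* t :+ q :* q :* s := q :* (q :* s :+ t)) ≋-refl (ι q) (ι t) _ ⟩
        ι q ⊛ (ι q ⊛ δ q (δ q S) ⊞ ι t)              ≈⟨ *-congˡ {ι q} (δ-affine q q t (δ q S)) ⟨
        ι q ⊛ δ q (ι q ⊛ δ q S ⊞ ι t)                ∎)
      Y≋ : δ t S′ ⊛ δ t T′ ≋ ι 1# ⊞ z ⊛ ((ι q ⊛ δ q (ι t ⊛ δ t S′ ⊞ ι q)) ⊛ (δ t S′ ⊛ δ t T′))
      Y≋ = coefficient-cong (product-equation z (ι (t · p)) (ι (t · q)) {d = δ t (δ q S′)}
                               (δ-equation′ t p (S-equation P′)) (δ-equation′ t q (T-equation P′))) (begin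
        ι (t · p) ⊞ ι (t · q) ⊛ δ t (δ q S′)         ≈⟨ +-cong ιtp≋ (*-cong (ι-* t q) (δ-comm t q S′)) ⟩
        ι q ⊛ ι q ⊞ ι t ⊛ ι q ⊛ δ q (δ t S′)         ≈⟨ solve 3 (λ q t s → q :* q :+ t :* q :* s := q :* (t :* s :+ q)) ≋-refl (ι q) (ι t) _ ⟩
        ι q ⊛ (ι t ⊛ δ q (δ t S′) ⊞ ι q)             ≈⟨ *-congˡ {ι q} (δ-affine q t q (δ t S′)) ⟨
        ι q ⊛ δ q (ι t ⊛ δ t S′ ⊞ ι q)               ∎)

  module _ {q t t⁻¹ p v : Carrier} {S T S′ T′ Sₚ Tₚ N F : Series}
           (v≈tq : v ≈ᴿ t · q) (tp≈qq : t · p ≈ᴿ q · q) (tt⁻¹≈1 : t · t⁻¹ ≈ᴿ 1#)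
           (P : StieltjesPair q t S T) (P′ : StieltjesPair q v S′ T′) (Pₚ : StieltjesPair q p Sₚ Tₚ)
           (N≋ : WeightedBy t S′ N) (F≋ : WeightedBy (1# ∔ q · t⁻¹) Sₚ F) where

    -- By `S-shift` the coefficient t - 1 + S′ in the equation of N is t T, so N and S solve the
    -- same equation. In S = 1 + z t S T the product S T has the coefficient t + q S(q z), while F(t
    -- z) has t (q / t + Sₚ(t z)) = q + t Sₚ(t z). These agree by `S-reflect`.
    second-contraction : N ≋ ι 1# ⊞ z ⊛ (ι t ⊛ δ t F)
    second-contraction = begin
      N                              ≈⟨ solution-unique N≋′ S≋′ ⟩
      S                              ≈⟨ S-equation P ⟩
      ι 1# ⊞ z ⊛ (ι t ⊛ (S ⊛ T))     ≈⟨ +-congˡ {ι 1#} (*-congˡ {z} (*-congˡ {ι t} (solution-unique ST≋ δF≋))) ⟩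
      ι 1# ⊞ z ⊛ (ι t ⊛ δ t F)       ∎
      where
      N≋′ : N ≋ ι 1# ⊞ z ⊛ ((ι t ⊛ T) ⊛ N)
      N≋′ = cancelʳ (z ⊛ N) _ _ (begin
        N ⊞ z ⊛ N                                ≈⟨ N≋ ⟩
        ι 1# ⊞ z ⊛ ((ι t ⊞ S′) ⊛ N)              ≈⟨ +-congˡ {ι 1#} (*-congˡ {z} (*-congʳ {N}
                                                      (≋-trans (+-comm (ι t) S′) (S-shift v≈tq P P′)))) ⟩
        ι 1# ⊞ z ⊛ ((ι t ⊛ T ⊞ ι 1#) ⊛ N)        ≈⟨ solve 3 (λ z a n → con 1 :+ z :* ((a :+ con 1) :* n) :=
                                                      con 1 :+ z :* (a :* n) :+ z :* n) ≋-refl z (ι t ⊛ T) N ⟩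
        ι 1# ⊞ z ⊛ ((ι t ⊛ T) ⊛ N) ⊞ z ⊛ N       ∎)
      S≋′ : S ≋ ι 1# ⊞ z ⊛ ((ι t ⊛ T) ⊛ S)
      S≋′ = ≋-trans (S-equation P) (solve 4 (λ z t s w → con 1 :+ z :* (t :* (s :* w)) :=
                                    con 1 :+ z :* (t :* w :* s)) ≋-refl z (ι t) S T)
      ST≋ : S ⊛ T ≋ ι 1# ⊞ z ⊛ ((ι q ⊛ δ q S ⊞ ι t) ⊛ (S ⊛ T))
      ST≋ = coefficient-cong (product-equation z (ι t) (ι q) (S-equation P) (T-equation P))
              (+-comm (ι t) (ι q ⊛ δ q S))
      F≋′ : F ≋ ι 1# ⊞ z ⊛ (ι 1# ⊛ ((ι (q · t⁻¹) ⊞ Sₚ) ⊛ F))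
      F≋′ = ≋-trans (weighted-cancel R.refl F≋) (+-congˡ {ι 1#} (*-congˡ {z} (≋-sym (⊛-identityˡ _))))
      -- The substitution of t z for z multiplies the coefficient in the equation of F by t, which
      -- clears the denominator of q / t.
      tqt⁻¹≈q : t · (q · t⁻¹) ≈ᴿ q
      tqt⁻¹≈q = R.trans (R.*-congˡ (R.*-comm q t⁻¹)) (R.trans (R.sym (R.*-assoc t t⁻¹ q))
                  (R.trans (R.*-congʳ tt⁻¹≈1) (R.*-identityˡ q)))
      δF≋ : δ t F ≋ ι 1# ⊞ z ⊛ ((ι q ⊛ δ q S ⊞ ι t) ⊛ δ t F)
      δF≋ = begin
        δ t F
          ≈⟨ δ-equation′ t 1# F≋′ ⟩
        ι 1# ⊞ z ⊛ (ι (t · 1#) ⊛ (δ t (ι (q · t⁻¹) ⊞ Sₚ) ⊛ δ t F))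
          ≈⟨ +-congˡ {ι 1#} (*-congˡ {z} (*-cong (ι-cong (R.*-identityʳ t)) (*-congʳ {δ t F}
               (≋-trans (δ-⊞ t (ι (q · t⁻¹)) Sₚ) (+-congʳ {δ t Sₚ} (δ-ι t (q · t⁻¹))))))) ⟩
        ι 1# ⊞ z ⊛ (ι t ⊛ ((ι (q · t⁻¹) ⊞ δ t Sₚ) ⊛ δ t F))
          ≈⟨ solve 5 (λ z t a s f → con 1 :+ z :* (t :* ((a :+ s) :* f)) :=
               con 1 :+ z :* ((t :* s :+ t :* a) :* f)) ≋-refl z (ι t) (ι (q · t⁻¹)) (δ t Sₚ) (δ t F) ⟩
        ι 1# ⊞ z ⊛ ((ι t ⊛ δ t Sₚ ⊞ ι t ⊛ ι (q · t⁻¹)) ⊛ δ t F)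
          ≈⟨ +-congˡ {ι 1#} (*-congˡ {z} (*-congʳ {δ t F} (+-congˡ {ι t ⊛ δ t Sₚ}
               (≋-trans (≋-sym (ι-* t (q · t⁻¹))) (ι-cong tqt⁻¹≈q))))) ⟩
        ι 1# ⊞ z ⊛ ((ι t ⊛ δ t Sₚ ⊞ ι q) ⊛ δ t F)
          ≈⟨ +-congˡ {ι 1#} (*-congˡ {z} (*-congʳ {δ t F} (S-reflect tp≈qq P Pₚ))) ⟨
        ι 1# ⊞ z ⊛ ((ι q ⊛ δ q S ⊞ ι t) ⊛ δ t F) ∎

-- Binary trees listed by size

data Tree : Set where
  leaf : Tree
  node : Tree → Tree → Tree

size : Tree → ℕ
size leaf       = 0
size (node l r) = suc (size l ℕ.+ size r)

node-injective : ∀ {a b c d} → node a b ≡ node c d → a ≡ c × b ≡ d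
node-injective refl = refl , refl

-- The recursion copies that of `_⊛_`, so that sums over grafted lists become Cauchy products clause
-- by clause.
graft : (ℕ → List Tree) → (ℕ → List Tree) → ℕ → List Tree
graft f g zero    = cartesianProductWith node (f 0) (g 0)
graft f g (suc n) = cartesianProductWith node (f 0) (g (suc n)) ++ graft (f ∘ suc) g n

-- The first argument is fuel: any value ≥ n gives the same list.
treesWithin : ℕ → ℕ → List Tree
treesWithin _       zero    = leaf ∷ []
treesWithin zero    (suc n) = []
treesWithin (suc k) (suc n) = graft (treesWithin k) (treesWithin k) n

trees : ℕ → List Tree
trees n = treesWithin n n

graft-cong : ∀ n {f f′ g g′} → (∀ i → i ℕ.≤ n → f i ≡ f′ i) → (∀ i → i ℕ.≤ n → g i ≡ g′ i) →
             graft f g n ≡ graft f′ g′ n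
graft-cong zero    f≡ g≡ = cong₂ (cartesianProductWith node) (f≡ 0 ℕ.z≤n) (g≡ 0 ℕ.z≤n)
graft-cong (suc n) f≡ g≡ = cong₂ _++_
  (cong₂ (cartesianProductWith node) (f≡ 0 ℕ.z≤n) (g≡ (suc n) ℕₚ.≤-refl))
  (graft-cong n (λ i i≤n → f≡ (suc i) (ℕ.s≤s i≤n)) (λ i i≤n → g≡ i (ℕₚ.m≤n⇒m≤1+n i≤n)))

treesWithin-stable : ∀ j k n → n ℕ.≤ j → n ℕ.≤ k → treesWithin j n ≡ treesWithin k n
treesWithin-stable j       k       zero    _           _           = refl
treesWithin-stable (suc j) (suc k) (suc n) (ℕ.s≤s n≤j) (ℕ.s≤s n≤k) = graft-cong n stable stable
  where
  stable : ∀ i → i ℕ.≤ n → treesWithin j i ≡ treesWithin k i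
  stable i i≤n = treesWithin-stable j k i (ℕₚ.≤-trans i≤n n≤j) (ℕₚ.≤-trans i≤n n≤k)

trees-suc : ∀ n → trees (suc n) ≡ graft trees trees n
trees-suc n = graft-cong n stable stable
  where
  stable : ∀ i → i ℕ.≤ n → treesWithin n i ≡ trees i
  stable i i≤n = treesWithin-stable n i i i≤n ℕₚ.≤-refl

∈-graft⁺ : ∀ f g i j {l r} → l ∈ f i → r ∈ g j → node l r ∈ graft f g (i ℕ.+ j)
∈-graft⁺ f g zero    zero    l∈ r∈ = ∈-cartesianProductWith⁺ node l∈ r∈
∈-graft⁺ f g zero    (suc j) l∈ r∈ = ∈-++⁺ˡ (∈-cartesianProductWith⁺ node l∈ r∈)
∈-graft⁺ f g (suc i) j       l∈ r∈ = ∈-++⁺ʳ _ (∈-graft⁺ (f ∘ suc) g i j l∈ r∈)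

∈-graft⁻ : ∀ f g n {t} → t ∈ graft f g n →
           ∃₂ λ i j → ∃₂ λ l r → i ℕ.+ j ≡ n × l ∈ f i × r ∈ g j × t ≡ node l r
∈-graft⁻ f g zero t∈ with l , r , l∈ , r∈ , t≡ ← ∈-cartesianProductWith⁻ node (f 0) (g 0) t∈ =
  0 , 0 , l , r , refl , l∈ , r∈ , t≡
∈-graft⁻ f g (suc n) t∈ with ∈-++⁻ (cartesianProductWith node (f 0) (g (suc n))) t∈
... | inj₁ t∈ˡ with l , r , l∈ , r∈ , t≡ ← ∈-cartesianProductWith⁻ node (f 0) (g (suc n)) t∈ˡ =
  0 , suc n , l , r , refl , l∈ , r∈ , t≡
... | inj₂ t∈ʳ with i , j , l , r , i+j≡n , l∈ , r∈ , t≡ ← ∈-graft⁻ (f ∘ suc) g n t∈ʳ =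
  suc i , j , l , r , cong suc i+j≡n , l∈ , r∈ , t≡

∈-trees⁺ : ∀ t → t ∈ trees (size t)
∈-trees⁺ leaf       = here refl
∈-trees⁺ (node l r) rewrite trees-suc (size l ℕ.+ size r) =
  ∈-graft⁺ trees trees (size l) (size r) (∈-trees⁺ l) (∈-trees⁺ r)

∈-treesWithin⇒size : ∀ k n {t} → t ∈ treesWithin k n → size t ≡ n
∈-treesWithin⇒size _       zero    (here refl) = refl
∈-treesWithin⇒size (suc k) (suc n) t∈
  with i , j , l , r , i+j≡n , l∈ , r∈ , refl ← ∈-graft⁻ (treesWithin k) (treesWithin k) n t∈ =
  cong suc (trans (cong₂ ℕ._+_ (∈-treesWithin⇒size k i l∈) (∈-treesWithin⇒size k j r∈)) i+j≡n)

∈-trees⇒size : ∀ n {t} → t ∈ trees n → size t ≡ n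
∈-trees⇒size n = ∈-treesWithin⇒size n n

-- Trees from different blocks have left subtrees of different sizes. The offset `d` records how
-- often `f` has been shifted by the recursion.
graft-unique : ∀ n {f g d} → (∀ i → Uniqueᴸ (f i)) → (∀ i → Uniqueᴸ (g i)) →
               (∀ i {t} → t ∈ f i → size t ≡ d ℕ.+ i) → Uniqueᴸ (graft f g n)
graft-unique zero    f! g! f-size = Uniqueₚ.cartesianProductWith⁺ node node-injective (f! 0) (g! 0)
graft-unique (suc n) {f} {g} {d} f! g! f-size = Uniqueₚ.++⁺
  (Uniqueₚ.cartesianProductWith⁺ node node-injective (f! 0) (g! (suc n)))
  (graft-unique n {d = suc d} (f! ∘ suc) g! (λ i t∈ → trans (f-size (suc i) t∈) (ℕₚ.+-suc d i)))
  disjoint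
  where
  disjoint : ∀ {t} → t ∈ cartesianProductWith node (f 0) (g (suc n)) × t ∈ graft (f ∘ suc) g n → _
  disjoint (t∈ , t∈′)
    with l , r , l∈ , r∈ , refl ← ∈-cartesianProductWith⁻ node (f 0) (g (suc n)) t∈
       | i , j , l , r , _ , l∈′ , _ , refl ← ∈-graft⁻ (f ∘ suc) g n t∈′
    with () ← ℕₚ.+-cancelˡ-≡ d 0 (suc i) (trans (sym (f-size 0 l∈)) (f-size (suc i) l∈′))

treesWithin-unique : ∀ k n → Uniqueᴸ (treesWithin k n)
treesWithin-unique _       zero    = All.[] AllPairs.∷ AllPairs.[]
treesWithin-unique zero    (suc n) = AllPairs.[]
treesWithin-unique (suc k) (suc n) = graft-unique n {d = 0}
  (treesWithin-unique k) (treesWithin-unique k) (λ i → ∈-treesWithin⇒size k i)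

-- Sums over lists and weighted generating series of trees

module Sums {c ℓ} (R : CommutativeRing c ℓ) where
  open CommutativeRing R renaming (refl to ≈-refl; sym to ≈-sym; trans to ≈-trans)
  open GeneratingFunctions R using (∑) public
  open SetoidReasoning setoid
  open SemiringSolver commutativeSemiring using (solve; _:=_; _:+_)

  module _ {a} {A : Set a} where

    ∑-cong-∈ : ∀ (xs : List A) {f g} → (∀ {x} → x ∈ xs → f x ≈ g x) → ∑ xs f ≈ ∑ xs g
    ∑-cong-∈ []       f≈g = ≈-refl
    ∑-cong-∈ (x ∷ xs) f≈g = +-cong (f≈g (here refl)) (∑-cong-∈ xs (f≈g ∘ there))

    ∑-cong : ∀ (xs : List A) {f g} → (∀ x → f x ≈ g x) → ∑ xs f ≈ ∑ xs g
    ∑-cong xs f≈g = ∑-cong-∈ xs (λ {x} _ → f≈g x)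

    ∑-++ : ∀ (xs ys : List A) f → ∑ (xs ++ ys) f ≈ ∑ xs f + ∑ ys f
    ∑-++ []       ys f = ≈-sym (+-identityˡ _)
    ∑-++ (x ∷ xs) ys f = ≈-trans (+-congˡ (∑-++ xs ys f)) (≈-sym (+-assoc _ _ _))

    ∑-scale : ∀ a (xs : List A) f → ∑ xs (λ x → a * f x) ≈ a * ∑ xs f
    ∑-scale a []       f = ≈-sym (zeroʳ a)
    ∑-scale a (x ∷ xs) f = ≈-trans (+-congˡ (∑-scale a xs f)) (≈-sym (distribˡ _ _ _))

    ∑-↭ : ∀ {xs ys : List A} f → xs ↭ ys → ∑ xs f ≈ ∑ ys f
    ∑-↭ f _↭_.refl         = ≈-refl
    ∑-↭ f (_↭_.prep x xs↭)     = +-congˡ (∑-↭ f xs↭)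
    ∑-↭ f (_↭_.swap x y xs↭)   = ≈-trans (+-congˡ (+-congˡ (∑-↭ f xs↭)))
      (solve 3 (λ a b c → a :+ (b :+ c) := b :+ (a :+ c)) ≈-refl _ _ _)
    ∑-↭ f (_↭_.trans p q)  = ≈-trans (∑-↭ f p) (∑-↭ f q)

  ∑-map : ∀ {a b} {A : Set a} {B : Set b} (h : A → B) xs f → ∑ (map h xs) f ≡ ∑ xs (f ∘ h)
  ∑-map h []       f = refl
  ∑-map h (x ∷ xs) f = cong (_ +_) (∑-map h xs f)

  ∑-cartesianProductWith : ∀ {a} {A : Set a} (h : A → A → A) {f g w : A → Carrier} →
    (∀ x y → w (h x y) ≈ f x * g y) → ∀ xs ys →
    ∑ (cartesianProductWith h xs ys) w ≈ ∑ xs f * ∑ ys g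
  ∑-cartesianProductWith h {f} {g} {w} w≈ []       ys = ≈-sym (zeroˡ _)
  ∑-cartesianProductWith h {f} {g} {w} w≈ (x ∷ xs) ys = begin
    ∑ (map (h x) ys ++ cartesianProductWith h xs ys) w      ≈⟨ ∑-++ (map (h x) ys) _ w ⟩
    ∑ (map (h x) ys) w + ∑ (cartesianProductWith h xs ys) w ≈⟨ +-cong (reflexive (∑-map (h x) ys w)) (∑-cartesianProductWith h w≈ xs ys) ⟩
    ∑ ys (w ∘ h x) + ∑ xs f * ∑ ys g                        ≈⟨ +-congʳ (∑-cong ys (w≈ x)) ⟩
    ∑ ys (λ y → f x * g y) + ∑ xs f * ∑ ys g                ≈⟨ +-congʳ (∑-scale (f x) ys g) ⟩
    f x * ∑ ys g + ∑ xs f * ∑ ys g                          ≈⟨ distribʳ _ _ _ ⟨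
    (f x + ∑ xs f) * ∑ ys g                                 ∎

module TreeSeries {c ℓ} (R : CommutativeRing c ℓ) where
  open CommutativeRing R renaming (refl to ≈-refl; sym to ≈-sym; trans to ≈-trans)
  open PowerSeries R
  open FunctionalEquations R
  open Sums R
  open GeneratingFunctions R using (_^_)
  open SetoidReasoning setoid
  open SemiringSolver commutativeSemiring using (solve; _:=_; _:*_; _:+_)
  private module S = CommutativeRing seriesRing

  treeSeries : (Tree → Carrier) → Series
  treeSeries w n = ∑ (trees n) w

  ∑-graft : ∀ {u v w} → (∀ l r → w (node l r) ≈ u l * v r) → ∀ n (f g : ℕ → List Tree) →
            ∑ (graft f g n) w ≈ ((λ i → ∑ (f i) u) ⊛ (λ i → ∑ (g i) v)) n
  ∑-graft w≈ zero    f g = ∑-cartesianProductWith node w≈ (f 0) (g 0)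
  ∑-graft {w = w} w≈ (suc n) f g = ≈-trans (∑-++ (cartesianProductWith node (f 0) (g (suc n))) _ w)
    (+-cong (∑-cartesianProductWith node w≈ (f 0) (g (suc n))) (∑-graft w≈ n (f ∘ suc) g))

  treeSeries-equation : ∀ {u v w} → w leaf ≈ 1# → (∀ l r → w (node l r) ≈ u l * v r) →
                        treeSeries w ≋ ι 1# ⊞ z ⊛ (treeSeries u ⊛ treeSeries v)
  treeSeries-equation {u} {v} {w} w-leaf w-node zero    = begin
    w leaf + 0#     ≈⟨ +-congʳ w-leaf ⟩
    1# + 0#         ≈⟨ +-congˡ (z⊛-zero (treeSeries u ⊛ treeSeries v)) ⟨
    1# + _          ∎
  treeSeries-equation {u} {v} {w} w-leaf w-node (suc n) = begin
    ∑ (trees (suc n)) w                       ≈⟨ reflexive (cong (λ ts → ∑ ts w) (trees-suc n)) ⟩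
    ∑ (graft trees trees n) w                 ≈⟨ ∑-graft w-node n trees trees ⟩
    (treeSeries u ⊛ treeSeries v) n           ≈⟨ z⊛-suc _ n ⟨
    (z ⊛ (treeSeries u ⊛ treeSeries v)) (suc n) ≈⟨ +-identityˡ _ ⟨
    0# + (z ⊛ (treeSeries u ⊛ treeSeries v)) (suc n) ∎

  treeSeries-scale : ∀ a w → treeSeries (λ t → a * w t) ≋ ι a ⊛ treeSeries w
  treeSeries-scale a w n = ≈-trans (∑-scale a (trees n) w) (≈-sym (ι⊛ a (treeSeries w) n))

  treeSeries-δ : ∀ a w → treeSeries (λ t → a ^ size t * w t) ≋ δ a (treeSeries w)
  treeSeries-δ a w n = ≈-trans
    (∑-cong-∈ (trees n) (λ t∈ → *-congʳ (reflexive (cong (a ^_) (∈-trees⇒size n t∈)))))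
    (∑-scale (a ^ n) (trees n) w)

  module _ (q u : Carrier) where

    mutual
      -- The weights are read off the equations of S and T, with `q ^ size l` realising the
      -- substitution of q z for z. Which subtree carries which weight matters only later: the
      -- choice here is the one that the statistics of 231-avoiding words produce.
      weightS : Tree → Carrier
      weightS leaf       = 1#
      weightS (node l r) = u * (weightS l * weightT r)

      weightT : Tree → Carrier
      weightT leaf       = 1#
      weightT (node l r) = q * (weightT r * (q ^ size l * weightS l))

    -- The right spine is followed, and each of its nodes without a left child has weight `r`; for
    -- 231-avoiding words these nodes are the double ascents counted by `fmax`.
    weightF : Carrier → Tree → Carrier
    weightF r leaf                  = 1#
    weightF r (node leaf t)         = r * weightF r t
    weightF r (node s@(node _ _) t) = weightS s * weightF r t

    seriesS seriesT : Series
    seriesS = treeSeries weightS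
    seriesT = treeSeries weightT

    seriesF : Carrier → Series
    seriesF r = treeSeries (weightF r)

    stieltjesPair : StieltjesPair q u seriesS seriesT
    stieltjesPair .StieltjesPair.S-equation = S.trans
      (treeSeries-equation {λ t → u * weightS t} ≈-refl (λ l r → ≈-sym (*-assoc _ _ _)))
      (S.+-congˡ {ι 1#} (S.*-congˡ {z} (S.trans (S.*-congʳ (treeSeries-scale u weightS))
        (S.*-assoc (ι u) seriesS seriesT))))
    stieltjesPair .StieltjesPair.T-equation = S.trans
      (treeSeries-equation {λ t → q ^ size t * weightS t} {λ t → q * weightT t} ≈-refl
        (λ l r → solve 3 (λ q x y → q :* (x :* y) := y :* (q :* x)) ≈-refl _ _ _))
      (S.+-congˡ {ι 1#} (S.*-congˡ {z} (S.trans
        (S.*-cong (treeSeries-δ q weightS) (treeSeries-scale q weightT))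
        (S.trans (S.*-comm (δ q seriesS) (ι q ⊛ seriesT)) (S.*-assoc (ι q) seriesT (δ q seriesS))))))

    -- The left subtrees along the right spine carry the weight of S, except that a leaf weighs r
    -- instead of 1. Their series C therefore satisfies C + 1 = r + S, and F = 1 + z C F.
    seriesF-weighted : ∀ r → WeightedBy r seriesS (seriesF r)
    seriesF-weighted r = S.trans (S.+-congʳ {z ⊛ seriesF r} F≋)
      (S.trans (S.+-assoc (ι 1#) _ _) (S.+-congˡ {ι 1#} (S.trans (S.sym (S.distribˡ z _ _))
        (S.*-congˡ {z} (S.trans (S.+-congˡ {treeSeries weightC ⊛ seriesF r} (S.sym (⊛-identityˡ (seriesF r))))
          (S.trans (S.sym (S.distribʳ (seriesF r) _ _)) (S.*-congʳ C≋)))))))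
      where
      weightC : Tree → Carrier
      weightC leaf         = r
      weightC s@(node _ _) = weightS s
      weightF-node : ∀ s t → weightF r (node s t) ≈ weightC s * weightF r t
      weightF-node leaf       t = ≈-refl
      weightF-node (node _ _) t = ≈-refl
      F≋ : seriesF r ≋ ι 1# ⊞ z ⊛ (treeSeries weightC ⊛ seriesF r)
      F≋ = treeSeries-equation ≈-refl weightF-node
      C≋ : treeSeries weightC ⊞ ι 1# ≋ ι r ⊞ seriesS
      C≋ zero    = solve 3 (λ r o z → r :+ z :+ o := r :+ (o :+ z)) ≈-refl r 1# 0#
      C≋ (suc n) = ≈-trans (+-identityʳ _) (≈-trans (∑-cong-∈ (trees (suc n)) agree) (≈-sym (+-identityˡ _)))
        where
        agree : ∀ {t} → t ∈ trees (suc n) → weightC t ≈ weightS t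
        agree {leaf}     t∈ with () ← ∈-trees⇒size (suc n) t∈
        agree {node _ _} t∈ = ≈-refl

-- 321-avoiding words and the queue of skipped letters

module Words where
  open import Data.Nat hiding (zero; suc; ℕ; _≤_; _∸_)
  open import Data.Nat.Properties
  open CommutativeSemigroupₚ +-commutativeSemigroup using (interchange; x∙yz≈y∙xz)

  𝟙 : ∀ {p} {P : Set p} → Dec P → ℕ
  𝟙 P? = if does P? then 1 else 0

  count : ∀ {a p} {A : Set a} {P : A → Set p} → Decidable P → List A → ℕ
  count P? xs = length (filter P? xs)

  Avoids : (ℕ → ℕ → ℕ → Set) → List ℕ → Set
  Avoids P []      = ⊤
  Avoids P (x ∷ l) = AllPairs (P x) l × Avoids P l

  Not321 Not231 : ℕ → ℕ → ℕ → Set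
  Not321 x y w = ¬ (w < y × y < x)
  Not231 x y w = ¬ (w < x × x < y)

  interval : ℕ → ℕ → List ℕ
  interval = iterate suc

  ∈-interval : ∀ o n {x} → x ∈ interval o n → o ≤ x × x < o + n
  ∈-interval o (suc n) (here refl) = ≤-refl , m<m+n o z<s
  ∈-interval o (suc n) (there x∈) with o<x , x<o+n ← ∈-interval (suc o) n x∈ =
    <⇒≤ o<x , <-≤-trans x<o+n (≤-reflexive (sym (+-suc o n)))

  excFrom fixFrom : ℕ → List ℕ → ℕ
  excFrom p []      = 0
  excFrom p (x ∷ l) = 𝟙 (p <? x) + excFrom (suc p) l
  fixFrom p []      = 0
  fixFrom p (x ∷ l) = 𝟙 (x ≟ p) + fixFrom (suc p) l

  invᴸ : List ℕ → ℕ
  invᴸ []      = 0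
  invᴸ (x ∷ l) = count (_<? x) l + invᴸ l

  -- A 321-avoiding word is read from left to right.  If the letters smaller than m
  -- that are still to come are those of the list L, and the others are the n
  -- letters m, …, m + n - 1, then the next letter is the head of L, since L comes in
  -- increasing order, or a new maximum, and all letters that it skips join L.
  mutual
    arrangements : List ℕ → ℕ → ℕ → List (List ℕ)
    arrangements L m n = fromQueue L m n ++ newMaximum L m n

    fromQueue : List ℕ → ℕ → ℕ → List (List ℕ)
    fromQueue []      m zero    = [ [] ]
    fromQueue []      m (suc n) = []
    fromQueue (x ∷ L) m n       = map (x ∷_) (arrangements L m n)

    newMaximum : List ℕ → ℕ → ℕ → List (List ℕ)
    newMaximum L m zero    = []
    newMaximum L m (suc n) = map (m ∷_) (arrangements L (suc m) n) ++ newMaximum (L ∷ʳ m) (suc m) n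

  Queue : List ℕ → ℕ → Set
  Queue L m = AllPairs _<_ L × All (_< m) L

  Queue-tail : ∀ {x L m} → Queue (x ∷ L) m → Queue L m
  Queue-tail (_ ∷ sorted , _ ∷ below) = sorted , below

  Queue-suc : ∀ {L m} → Queue L m → Queue L (suc m)
  Queue-suc (sorted , below) = sorted , All.map m≤n⇒m≤1+n below

  Queue-∷ʳ : ∀ {L m} → Queue L m → Queue (L ∷ʳ m) (suc m)
  Queue-∷ʳ {m = m} (sorted , below) =
    AllPairsₚ.++⁺ sorted ([] ∷ []) (All.map (λ x<m → x<m ∷ []) below) ,
    Allₚ.++⁺ (All.map m≤n⇒m≤1+n below) (n<1+n m ∷ [])

  Not321-antitone : ∀ {m m′ l} → m ≤ m′ → AllPairs (Not321 m′) l → AllPairs (Not321 m) l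
  Not321-antitone m≤m′ = AllPairs.map (λ ok (w<y , y<m) → ok (w<y , <-≤-trans y<m m≤m′))

  Avoids321-antitone : ∀ {m m′ l} → m ≤ m′ → Avoids Not321 (m′ ∷ l) → Avoids Not321 (m ∷ l)
  Avoids321-antitone m≤m′ (low , rest) = Not321-antitone m≤m′ low , rest

  ∷ʳ-shift : ∀ (L : List ℕ) m n → L ∷ʳ m ++ interval (suc m) n ≡ L ++ interval m (suc n)
  ∷ʳ-shift L m n = Listₚ.++-assoc L [ m ] _

  head-minimal : ∀ {x L m n w} → Queue (x ∷ L) m → w ∈ L ++ interval m n → x < w
  head-minimal {L = L} {m} {n} (x<L ∷ _ , x<m ∷ _) w∈ with ∈-++⁻ L w∈
  ... | inj₁ w∈L = All.lookup x<L w∈L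
  ... | inj₂ w∈i = <-≤-trans x<m (proj₁ (∈-interval m n w∈i))

  mutual
    -- The letter `m` placed in front of `l` is a device: avoiding 321 with it in first place says
    -- that the letters of `l` below `m` appear in increasing order. The queue maintains this, and
    -- it keeps earlier maxima from starting a 321.
    arrangements-sound : ∀ L m n {l} → Queue L m → l ∈ arrangements L m n →
                         l ↭ L ++ interval m n × Avoids Not321 (m ∷ l)
    arrangements-sound L m n queue l∈ with ∈-++⁻ (fromQueue L m n) l∈
    ... | inj₁ l∈ˡ = fromQueue-sound L m n queue l∈ˡ
    ... | inj₂ l∈ʳ = newMaximum-sound L m n queue l∈ʳ

    fromQueue-sound : ∀ L m n {l} → Queue L m → l ∈ fromQueue L m n →
                      l ↭ L ++ interval m n × Avoids Not321 (m ∷ l)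
    fromQueue-sound []      m zero queue (here refl) = ↭-refl , [] , tt
    fromQueue-sound (x ∷ L) m n    queue l∈
      with l′ , l′∈ , refl ← ∈-map⁻ (x ∷_) l∈
      with l′↭ , low , rest ← arrangements-sound L m n (Queue-tail queue) l′∈ =
      ↭-prep x l′↭ ,
      All.tabulate (λ w∈l′ (w<x , _) → <-asym w<x (head-minimal queue (∈-resp-↭ l′↭ w∈l′))) ∷ low ,
      Not321-antitone (<⇒≤ (All.head (proj₂ queue))) low , rest

    newMaximum-sound : ∀ L m n {l} → Queue L m → l ∈ newMaximum L m n →
                       l ↭ L ++ interval m n × Avoids Not321 (m ∷ l)
    newMaximum-sound L m (suc n) queue l∈ with ∈-++⁻ (map (m ∷_) (arrangements L (suc m) n)) l∈
    ... | inj₁ l∈ˡ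
      with l′ , l′∈ , refl ← ∈-map⁻ (m ∷_) l∈ˡ
      with l′↭ , low ← arrangements-sound L (suc m) n (Queue-suc queue) l′∈
      with low′ , rest ← Avoids321-antitone (n≤1+n m) low =
      ↭-trans (↭-prep m l′↭) (↭-sym (shift m L _)) ,
      All.tabulate (λ _ (_ , m<m) → <-irrefl refl m<m) ∷ low′ , low′ , rest
    ... | inj₂ l∈ʳ
      with l↭ , low ← newMaximum-sound (L ∷ʳ m) (suc m) n (Queue-∷ʳ queue) l∈ʳ =
      ↭-trans l↭ (↭-reflexive (∷ʳ-shift L m n)) , Avoids321-antitone (n≤1+n m) low

  -- Once `m` has been placed it does not occur in the rest, so being below m + 1 there means being
  -- below m.
  Not321-suc : ∀ {m l} → All (_≢ m) l → AllPairs (Not321 m) l → AllPairs (Not321 (suc m)) l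
  Not321-suc []          []           = []
  Not321-suc (x≢m ∷ l≢m) (ok ∷ oks) =
    All.map (λ ok′ (w<x , x<1+m) → ok′ (w<x , ≤∧≢⇒< (s≤s⁻¹ x<1+m) x≢m)) ok ∷ Not321-suc l≢m oks

  mutual
    arrangements-complete : ∀ L m n l → Queue L m → l ↭ L ++ interval m n →
                            Avoids Not321 (m ∷ l) → l ∈ arrangements L m n
    arrangements-complete []      m zero    [] queue l↭ avoids = here refl
    arrangements-complete []      m (suc n) [] queue l↭ avoids = case ↭-empty-inv (↭-sym l↭) of λ ()
    arrangements-complete (x ∷ L) m n       [] queue l↭ avoids = case ↭-empty-inv (↭-sym l↭) of λ ()
    arrangements-complete L m n (x ∷ l) queue l↭ avoids with x <? m
    ... | no  x≮m = ∈-++⁺ʳ (fromQueue L m n) (newMaximum-complete L m n x l queue (≮⇒≥ x≮m) l↭ avoids)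
    ... | yes x<m = ∈-++⁺ˡ (fromQueue-complete L m n x l queue x<m l↭ avoids)

    fromQueue-complete : ∀ L m n x l → Queue L m → x < m → x ∷ l ↭ L ++ interval m n →
                         Avoids Not321 (m ∷ x ∷ l) → x ∷ l ∈ fromQueue L m n
    fromQueue-complete [] m n x l queue x<m l↭ avoids =
      contradiction (proj₁ (∈-interval m n (∈-resp-↭ l↭ (here refl)))) (<⇒≱ x<m)
    fromQueue-complete (y ∷ L) m n x l queue x<m l↭ (ok ∷ low , _ , rest) with x ≟ y
    ... | yes refl = ∈-map⁺ (x ∷_) (arrangements-complete L m n l (Queue-tail queue) (drop-∷ l↭) (low , rest))
    ... | no  x≢y with ∈-resp-↭ (↭-sym l↭) (here refl) | ∈-resp-↭ l↭ (here refl)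
    ...   | here y≡x   | _          = contradiction (sym y≡x) x≢y
    ...   | there _    | here x≡y   = contradiction x≡y x≢y
    -- If a queued letter `x` came before the head `y`, then `m`, `x`, `y` would form a 321, because
    -- y < x < m.
    ...   | there y∈l  | there x∈   = contradiction (head-minimal queue x∈ , x<m) (All.lookup ok y∈l)

    newMaximum-complete : ∀ L m n x l → Queue L m → m ≤ x → x ∷ l ↭ L ++ interval m n →
                          Avoids Not321 (m ∷ x ∷ l) → x ∷ l ∈ newMaximum L m n
    newMaximum-complete L m zero x l queue m≤x l↭ avoids =
      contradiction (All.lookup (proj₂ queue) (subst (x ∈_) (Listₚ.++-identityʳ L) (∈-resp-↭ l↭ (here refl)))) (≤⇒≯ m≤x)
    newMaximum-complete L m (suc n) x l queue m≤x l↭ (ok ∷ low , low′ , rest) with x ≟ m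
    ... | yes refl = ∈-++⁺ˡ (∈-map⁺ (x ∷_) (arrangements-complete L (suc m) n l (Queue-suc queue) l′↭
                       (Not321-suc (All-resp-↭ (↭-sym l′↭) fresh) low , rest)))
      where
      l′↭ : l ↭ L ++ interval (suc m) n
      l′↭ = drop-mid [] L l↭
      fresh : All (_≢ m) (L ++ interval (suc m) n)
      fresh = Allₚ.++⁺ (All.map <⇒≢ (proj₂ queue))
                (All.tabulate (λ w∈ → >⇒≢ (proj₁ (∈-interval (suc m) n w∈))))
    ... | no  x≢m = ∈-++⁺ʳ (map (m ∷_) (arrangements L (suc m) n))
      (newMaximum-complete (L ∷ʳ m) (suc m) n x l (Queue-∷ʳ queue) m<x
        (↭-trans l↭ (↭-reflexive (sym (∷ʳ-shift L m n))))
        -- The letter `m` is skipped by a larger `x`. The order of the letters below m + 1 is now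
        -- enforced by `x` itself, which precedes all of them.
        (All.tabulate (λ _ (_ , x<1+m) → <⇒≱ x<1+m m<x) ∷ Not321-antitone m<x low′ , low′ , rest))
      where
      m<x : m < x
      m<x = ≤∧≢⇒< m≤x (x≢m ∘ sym)

  -- The first letter separates the branches: it is below `m` when taken from the queue, equal to
  -- `m` when nothing is skipped, and above `m` when `m` is skipped.
  newMaximum-head : ∀ L m n {x l} → x ∷ l ∈ newMaximum L m n → m ≤ x
  newMaximum-head L m (suc n) l∈ with ∈-++⁻ (map (m ∷_) (arrangements L (suc m) n)) l∈
  ... | inj₁ l∈ˡ with _ , _ , refl ← ∈-map⁻ (m ∷_) l∈ˡ = ≤-refl
  ... | inj₂ l∈ʳ = <⇒≤ (newMaximum-head (L ∷ʳ m) (suc m) n l∈ʳ)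

  mutual
    arrangements-unique : ∀ L m n → Queue L m → Uniqueᴸ (arrangements L m n)
    arrangements-unique L m n queue = Uniqueₚ.++⁺ (fromQueue-unique L m n queue) (newMaximum-unique L m n queue)
      (λ (l∈ , l∈′) → disjoint L n queue l∈ l∈′)
      where
      disjoint : ∀ L n {l} → Queue L m → l ∈ fromQueue L m n → l ∈ newMaximum L m n → ⊥
      disjoint []      zero queue (here refl) ()
      disjoint (x ∷ L) n (_ , x<m ∷ _) l∈ l∈′ with _ , _ , refl ← ∈-map⁻ (x ∷_) l∈ =
        <⇒≱ x<m (newMaximum-head (x ∷ L) m n l∈′)

    fromQueue-unique : ∀ L m n → Queue L m → Uniqueᴸ (fromQueue L m n)
    fromQueue-unique []      m zero    queue = [] ∷ []
    fromQueue-unique []      m (suc n) queue = []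
    fromQueue-unique (x ∷ L) m n       queue =
      Uniqueₚ.map⁺ Listₚ.∷-injectiveʳ (arrangements-unique L m n (Queue-tail queue))

    newMaximum-unique : ∀ L m n → Queue L m → Uniqueᴸ (newMaximum L m n)
    newMaximum-unique L m zero    queue = []
    newMaximum-unique L m (suc n) queue = Uniqueₚ.++⁺
      (Uniqueₚ.map⁺ Listₚ.∷-injectiveʳ (arrangements-unique L (suc m) n (Queue-suc queue)))
      (newMaximum-unique (L ∷ʳ m) (suc m) n (Queue-∷ʳ queue))
      disjoint
      where
      disjoint : ∀ {l} → l ∈ map (m ∷_) (arrangements L (suc m) n) × l ∈ newMaximum (L ∷ʳ m) (suc m) n → ⊥
      disjoint (l∈ , l∈′) with _ , _ , refl ← ∈-map⁻ (m ∷_) l∈ =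
        <-irrefl refl (newMaximum-head (L ∷ʳ m) (suc m) n l∈′)

  𝟙-yes : ∀ {p} {P : Set p} (P? : Dec P) → P → 𝟙 P? ≡ 1
  𝟙-yes P? p rewrite dec-true P? p = refl

  𝟙-no : ∀ {p} {P : Set p} (P? : Dec P) → ¬ P → 𝟙 P? ≡ 0
  𝟙-no P? ¬p rewrite dec-false P? ¬p = refl

  module _ {a p} {A : Set a} {P : A → Set p} (P? : Decidable P) where

    count-all : ∀ {xs} → All P xs → count P? xs ≡ length xs
    count-all pxs = cong length (Listₚ.filter-all P? pxs)

    count-none : ∀ {xs} → All (¬_ ∘ P) xs → count P? xs ≡ 0
    count-none ¬pxs = cong length (Listₚ.filter-none P? ¬pxs)

    count-++ : ∀ xs ys → count P? (xs ++ ys) ≡ count P? xs + count P? ys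
    count-++ xs ys = trans (cong length (Listₚ.filter-++ P? xs ys)) (Listₚ.length-++ (filter P? xs))

    count-↭ : ∀ {xs ys} → xs ↭ ys → count P? xs ≡ count P? ys
    count-↭ xs↭ys = ↭-length (filter-↭ P? xs↭ys)

  -- If the queue were emptied at once from position `p` on, every letter would be smaller than its
  -- position. Delays only increase the positions, so queued letters never become excedances or
  -- fixed points.
  AntiExcedances : ℕ → List ℕ → Set
  AntiExcedances p []      = ⊤
  AntiExcedances p (x ∷ L) = x < p × AntiExcedances (suc p) L

  AntiExcedances-suc : ∀ {p} L → AntiExcedances p L → AntiExcedances (suc p) L
  AntiExcedances-suc []      _            = tt
  AntiExcedances-suc (x ∷ L) (x<p , rest) = m≤n⇒m≤1+n x<p , AntiExcedances-suc L rest

  AntiExcedances-∷ʳ : ∀ p L {m} → p + length L ≡ m → AntiExcedances (suc p) L → AntiExcedances (suc p) (L ∷ʳ m)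
  AntiExcedances-∷ʳ p []      p≡m _            = s≤s (≤-reflexive (trans (sym p≡m) (+-identityʳ p))) , tt
  AntiExcedances-∷ʳ p (x ∷ L) p≡m (x<p , rest) =
    x<p , AntiExcedances-∷ʳ (suc p) L (trans (sym (+-suc p (length L))) p≡m) rest

  count-smaller : ∀ {L m n l} → Queue L m → l ↭ L ++ interval (suc m) n → count (_<? m) l ≡ length L
  count-smaller {L} {m} {n} {l} (_ , below) l↭ = begin
    count (_<? m) l                                        ≡⟨ count-↭ (_<? m) l↭ ⟩
    count (_<? m) (L ++ interval (suc m) n)                ≡⟨ count-++ (_<? m) L _ ⟩
    count (_<? m) L + count (_<? m) (interval (suc m) n)   ≡⟨ cong₂ _+_ (count-all (_<? m) below) (count-none (_<? m)
      (All.tabulate (λ x∈ x<m → <-asym x<m (proj₁ (∈-interval (suc m) n x∈))))) ⟩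
    length L + 0                                           ≡⟨ +-identityʳ _ ⟩
    length L                                               ∎
    where open ≡.≡-Reasoning

  m+1+n≡o⇒m<o : ∀ m {n o} → m + suc n ≡ o → m < o
  m+1+n≡o⇒m<o m m+1+n≡o = <-≤-trans (m<m+n m z<s) (≤-reflexive m+1+n≡o)

  -- The generating series of 321-avoiding words

  module Sum321 {c ℓ} (R : CommutativeRing c ℓ) where
    open CommutativeRing R
      using (Carrier; 1#; 0#; _≈_; setoid; commutativeSemiring; semiring; +-congˡ; +-congʳ; +-cong; *-congˡ; *-congʳ)
      renaming (*-comm to ⊗-comm; *-assoc to ⊗-assoc; _+_ to _⊕_; _*_ to _⊗_; refl to ≈-refl; sym to ≈-sym;
        trans to ≈-trans; +-identityʳ to ⊕-identityʳ; +-group to ⊕-group)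
    open Exp semiring using (^-homo-*) renaming (_^_ to _⋆_)
    open PowerSeries R
    open FunctionalEquations R
    open Sums R
    open TreeSeries R
    private module S = CommutativeRing seriesRing
    open SemiringSolver commutativeSemiring using (solve; _:=_; _:+_; _:*_; con)
    open GroupProperties ⊕-group using () renaming (∙-cancelʳ to ⊕-cancelʳ)

    module _ (t q r : Carrier) where

      parameter : ℕ → Carrier
      parameter k = t ⊗ q ⋆ suc k

      parameter-suc : ∀ k → parameter (suc k) ≈ parameter k ⊗ q
      parameter-suc k = ≈-trans (*-congˡ (⊗-comm q (q ⋆ suc k))) (≈-sym (⊗-assoc t (q ⋆ suc k) q))

      -- The series of the words with k letters in the queue, by the number of
      -- other letters, and the weight of a new maximum that exceeds k later letters.
      queueSeries : ℕ → Series
      queueSeries zero    = seriesF q (parameter 0) r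
      queueSeries (suc k) = seriesS q (parameter k) ⊛ queueSeries k

      pop : ℕ → Series
      pop zero    = ι 1#
      pop (suc k) = queueSeries k

      maximumWeight : ℕ → Carrier
      maximumWeight zero    = r
      maximumWeight (suc k) = parameter k

      -- A nonempty word starts with a letter of the queue, or with `m`, or it skips `m`. In the
      -- last case it is a word for k + 1 queued letters that does not start from the queue; those
      -- that do start from it have the series `pop (suc k)`, which is `queueSeries k`, and they
      -- account for the extra term on the left. For k > 0 the equation is `S-weighted` multiplied
      -- by the series of the remaining queue.
      queueSeries-equation : ∀ k → queueSeries k ⊞ z ⊛ queueSeries k ≋
        pop k ⊞ z ⊛ (ι (maximumWeight k) ⊛ queueSeries k ⊞ queueSeries (suc k))
      queueSeries-equation zero = S.trans (seriesF-weighted q (parameter 0) r)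
        (S.+-congˡ {ι 1#} (S.*-congˡ {z} (S.distribʳ (queueSeries 0) (ι r) (seriesS q (parameter 0)))))
      queueSeries-equation (suc k) = begin
        S ⊛ Q ⊞ z ⊛ (S ⊛ Q)                    ≈⟨ Solver.solve 3 (λ z s q →
          s Solver.:* q Solver.:+ z Solver.:* (s Solver.:* q) Solver.:= (s Solver.:+ z Solver.:* s) Solver.:* q) S.refl z S Q ⟩
        (S ⊞ z ⊛ S) ⊛ Q                        ≈⟨ S.*-congʳ {Q} (S-weighted (parameter-suc k)
          (stieltjesPair q (parameter k)) (stieltjesPair q (parameter (suc k)))) ⟩
        (ι 1# ⊞ z ⊛ ((ι u ⊞ S′) ⊛ S)) ⊛ Q      ≈⟨ Solver.solve 5 (λ z u s s′ q →
          (Solver.con 1 Solver.:+ z Solver.:* ((u Solver.:+ s′) Solver.:* s)) Solver.:* q Solver.:=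
          q Solver.:+ z Solver.:* (u Solver.:* (s Solver.:* q) Solver.:+ s′ Solver.:* (s Solver.:* q))) S.refl z (ι u) S S′ Q ⟩
        Q ⊞ z ⊛ (ι u ⊛ (S ⊛ Q) ⊞ S′ ⊛ (S ⊛ Q)) ∎
        where
        open SetoidReasoning S.setoid
        module Solver = SemiringSolver S.commutativeSemiring
        Q = queueSeries k
        u = parameter k
        S = seriesS q u
        S′ = seriesS q (parameter (suc k))

      queueSeries-suc : ∀ k n → queueSeries k (suc n) ⊕ queueSeries k n ≈
        pop k (suc n) ⊕ (maximumWeight k ⊗ queueSeries k n ⊕ queueSeries (suc k) n)
      queueSeries-suc k n = begin
        Q (suc n) ⊕ Q n                 ≈⟨ +-congˡ (z⊛-suc Q n) ⟨
        Q (suc n) ⊕ (z ⊛ Q) (suc n)     ≈⟨ queueSeries-equation k (suc n) ⟩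
        pop k (suc n) ⊕ (z ⊛ (ι w ⊛ Q ⊞ queueSeries (suc k))) (suc n)
                                        ≈⟨ +-congˡ (z⊛-suc (ι w ⊛ Q ⊞ queueSeries (suc k)) n) ⟩
        pop k (suc n) ⊕ ((ι w ⊛ Q) n ⊕ queueSeries (suc k) n)
                                        ≈⟨ +-congˡ (+-congʳ (ι⊛ w Q n)) ⟩
        pop k (suc n) ⊕ (w ⊗ Q n ⊕ queueSeries (suc k) n) ∎
        where
        open SetoidReasoning setoid
        Q = queueSeries k
        w = maximumWeight k

      queueSeries-zero : ∀ k → pop k 0 ≈ queueSeries k 0
      queueSeries-zero k = begin
        pop k 0                               ≈⟨ ⊕-identityʳ _ ⟨
        pop k 0 ⊕ 0#                          ≈⟨ +-congˡ (z⊛-zero C) ⟨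
        pop k 0 ⊕ (z ⊛ C) 0                   ≈⟨ queueSeries-equation k 0 ⟨
        queueSeries k 0 ⊕ (z ⊛ queueSeries k) 0 ≈⟨ +-congˡ (z⊛-zero (queueSeries k)) ⟩
        queueSeries k 0 ⊕ 0#                  ≈⟨ ⊕-identityʳ _ ⟩
        queueSeries k 0                       ∎
        where
        open SetoidReasoning setoid
        C = ι (maximumWeight k) ⊛ queueSeries k ⊞ queueSeries (suc k)

      weight321 : ℕ → List ℕ → Carrier
      weight321 p l = t ⋆ excFrom p l ⊗ q ⋆ invᴸ l ⊗ r ⋆ fixFrom p l

      -- The head of the queue is the smallest letter left, so it starts no inversion, and it is
      -- neither an excedance nor a fixed point since it lies below its position.
      weight-queue : ∀ {L m n x p l} → Queue (x ∷ L) m → x < p → l ↭ L ++ interval m n →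
                     weight321 p (x ∷ l) ≈ weight321 (suc p) l
      weight-queue {x = x} {p} {l} queue x<p l↭
        rewrite 𝟙-no (p <? x) (<-asym x<p) | 𝟙-no (x ≟ p) (<⇒≢ x<p)
              | count-none (_<? x) {l} (All.tabulate (λ w∈ w<x → <-asym w<x (head-minimal queue (∈-resp-↭ l↭ w∈)))) = ≈-refl

      -- The later letters smaller than `m` are those of the queue, so `m` starts `length L`
      -- inversions. It stands at position p = m - `length L`: a fixed point if the queue is empty,
      -- and otherwise an excedance.
      weight-maximum : ∀ {L m n p l} → Queue L m → p + length L ≡ m → l ↭ L ++ interval (suc m) n →
                       weight321 p (m ∷ l) ≈ maximumWeight (length L) ⊗ weight321 (suc p) l
      weight-maximum {[]} {m} {n} {p} {l} queue p≡m l↭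
        rewrite trans (sym (+-identityʳ p)) p≡m
              | 𝟙-no (m <? m) (<-irrefl refl) | 𝟙-yes (m ≟ m) refl | count-smaller queue l↭ =
        solve 4 (λ a b c r → a :* b :* (r :* c) := r :* (a :* b :* c)) ≈-refl _ _ _ r
      weight-maximum {L@(_ ∷ L′)} {m} {n} {p} {l} queue p≡m l↭
        rewrite 𝟙-yes (p <? m) (m+1+n≡o⇒m<o p p≡m) | 𝟙-no (m ≟ p) (>⇒≢ (m+1+n≡o⇒m<o p p≡m)) | count-smaller queue l↭ = begin
        t ⊗ t ⋆ e ⊗ q ⋆ (suc (length L′) + i) ⊗ r ⋆ f
          ≈⟨ *-congʳ (*-congˡ (^-homo-* q (suc (length L′)) i)) ⟩
        t ⊗ t ⋆ e ⊗ (q ⋆ suc (length L′) ⊗ q ⋆ i) ⊗ r ⋆ f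
          ≈⟨ solve 5 (λ t a b c d → t :* a :* (b :* c) :* d := t :* b :* (a :* c :* d)) ≈-refl t _ _ _ _ ⟩
        t ⊗ q ⋆ suc (length L′) ⊗ (t ⋆ e ⊗ q ⋆ i ⊗ r ⋆ f) ∎
        where
        open SetoidReasoning setoid
        e = excFrom (suc p) l
        i = invᴸ l
        f = fixFrom (suc p) l

      mutual
        -- The equation `p + length L ≡ m` holds because, of the letters below `m`, exactly `p` have
        -- been read and the others are queued. It ties positions to values, so that the weight of a
        -- new maximum depends on the length of the queue alone.
        arrangements-sum : ∀ L m n p → Queue L m → AntiExcedances p L → p + length L ≡ m →
          ∑ (arrangements L m n) (weight321 p) ≈ queueSeries (length L) n
        arrangements-sum L m n p queue anti p≡m = begin
          ∑ (fromQueue L m n ++ newMaximum L m n) (weight321 p)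
            ≈⟨ ∑-++ (fromQueue L m n) _ _ ⟩
          ∑ (fromQueue L m n) (weight321 p) ⊕ ∑ (newMaximum L m n) (weight321 p)
            ≈⟨ +-congʳ (fromQueue-sum L m n p queue anti p≡m) ⟩
          pop (length L) n ⊕ ∑ (newMaximum L m n) (weight321 p)
            ≈⟨ newMaximum-sum L m n p queue (AntiExcedances-suc L anti) p≡m ⟩
          queueSeries (length L) n ∎
          where open SetoidReasoning setoid

        fromQueue-sum : ∀ L m n p → Queue L m → AntiExcedances p L → p + length L ≡ m →
          ∑ (fromQueue L m n) (weight321 p) ≈ pop (length L) n
        fromQueue-sum []      m zero    p queue anti p≡m =
          ≈-trans (⊕-identityʳ _) (solve 0 (con 1 :* con 1 :* con 1 := con 1) ≈-refl)
        fromQueue-sum []      m (suc n) p queue anti p≡m = ≈-refl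
        fromQueue-sum (x ∷ L) m n p queue (x<p , anti) p≡m = begin
          ∑ (map (x ∷_) (arrangements L m n)) (weight321 p)
            ≡⟨ ∑-map (x ∷_) (arrangements L m n) (weight321 p) ⟩
          ∑ (arrangements L m n) (λ l → weight321 p (x ∷ l))
            ≈⟨ ∑-cong-∈ (arrangements L m n) (λ {l} l∈ →
                 weight-queue {l = l} queue x<p (proj₁ (arrangements-sound L m n (Queue-tail queue) l∈))) ⟩
          ∑ (arrangements L m n) (weight321 (suc p))
            ≈⟨ arrangements-sum L m n (suc p) (Queue-tail queue) anti (trans (sym (+-suc p (length L))) p≡m) ⟩
          queueSeries (length L) n ∎
          where open SetoidReasoning setoid

        -- Position `p` is reserved for a maximum, so the queue can be served only from p + 1 on.
        -- This weaker bound is the one that survives when a skipped `m` joins the queue: in the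
        -- queue started at p its place would be exactly m.
        newMaximum-sum : ∀ L m n p → Queue L m → AntiExcedances (suc p) L → p + length L ≡ m →
          pop (length L) n ⊕ ∑ (newMaximum L m n) (weight321 p) ≈ queueSeries (length L) n
        newMaximum-sum L m zero    p queue anti p≡m = ≈-trans (⊕-identityʳ _) (queueSeries-zero (length L))
        -- Adding `Q n`, the sum of the words that start from the longer queue, completes the words
        -- that skip `m` to all words for that queue.
        newMaximum-sum L m (suc n) p queue anti p≡m = ⊕-cancelʳ (Q n) _ _ (begin
          pop k (suc n) ⊕ ∑ (map (m ∷_) A ++ B) (weight321 p) ⊕ Q n
            ≈⟨ +-congʳ (+-congˡ (∑-++ (map (m ∷_) A) B (weight321 p))) ⟩
          pop k (suc n) ⊕ (∑ (map (m ∷_) A) (weight321 p) ⊕ ∑ B (weight321 p)) ⊕ Q n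
            ≈⟨ solve 4 (λ a b c d → a :+ (b :+ c) :+ d := a :+ (b :+ (d :+ c))) ≈-refl _ _ _ _ ⟩
          pop k (suc n) ⊕ (∑ (map (m ∷_) A) (weight321 p) ⊕ (Q n ⊕ ∑ B (weight321 p)))
            ≈⟨ +-congˡ (+-cong A-sum B-sum) ⟩
          pop k (suc n) ⊕ (maximumWeight k ⊗ Q n ⊕ queueSeries (suc k) n)
            ≈⟨ queueSeries-suc k n ⟨
          Q (suc n) ⊕ Q n ∎)
          where
          open SetoidReasoning setoid
          k = length L
          Q = queueSeries k
          A = arrangements L (suc m) n
          B = newMaximum (L ∷ʳ m) (suc m) n
          A-sum : ∑ (map (m ∷_) A) (weight321 p) ≈ maximumWeight k ⊗ Q n
          A-sum = begin
            ∑ (map (m ∷_) A) (weight321 p)                    ≡⟨ ∑-map (m ∷_) A (weight321 p) ⟩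
            ∑ A (λ l → weight321 p (m ∷ l))                   ≈⟨ ∑-cong-∈ A (λ {l} l∈ → weight-maximum {l = l} queue p≡m
                                                                   (proj₁ (arrangements-sound L (suc m) n (Queue-suc queue) l∈))) ⟩
            ∑ A (λ l → maximumWeight k ⊗ weight321 (suc p) l) ≈⟨ ∑-scale (maximumWeight k) A (weight321 (suc p)) ⟩
            maximumWeight k ⊗ ∑ A (weight321 (suc p))         ≈⟨ *-congˡ (arrangements-sum L (suc m) n (suc p)
                                                                   (Queue-suc queue) anti (cong suc p≡m)) ⟩
            maximumWeight k ⊗ Q n                             ∎
          length-∷ʳ : length (L ∷ʳ m) ≡ suc k
          length-∷ʳ = trans (Listₚ.length-++ L) (+-comm k 1)
          B-sum : Q n ⊕ ∑ B (weight321 p) ≈ queueSeries (suc k) n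
          B-sum = subst (λ j → pop j n ⊕ ∑ B (weight321 p) ≈ queueSeries j n) length-∷ʳ
            (newMaximum-sum (L ∷ʳ m) (suc m) n p (Queue-∷ʳ queue) (AntiExcedances-∷ʳ p L p≡m anti)
              (trans (cong (p +_) length-∷ʳ) (trans (+-suc p k) (cong suc p≡m))))

  -- 231-avoiding words as preorder readings of binary trees

  word : ℕ → Tree → List ℕ
  word o leaf       = []
  word o (node s t) = o + size s ∷ word o s ++ word (suc (o + size s)) t

  interval-++ : ∀ o i j → interval o (i + j) ≡ interval o i ++ interval (o + i) j
  interval-++ o zero    j = cong (λ o′ → interval o′ j) (sym (+-identityʳ o))
  interval-++ o (suc i) j = cong (o ∷_) (trans (interval-++ (suc o) i j)
    (cong (λ o′ → interval (suc o) i ++ interval o′ j) (sym (+-suc o i))))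

  interval-split : ∀ o i j → interval o (suc (i + j)) ≡ interval o i ++ o + i ∷ interval (suc (o + i)) j
  interval-split o i j = trans (cong (interval o) (sym (+-suc i j))) (interval-++ o i (suc j))

  word-↭ : ∀ o t → word o t ↭ interval o (size t)
  word-↭ o leaf       = ↭-refl
  word-↭ o (node s t) = ↭-trans (↭-prep a (++⁺ (word-↭ o s) (word-↭ (suc a) t)))
    (↭-trans (↭-sym (shift a (interval o (size s)) _)) (↭-reflexive (sym (interval-split o (size s) (size t)))))
    where a = o + size s

  length-word : ∀ o t → length (word o t) ≡ size t
  length-word o t = trans (↭-length (word-↭ o t)) (Listₚ.length-iterate suc o (size t))

  word-≥ : ∀ o t → All (o ≤_) (word o t)
  word-≥ o t = All.tabulate (λ x∈ → proj₁ (∈-interval o (size t) (∈-resp-↭ (word-↭ o t) x∈)))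

  word-< : ∀ o t → All (_< o + size t) (word o t)
  word-< o t = All.tabulate (λ x∈ → proj₂ (∈-interval o (size t) (∈-resp-↭ (word-↭ o t) x∈)))

  All⇒AllPairs : ∀ {P : ℕ → Set} {R : ℕ → ℕ → Set} → (∀ {y w} → P y → P w → R y w) →
                 ∀ {l} → All P l → AllPairs R l
  All⇒AllPairs R-ok []       = []
  All⇒AllPairs R-ok (p ∷ ps) = All.map (R-ok p) ps ∷ All⇒AllPairs R-ok ps

  Not231-++ : ∀ x {α β} → AllPairs (Not231 x) α → All (x <_) β → AllPairs (Not231 x) (α ++ β)
  Not231-++ x α-ok x<β = AllPairsₚ.++⁺ α-ok
    (All⇒AllPairs (λ _ x<w (w<x , _) → <-asym w<x x<w) x<β)
    (All.universal (λ _ → All.map (λ x<w (w<x , _) → <-asym w<x x<w) x<β) _)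

  Avoids231-++ : ∀ {a} α {β} → All (_< a) α → All (a <_) β → Avoids Not231 α → Avoids Not231 β →
                 Avoids Not231 (α ++ β)
  Avoids231-++ []      _           _   _           β-ok = β-ok
  Avoids231-++ (x ∷ α) (x<a ∷ α<a) a<β (ok , α-ok) β-ok =
    Not231-++ x ok (All.map (<-trans x<a) a<β) , Avoids231-++ α α<a a<β α-ok β-ok

  word-avoids : ∀ o t → Avoids Not231 (word o t)
  word-avoids o leaf       = tt
  word-avoids o (node s t) =
    Not231-++ _ (All⇒AllPairs (λ y<x _ (_ , x<y) → <-asym y<x x<y) (word-< o s)) (word-≥ _ t) ,
    Avoids231-++ (word o s) (word-< o s) (word-≥ _ t) (word-avoids o s) (word-avoids _ t)

  ++-injective : ∀ (α α′ : List ℕ) {β β′} → length α ≡ length α′ → α ++ β ≡ α′ ++ β′ → α ≡ α′ × β ≡ β′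
  ++-injective []      []        _       eq = refl , eq
  ++-injective (x ∷ α) (x′ ∷ α′) |α|≡|α′| eq
    with refl , eq′ ← Listₚ.∷-injective eq
    with refl , β≡ ← ++-injective α α′ (suc-injective |α|≡|α′|) eq′ = refl , β≡

  -- The first letter reveals the size of the left subtree, and with it the place where the rest of
  -- the word is to be cut.
  word-injective : ∀ o s t → word o s ≡ word o t → s ≡ t
  word-injective o leaf       leaf         _  = refl
  word-injective o (node s t) (node s′ t′) eq
    with o+s≡ , eq′ ← Listₚ.∷-injective eq
    with |s|≡ ← +-cancelˡ-≡ o _ _ o+s≡
    with s≡ , t≡ ← ++-injective (word o s) (word o s′)
                     (trans (length-word o s) (trans |s|≡ (sym (length-word o s′)))) eq′ =
    cong₂ node (word-injective o s s′ s≡)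
      (word-injective _ t t′ (trans t≡ (cong (λ k → word (suc (o + k)) t′) (sym |s|≡))))

  Avoids-filter : ∀ {P} {Q : ℕ → Set} (Q? : Decidable Q) l → Avoids P l → Avoids P (filter Q? l)
  Avoids-filter Q? []      _          = tt
  Avoids-filter Q? (x ∷ l) (ok , rest) with Q? x
  ... | yes _ = AllPairsₚ.filter⁺ Q? ok , Avoids-filter Q? l rest
  ... | no  _ = Avoids-filter Q? l rest

  -- After the first letter above `x` no letter below `x` can follow, since with `x` in front it
  -- would complete a 231.
  partition-231 : ∀ x l → All (_≢ x) l → AllPairs (Not231 x) l → l ≡ filter (_<? x) l ++ filter (x <?_) l
  partition-231 x []      _           _          = refl
  partition-231 x (y ∷ l) (y≢x ∷ l≢x) (ok ∷ oks) with y <? x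
  ... | yes y<x rewrite Listₚ.filter-accept (_<? x) {xs = l} y<x | Listₚ.filter-reject (x <?_) {xs = l} (<-asym y<x) = cong (y ∷_) (partition-231 x l l≢x oks)
  ... | no  y≮x with x<y ← ≤∧≢⇒< (≮⇒≥ y≮x) (y≢x ∘ sym)
    rewrite Listₚ.filter-reject (_<? x) {xs = l} y≮x
          | Listₚ.filter-none (_<? x) {xs = l} (All.map (λ ok′ w<x → ok′ (w<x , x<y)) ok)
          | Listₚ.filter-accept (x <?_) {xs = l} x<y
          | Listₚ.filter-all (x <?_) (All.zipWith (λ (ok′ , w≢x) →
              ≤∧≢⇒< (≮⇒≥ (λ w<x → ok′ (w<x , x<y))) (w≢x ∘ sym)) (ok , l≢x)) = refl

  -- The two blocks are obtained by filtering, hence are not structurally smaller; `k` bounds the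
  -- depth of the recursion.
  word-complete : ∀ k o n l → n ≤ k → l ↭ interval o n → Avoids Not231 l → ∃ λ t → l ≡ word o t
  word-complete k o zero l n≤k l↭ avoids = leaf , ↭-empty-inv l↭
  word-complete (suc k) o (suc n) [] (s≤s n≤k) l↭ avoids = case ↭-empty-inv (↭-sym l↭) of λ ()
  word-complete (suc k) o (suc n) (x ∷ l) (s≤s n≤k) x∷l↭ (ok , avoids)
    with o≤x , x<o+1+n ← ∈-interval o (suc n) (∈-resp-↭ x∷l↭ (here refl))
    -- The first letter is o + i, so `i` of the other letters are smaller and the remaining `j` are
    -- larger.
    with i , refl ← m≤n⇒∃[o]m+o≡n o≤x
    with j , refl ← m≤n⇒∃[o]m+o≡n (s≤s⁻¹ (+-cancelˡ-< o i (suc n) x<o+1+n)) = node s t ,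
      cong₂ _∷_ (cong (o +_) i≡) (trans (partition-231 x l l≢x ok) (cong₂ _++_ smaller≡
        (trans larger≡ (cong (λ i → word (suc (o + i)) t) i≡))))
    where
    lower = interval o i
    upper = interval (suc x) j
    lower<x : All (_< x) lower
    lower<x = All.tabulate (λ w∈ → proj₂ (∈-interval o i w∈))
    x<upper : All (x <_) upper
    x<upper = All.tabulate (λ w∈ → proj₁ (∈-interval (suc x) j w∈))
    l↭ : l ↭ lower ++ upper
    l↭ = drop-mid [] lower (↭-trans x∷l↭ (↭-reflexive (interval-split o i j)))
    l≢x : All (_≢ x) l
    l≢x = All-resp-↭ (↭-sym l↭) (Allₚ.++⁺ (All.map <⇒≢ lower<x) (All.map >⇒≢ x<upper))
    smaller↭ : filter (_<? x) l ↭ lower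
    smaller↭ = ↭-trans (filter-↭ (_<? x) l↭) (↭-reflexive (trans (Listₚ.filter-++ (_<? x) lower upper)
      (trans (cong₂ _++_ (Listₚ.filter-all (_<? x) lower<x) (Listₚ.filter-none (_<? x) (All.map <-asym x<upper)))
        (Listₚ.++-identityʳ lower))))
    larger↭ : filter (x <?_) l ↭ upper
    larger↭ = ↭-trans (filter-↭ (x <?_) l↭) (↭-reflexive (trans (Listₚ.filter-++ (x <?_) lower upper)
      (cong₂ _++_ (Listₚ.filter-none (x <?_) (All.map <-asym lower<x)) (Listₚ.filter-all (x <?_) x<upper))))
    left : ∃ λ s → filter (_<? x) l ≡ word o s
    left = word-complete k o i _ (≤-trans (m≤m+n i j) n≤k) smaller↭ (Avoids-filter (_<? x) l avoids)
    right : ∃ λ t → filter (x <?_) l ≡ word (suc x) t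
    right = word-complete k (suc x) j _ (≤-trans (m≤n+m j i) n≤k) larger↭ (Avoids-filter (x <?_) l avoids)
    s = proj₁ left
    t = proj₁ right
    smaller≡ = proj₂ left
    larger≡ = proj₂ right
    i≡ : i ≡ size s
    i≡ = trans (sym (Listₚ.length-iterate suc o i)) (trans (sym (↭-length smaller↭))
           (trans (cong length smaller≡) (length-word o s)))

  -- Descents, 31-2 and left-to-right maxima in the tree decomposition

  desFrom gapFrom : ℕ → List ℕ → ℕ
  desFrom x []      = 0
  desFrom x (y ∷ l) = 𝟙 (y <? x) + desFrom y l
  gapFrom x []      = 0
  gapFrom x (y ∷ l) = count (λ w → (y <? w) ×-dec (w <? x)) l + gapFrom y l

  desᴸ gapᴸ : List ℕ → ℕ
  desᴸ []      = 0
  desᴸ (x ∷ l) = desFrom x l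
  gapᴸ []      = 0
  gapᴸ (x ∷ l) = gapFrom x l

  AscendsTo : ℕ → List ℕ → Set
  AscendsTo x []      = ⊤
  AscendsTo x (y ∷ l) = x < y

  ascendsTo? : ∀ x l → Dec (AscendsTo x l)
  ascendsTo? x []      = yes tt
  ascendsTo? x (y ∷ l) = x <? y

  -- The argument `m` is one more than the largest letter read so far, or 0 at the start, so `m ≤ x`
  -- marks a left-to-right maximum. The entry before such a letter is smaller automatically, and a
  -- last letter ascends to the conventional ∞; so only an actual next letter has to be compared.
  fmaxFrom : ℕ → List ℕ → ℕ
  fmaxFrom m []      = 0
  fmaxFrom m (x ∷ l) = 𝟙 ((m ≤? x) ×-dec ascendsTo? x l) + fmaxFrom (m ⊔ suc x) l

  desFrom-ascent : ∀ {x} β → All (x <_) β → desFrom x β ≡ desᴸ β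
  desFrom-ascent []      _         = refl
  desFrom-ascent (y ∷ β) (x<y ∷ _) rewrite 𝟙-no (y <? _) (<-asym x<y) = refl

  gapFrom-ascent : ∀ {x} β → All (x <_) β → gapFrom x β ≡ gapᴸ β
  gapFrom-ascent []      _           = refl
  gapFrom-ascent {x} (y ∷ β) (_ ∷ x<β)
    rewrite count-none (λ w → (y <? w) ×-dec (w <? x)) (All.map (λ x<w (_ , w<x) → <-asym x<w w<x) x<β) = refl

  module _ {a : ℕ} {β : List ℕ} (a<β : All (a <_) β) where

    desFrom-++ : ∀ {x} α → x ≤ a → All (_< a) α → desFrom x (α ++ β) ≡ desFrom x α + desᴸ β
    desFrom-++ []      x≤a _           = desFrom-ascent β (All.map (≤-<-trans x≤a) a<β)
    desFrom-++ {x} (y ∷ α) x≤a (y<a ∷ α<a) =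
      trans (cong (𝟙 (y <? x) +_) (desFrom-++ α (<⇒≤ y<a) α<a)) (sym (+-assoc (𝟙 (y <? x)) _ _))

    -- No occurrence of 31-2 crosses from α to β: letters of β exceed `a` and cannot lie between two
    -- letters that are at most `a`, and the step into β is an ascent.
    gapFrom-++ : ∀ {x} α → x ≤ a → All (_< a) α → gapFrom x (α ++ β) ≡ gapFrom x α + gapᴸ β
    gapFrom-++ []      x≤a _           = gapFrom-ascent β (All.map (≤-<-trans x≤a) a<β)
    gapFrom-++ {x} (y ∷ α) x≤a (y<a ∷ α<a) = begin
      count B? (α ++ β) + gapFrom y (α ++ β)            ≡⟨ cong₂ _+_ (count-++ B? α β) (gapFrom-++ α (<⇒≤ y<a) α<a) ⟩
      count B? α + count B? β + (gapFrom y α + gapᴸ β)  ≡⟨ cong (λ k → count B? α + k + _) (count-none B?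
        (All.map (λ a<w (_ , w<x) → <-asym (<-≤-trans w<x x≤a) a<w) a<β)) ⟩
      count B? α + 0 + (gapFrom y α + gapᴸ β)           ≡⟨ cong (_+ _) (+-identityʳ (count B? α)) ⟩
      count B? α + (gapFrom y α + gapᴸ β)               ≡⟨ +-assoc (count B? α) _ _ ⟨
      count B? α + gapFrom y α + gapᴸ β                 ∎
      where
      open ≡.≡-Reasoning
      B? = λ w → (y <? w) ×-dec (w <? x)

  fmaxFrom-≤ : ∀ {m} β → All (m ≤_) β → fmaxFrom m β ≡ fmaxFrom 0 β
  fmaxFrom-≤ []          _           = refl
  fmaxFrom-≤ {m} (y ∷ β) (m≤y ∷ _)
    rewrite m≤n⇒m⊔n≡n (m≤n⇒m≤1+n m≤y) | dec-true (m ≤? y) m≤y = refl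

  fmaxFrom-++ : ∀ {a} α β → All (_< a) α → fmaxFrom (suc a) (α ++ β) ≡ fmaxFrom (suc a) β
  fmaxFrom-++     []      β _           = refl
  fmaxFrom-++ {a} (y ∷ α) β (y<a ∷ α<a)
    rewrite m≥n⇒m⊔n≡m (m≤n⇒m≤1+n y<a)
          | 𝟙-no ((suc a ≤? y) ×-dec ascendsTo? y (α ++ β)) (λ (a<y , _) → <-asym a<y y<a) = fmaxFrom-++ α β α<a

  -- The bound b stands for an entry that precedes the word.
  desFrom-node : ∀ o s t {b} → o + size (node s t) ≤ b →
    desFrom b (word o (node s t)) ≡ suc (desFrom (o + size s) (word o s) + desᴸ (word (suc (o + size s)) t))
  desFrom-node o s t {b} top≤b
    rewrite 𝟙-yes (o + size s <? b) (<-≤-trans (+-monoʳ-< o (s≤s (m≤m+n (size s) (size t)))) top≤b) =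
    cong suc (desFrom-++ (word-≥ _ t) (word o s) ≤-refl (word-< o s))

  -- The pair formed by the preceding `b` and the root is a descent, and the letters between the two
  -- values are those of the right subtree, all of which come later. Hence the contribution
  -- `size t`.
  gapFrom-node : ∀ o s t {b} → o + size (node s t) ≤ b →
    gapFrom b (word o (node s t)) ≡ size t + (gapFrom (o + size s) (word o s) + gapᴸ (word (suc (o + size s)) t))
  gapFrom-node o s t {b} top≤b = cong₂ _+_ (begin
    count B? (word o s ++ word (suc a) t)           ≡⟨ count-++ B? (word o s) _ ⟩
    count B? (word o s) + count B? (word (suc a) t) ≡⟨ cong₂ _+_
      (count-none B? (All.map (λ w<a (a<w , _) → <-asym a<w w<a) (word-< o s)))
      (count-all B? (All.zipWith (λ (a<w , w<top) → a<w , <-≤-trans w<top top′≤b) (word-≥ (suc a) t , word-< (suc a) t))) ⟩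
    length (word (suc a) t)                         ≡⟨ length-word (suc a) t ⟩
    size t                                          ∎)
    (gapFrom-++ (word-≥ _ t) (word o s) ≤-refl (word-< o s))
    where
    open ≡.≡-Reasoning
    a = o + size s
    B? = λ w → (a <? w) ×-dec (w <? b)
    top′≤b : suc a + size t ≤ b
    top′≤b = ≤-trans (≤-reflexive (trans (cong suc (+-assoc o (size s) (size t))) (sym (+-suc o _)))) top≤b

  fmaxFrom-node : ∀ o s t → fmaxFrom 0 (word o (node s t)) ≡
    𝟙 (ascendsTo? (o + size s) (word o s ++ word (suc (o + size s)) t)) + fmaxFrom 0 (word (suc (o + size s)) t)
  fmaxFrom-node o s t = cong (𝟙 (ascendsTo? (o + size s) (word o s ++ word (suc (o + size s)) t)) +_)
    (trans (fmaxFrom-++ (word o s) _ (word-< o s)) (fmaxFrom-≤ _ (word-≥ _ t)))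

  -- The root comes first, so it is a left-to-right maximum. It is followed by a larger letter or by
  -- the end exactly when its left subtree is empty, which is why only then it is counted.
  fmaxFrom-leaf-node : ∀ o t → fmaxFrom 0 (word o (node leaf t)) ≡ suc (fmaxFrom 0 (word (suc (o + 0)) t))
  fmaxFrom-leaf-node o t = trans (fmaxFrom-node o leaf t)
    (cong (_+ fmaxFrom 0 (word (suc (o + 0)) t)) (𝟙-yes (ascendsTo? (o + 0) (word (suc (o + 0)) t)) (ascends (word-≥ _ t))))
    where
    ascends : ∀ {x l} → All (x <_) l → AscendsTo x l
    ascends []        = tt
    ascends (x<y ∷ _) = x<y

  fmaxFrom-node-node : ∀ o s s′ t → let a = o + size (node s s′) in
    fmaxFrom 0 (word o (node (node s s′) t)) ≡ fmaxFrom 0 (word (suc a) t)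
  fmaxFrom-node-node o s s′ t = trans (fmaxFrom-node o (node s s′) t)
    (cong (_+ fmaxFrom 0 (word (suc (o + size (node s s′))) t)) (𝟙-no (_ <? _) (<-asym (All.head (word-< o (node s s′))))))

  module Sum231 {c ℓ} (R : CommutativeRing c ℓ) where
    open CommutativeRing R using (Carrier; 1#; _≈_; setoid; commutativeSemiring; semiring; reflexive; *-congˡ; *-cong)
      renaming (_*_ to _⊗_; refl to ≈-refl)
    open Exp semiring using (^-homo-*) renaming (_^_ to _⋆_)
    open TreeSeries R
    open SemiringSolver commutativeSemiring using (solve; _:=_; _:*_; con)
    open SetoidReasoning setoid

    module _ (t q : Carrier) where

      weightAfter : ℕ → List ℕ → Carrier
      weightAfter b l = t ⋆ desFrom b l ⊗ q ⋆ (desFrom b l + gapFrom b l)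

      weight : List ℕ → Carrier
      weight l = t ⋆ desᴸ l ⊗ q ⋆ (desᴸ l + gapᴸ l)

      ⋆-additive : ∀ d g d′ g′ → t ⋆ (d + d′) ⊗ q ⋆ (d + d′ + (g + g′)) ≈
                   (t ⋆ d ⊗ q ⋆ (d + g)) ⊗ (t ⋆ d′ ⊗ q ⋆ (d′ + g′))
      ⋆-additive d g d′ g′ = begin
        t ⋆ (d + d′) ⊗ q ⋆ (d + d′ + (g + g′))              ≡⟨ cong (λ k → t ⋆ (d + d′) ⊗ q ⋆ k) (interchange d d′ g g′) ⟩
        t ⋆ (d + d′) ⊗ q ⋆ (d + g + (d′ + g′))              ≈⟨ *-cong (^-homo-* t d d′) (^-homo-* q (d + g) (d′ + g′)) ⟩
        t ⋆ d ⊗ t ⋆ d′ ⊗ (q ⋆ (d + g) ⊗ q ⋆ (d′ + g′))      ≈⟨ solve 4 (λ a b x y →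
          a :* b :* (x :* y) := a :* x :* (b :* y)) ≈-refl _ _ _ _ ⟩
        (t ⋆ d ⊗ q ⋆ (d + g)) ⊗ (t ⋆ d′ ⊗ q ⋆ (d′ + g′))    ∎

      weight-node : ∀ o s u → let a = o + size s in
        weight (word o (node s u)) ≈ weightAfter a (word o s) ⊗ weight (word (suc a) u)
      weight-node o s u = begin
        t ⋆ desFrom a (word o s ++ word (suc a) u) ⊗
          q ⋆ (desFrom a (word o s ++ word (suc a) u) + gapFrom a (word o s ++ word (suc a) u))
          ≡⟨ cong₂ (λ d g → t ⋆ d ⊗ q ⋆ (d + g)) (desFrom-++ (word-≥ _ u) (word o s) ≤-refl (word-< o s))
               (gapFrom-++ (word-≥ _ u) (word o s) ≤-refl (word-< o s)) ⟩
        t ⋆ (desFrom a (word o s) + desᴸ (word (suc a) u)) ⊗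
          q ⋆ (desFrom a (word o s) + desᴸ (word (suc a) u) + (gapFrom a (word o s) + gapᴸ (word (suc a) u)))
          ≈⟨ ⋆-additive (desFrom a (word o s)) (gapFrom a (word o s)) _ _ ⟩
        weightAfter a (word o s) ⊗ weight (word (suc a) u) ∎
        where a = o + size s

      mutual
        -- After a larger letter the root adds a descent, of weight t q, and one occurrence of 31-2
        -- for each letter of its right subtree. The resulting power of q is absorbed by the right
        -- subtree, whose weight thereby turns from that of a free word into `weightT`.
        weightAfter-word : ∀ o s {b} → o + size s ≤ b → weightAfter b (word o s) ≈ weightS q (t ⊗ q) s
        weightAfter-word o leaf       top≤b = solve 0 (con 1 :* con 1 := con 1) ≈-refl
        weightAfter-word o (node s u) {b} top≤b = begin
          weightAfter b (word o (node s u))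
            ≡⟨ cong₂ (λ d g → t ⋆ d ⊗ q ⋆ (d + g)) (desFrom-node o s u top≤b) (gapFrom-node o s u top≤b) ⟩
          t ⋆ suc (d + d′) ⊗ q ⋆ (suc (d + d′) + (size u + (g + g′)))
            ≡⟨ cong (λ k → t ⋆ suc (d + d′) ⊗ q ⋆ suc k) (x∙yz≈y∙xz (d + d′) (size u) (g + g′)) ⟩
          t ⋆ suc (d + d′) ⊗ q ⋆ suc (size u + (d + d′ + (g + g′)))
            ≈⟨ *-congˡ (*-congˡ (^-homo-* q (size u) _)) ⟩
          t ⊗ t ⋆ (d + d′) ⊗ (q ⊗ (q ⋆ size u ⊗ q ⋆ (d + d′ + (g + g′))))
            ≈⟨ solve 5 (λ t q a b c → t :* a :* (q :* (b :* c)) := t :* q :* (b :* (a :* c))) ≈-refl t q _ _ _ ⟩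
          t ⊗ q ⊗ (q ⋆ size u ⊗ (t ⋆ (d + d′) ⊗ q ⋆ (d + d′ + (g + g′))))
            ≈⟨ *-congˡ (*-congˡ (⋆-additive d g d′ g′)) ⟩
          t ⊗ q ⊗ (q ⋆ size u ⊗ (weightAfter a (word o s) ⊗ weight (word (suc a) u)))
            ≈⟨ solve 4 (λ x y b c → x :* (y :* (b :* c)) := x :* (b :* (y :* c))) ≈-refl (t ⊗ q) (q ⋆ size u) _ _ ⟩
          t ⊗ q ⊗ (weightAfter a (word o s) ⊗ (q ⋆ size u ⊗ weight (word (suc a) u)))
            ≈⟨ *-congˡ (*-cong (weightAfter-word o s ≤-refl) (weight-word (suc a) u)) ⟩
          t ⊗ q ⊗ (weightS q (t ⊗ q) s ⊗ weightT q (t ⊗ q) u) ∎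
          where
          a = o + size s
          d = desFrom a (word o s)
          d′ = desᴸ (word (suc a) u)
          g = gapFrom a (word o s)
          g′ = gapᴸ (word (suc a) u)

        weight-word : ∀ o s → q ⋆ size s ⊗ weight (word o s) ≈ weightT q (t ⊗ q) s
        weight-word o leaf       = solve 0 (con 1 :* (con 1 :* con 1) := con 1) ≈-refl
        weight-word o (node s u) = begin
          q ⊗ q ⋆ (size s + size u) ⊗ weight (word o (node s u))
            ≈⟨ *-cong (*-congˡ (^-homo-* q (size s) (size u))) (weight-node o s u) ⟩
          q ⊗ (q ⋆ size s ⊗ q ⋆ size u) ⊗ (weightAfter a (word o s) ⊗ weight (word (suc a) u))
            ≈⟨ solve 5 (λ q x y b c → q :* (x :* y) :* (b :* c) := q :* (y :* c :* (x :* b))) ≈-refl q _ _ _ _ ⟩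
          q ⊗ (q ⋆ size u ⊗ weight (word (suc a) u) ⊗ (q ⋆ size s ⊗ weightAfter a (word o s)))
            ≈⟨ *-congˡ (*-cong (weight-word (suc a) u) (*-congˡ (weightAfter-word o s ≤-refl))) ⟩
          q ⊗ (weightT q (t ⊗ q) u ⊗ (q ⋆ size s ⊗ weightS q (t ⊗ q) s)) ∎
          where a = o + size s

      weight231 : Carrier → List ℕ → Carrier
      weight231 r l = weight l ⊗ r ⋆ fmaxFrom 0 l

      weight231-word : ∀ r o s → weight231 r (word o s) ≈ weightF q (t ⊗ q) r s
      weight231-word r o leaf          = solve 0 (con 1 :* con 1 :* con 1 := con 1) ≈-refl
      weight231-word r o (node leaf u) = begin
        weight (word o (node leaf u)) ⊗ r ⋆ fmaxFrom 0 (word o (node leaf u))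
          ≈⟨ *-cong (weight-node o leaf u) (reflexive (cong (r ⋆_) (fmaxFrom-leaf-node o u))) ⟩
        1# ⊗ 1# ⊗ weight w ⊗ (r ⊗ r ⋆ fmaxFrom 0 w)
          ≈⟨ solve 3 (λ x r y → con 1 :* con 1 :* x :* (r :* y) := r :* (x :* y)) ≈-refl _ r _ ⟩
        r ⊗ weight231 r w
          ≈⟨ *-congˡ (weight231-word r _ u) ⟩
        r ⊗ weightF q (t ⊗ q) r u ∎
        where w = word (suc (o + 0)) u
      weight231-word r o (node s@(node s₁ s₂) u) = begin
        weight (word o (node s u)) ⊗ r ⋆ fmaxFrom 0 (word o (node s u))
          ≈⟨ *-cong (weight-node o s u) (reflexive (cong (r ⋆_) (fmaxFrom-node-node o s₁ s₂ u))) ⟩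
        weightAfter (o + size s) (word o s) ⊗ weight w ⊗ r ⋆ fmaxFrom 0 w
          ≈⟨ solve 3 (λ x y v → x :* y :* v := x :* (y :* v)) ≈-refl _ _ _ ⟩
        weightAfter (o + size s) (word o s) ⊗ weight231 r w
          ≈⟨ *-cong (weightAfter-word o s ≤-refl) (weight231-word r _ u) ⟩
        weightS q (t ⊗ q) s ⊗ weightF q (t ⊗ q) r u ∎
        where w = word (suc (o + size s)) u

open Words

-- Statistics of permutations as statistics of words

module Permutations where
  open import Data.Nat using (_+_; _⊔_)
  open import Data.Fin using (_<_; _<?_)
  open MonoidSum ℕₚ.+-0-commutativeMonoid using (sum; sum-cong-≗; sum-permute)
  open Equivalence using (to; from)

  𝟙-cong : ∀ {p q} {P : Set p} {Q : Set q} (P? : Dec P) (Q? : Dec Q) → P ⇔ Q → 𝟙 P? ≡ 𝟙 Q?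
  𝟙-cong (yes p) Q? P⇔Q = sym (𝟙-yes Q? (to P⇔Q p))
  𝟙-cong (no ¬p) Q? P⇔Q = sym (𝟙-no Q? (¬p ∘ from P⇔Q))

  count-∷ : ∀ {a p} {A : Set a} {P : A → Set p} (P? : Decidable P) x xs → count P? (x ∷ xs) ≡ 𝟙 (P? x) + count P? xs
  count-∷ P? x xs with P? x
  ... | yes _ = refl
  ... | no  _ = refl

  count-map : ∀ {a b p} {A : Set a} {B : Set b} {P : B → Set p} (P? : Decidable P) (f : A → B) xs →
              count P? (List.map f xs) ≡ count (P? ∘ f) xs
  count-map P? f []       = refl
  count-map P? f (x ∷ xs) = trans (count-∷ P? (f x) (List.map f xs))
    (trans (cong (𝟙 (P? (f x)) +_) (count-map P? f xs)) (sym (count-∷ (P? ∘ f) x xs)))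

  count-tabulate : ∀ {a p} {A : Set a} {P : A → Set p} (P? : Decidable P) {m} (f : Fin m → A) →
                   count P? (tabulate f) ≡ sum (λ i → 𝟙 (P? (f i)))
  count-tabulate P? {zero}  f = refl
  count-tabulate P? {suc m} f = trans (count-∷ P? (f zero) _) (cong (𝟙 (P? (f zero)) +_) (count-tabulate P? (f ∘ suc)))

  -- Sums over `Fin m` unfold along vectors and are invariant under bijections of the index set,
  -- which is what the translation to words and the reversal of positions require.
  ♯-sum : ∀ {m} {P : Fin m → Set} (P? : ∀ i → Dec (P i)) → ♯ P? ≡ sum (λ i → 𝟙 (P? i))
  ♯-sum P? = count-tabulate P? id

  ♯₂-sum : ∀ {m n} {P : Fin m → Fin n → Set} (P? : ∀ i j → Dec (P i j)) →
           ♯₂ P? ≡ sum (λ i → sum (λ j → 𝟙 (P? i j)))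
  ♯₂-sum {n = n} {P} P? = rows _ id
    where
    rows : ∀ k (f : Fin k → Fin _) → count (λ (i , j) → P? i j) (cartesianProduct (tabulate f) (allFin n)) ≡
           sum (λ i → sum (λ j → 𝟙 (P? (f i) j)))
    rows zero    f = refl
    rows (suc k) f = trans (count-++ (λ (i , j) → P? i j) (List.map (f zero ,_) (allFin n)) _)
      (cong₂ _+_ (trans (count-map (λ (i , j) → P? i j) (f zero ,_) (allFin n)) (count-tabulate (P? (f zero)) id))
        (rows k (f ∘ suc)))

  ♯-cong : ∀ {m} {P Q : Fin m → Set} (P? : ∀ i → Dec (P i)) (Q? : ∀ i → Dec (Q i)) →
           (∀ i → P i ⇔ Q i) → ♯ P? ≡ ♯ Q?
  ♯-cong P? Q? P⇔Q = trans (♯-sum P?) (trans (sum-cong-≗ (λ i → 𝟙-cong (P? i) (Q? i) (P⇔Q i))) (sym (♯-sum Q?)))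

  ♯₂-cong : ∀ {m n} {P Q : Fin m → Fin n → Set} (P? : ∀ i j → Dec (P i j)) (Q? : ∀ i j → Dec (Q i j)) →
            (∀ i j → P i j ⇔ Q i j) → ♯₂ P? ≡ ♯₂ Q?
  ♯₂-cong P? Q? P⇔Q = trans (♯₂-sum P?)
    (trans (sum-cong-≗ (λ i → sum-cong-≗ (λ j → 𝟙-cong (P? i j) (Q? i j) (P⇔Q i j)))) (sym (♯₂-sum Q?)))

  ♯-opposite : ∀ {m} {P : Fin m → Set} (P? : ∀ i → Dec (P i)) → ♯ (P? ∘ opposite) ≡ ♯ P?
  ♯-opposite P? = trans (♯-sum (P? ∘ opposite))
    (trans (sym (sum-permute (λ i → 𝟙 (P? i)) Permutation.reverse)) (sym (♯-sum P?)))

  ♯₂-opposite : ∀ {m n} {P : Fin m → Fin n → Set} (P? : ∀ i j → Dec (P i j)) →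
                ♯₂ (λ i j → P? (opposite i) (opposite j)) ≡ ♯₂ P?
  ♯₂-opposite P? = trans (♯₂-sum (λ i j → P? (opposite i) (opposite j)))
    (trans (sum-cong-≗ (λ i → sym (sum-permute (λ j → 𝟙 (P? (opposite i) j)) Permutation.reverse)))
      (trans (sym (sum-permute (λ i → sum (λ j → 𝟙 (P? i j))) Permutation.reverse)) (sym (♯₂-sum P?))))

  entries : ∀ {v k} → Vec (Fin v) k → List ℕ
  entries σ = Vec.toList (Vec.map toℕ σ)

  count-entries : ∀ {p} {P : ℕ → Set p} (P? : Decidable P) {v k} (σ : Vec (Fin v) k) →
                  sum (λ i → 𝟙 (P? (toℕ (lookup σ i)))) ≡ count P? (entries σ)
  count-entries P? []      = refl
  count-entries P? (x ∷ σ) = trans (cong (𝟙 (P? (toℕ x)) +_) (count-entries P? σ)) (sym (count-∷ P? (toℕ x) (entries σ)))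

  exc-entries : ∀ {m} (σ : Word m) → exc σ ≡ excFrom 0 (entries σ)
  exc-entries σ = trans (♯-sum (λ i → i <? lookup σ i)) (go 0 σ)
    where
    -- The tail of a permutation is not a `Word`, so alphabet and length are separated; `p` is the
    -- position at which the tail starts.
    go : ∀ p {v k} (σ : Vec (Fin v) k) → sum (λ i → 𝟙 ((p + toℕ i) ℕ.<? toℕ (lookup σ i))) ≡ excFrom p (entries σ)
    go p []      = refl
    go p (x ∷ σ) = cong₂ _+_ (cong (λ k → 𝟙 (k ℕ.<? toℕ x)) (ℕₚ.+-identityʳ p))
      (trans (sum-cong-≗ (λ i → cong (λ k → 𝟙 (k ℕ.<? toℕ (lookup σ i))) (ℕₚ.+-suc p (toℕ i)))) (go (suc p) σ))

  fix-entries : ∀ {m} (σ : Word m) → fix σ ≡ fixFrom 0 (entries σ)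
  fix-entries σ = trans (♯-sum (λ i → lookup σ i Finₚ.≟ i))
    (trans (sum-cong-≗ (λ i → 𝟙-cong (lookup σ i Finₚ.≟ i) (toℕ (lookup σ i) ℕ.≟ toℕ i) (mk⇔ (cong toℕ) Finₚ.toℕ-injective)))
      (go 0 σ))
    where
    go : ∀ p {v k} (σ : Vec (Fin v) k) → sum (λ i → 𝟙 (toℕ (lookup σ i) ℕ.≟ (p + toℕ i))) ≡ fixFrom p (entries σ)
    go p []      = refl
    go p (x ∷ σ) = cong₂ _+_ (cong (λ k → 𝟙 (toℕ x ℕ.≟ k)) (ℕₚ.+-identityʳ p))
      (trans (sum-cong-≗ (λ i → cong (λ k → 𝟙 (toℕ (lookup σ i) ℕ.≟ k)) (ℕₚ.+-suc p (toℕ i)))) (go (suc p) σ))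

  inv-entries : ∀ {m} (σ : Word m) → inv σ ≡ invᴸ (entries σ)
  inv-entries σ = trans (♯₂-sum (λ i j → (i <? j) ×-dec (lookup σ j <? lookup σ i))) (go σ)
    where
    go : ∀ {v k} (σ : Vec (Fin v) k) →
         sum (λ i → sum (λ j → 𝟙 ((i <? j) ×-dec (lookup σ j <? lookup σ i)))) ≡ invᴸ (entries σ)
    go []      = refl
    go (x ∷ σ) = cong₂ _+_ (count-entries (ℕ._<? toℕ x) σ) (go σ)

  des-entries : ∀ {m} (σ : Word m) → des σ ≡ desᴸ (entries σ)
  des-entries []            = refl
  des-entries {suc k} (x ∷ σ) =
    trans (♯-sum (λ (i : Fin k) → lookup (x ∷ σ) (suc i) <? lookup (x ∷ σ) (inject₁ i))) (go x σ)
    where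
    go : ∀ {v k} x (σ : Vec (Fin v) k) →
         sum (λ (i : Fin k) → 𝟙 (lookup (x ∷ σ) (suc i) <? lookup (x ∷ σ) (inject₁ i))) ≡ desFrom (toℕ x) (entries σ)
    go x []      = refl
    go x (y ∷ σ) = cong (𝟙 (y <? x) +_) (go y σ)

  [31-2]-entries : ∀ {m} (σ : Word m) → [31-2] σ ≡ gapᴸ (entries σ)
  [31-2]-entries []            = refl
  [31-2]-entries {suc k} (x ∷ σ) = trans (♯₂-sum (λ (i : Fin k) j → (suc i <? j) ×-dec
    (lookup (x ∷ σ) (suc i) <? lookup (x ∷ σ) j) ×-dec (lookup (x ∷ σ) j <? lookup (x ∷ σ) (inject₁ i)))) (go x σ)
    where
    go : ∀ {v k} x (σ : Vec (Fin v) k) → sum (λ (i : Fin k) → sum (λ j → 𝟙 ((suc i <? j) ×-dec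
           (lookup (x ∷ σ) (suc i) <? lookup (x ∷ σ) j) ×-dec (lookup (x ∷ σ) j <? lookup (x ∷ σ) (inject₁ i))))) ≡
         gapFrom (toℕ x) (entries σ)
    go x []      = refl
    -- The positions of `x` and `y` contribute 0 to the first row, and the position of `x`
    -- contributes 0 to all later rows, by computation of the order on positions.
    go x (y ∷ σ) = cong₂ _+_ (count-entries (λ w → (toℕ y ℕ.<? w) ×-dec (w ℕ.<? toℕ x)) σ) (go y σ)

  -- Double ascents and descents that are extremal

  lookup-∷ʳ-inject₁ : ∀ {k} (w : Vec ℕ k) b i → lookup (w Vec.∷ʳ b) (inject₁ i) ≡ lookup w i
  lookup-∷ʳ-inject₁ (x ∷ w) b zero    = refl
  lookup-∷ʳ-inject₁ (x ∷ w) b (suc i) = lookup-∷ʳ-inject₁ w b i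

  previous : ∀ {k} a (w : Vec ℕ k) b i → let p = lookup (a ∷ (w Vec.∷ʳ b)) (inject₁ (inject₁ i)) in
    (toℕ i ≡ 0 × p ≡ a) ⊎ ∃ λ j → suc (toℕ j) ≡ toℕ i × p ≡ lookup w j
  previous a w b zero    = inj₁ (refl , refl)
  previous a w b (suc i) = inj₂ (inject₁ i , cong suc (Finₚ.toℕ-inject₁ i) , lookup-∷ʳ-inject₁ w b (inject₁ i))

  next : ∀ {k} (w : Vec ℕ k) b i → let n = lookup (w Vec.∷ʳ b) (suc i) in
    (suc (toℕ i) ≡ k × n ≡ b) ⊎ ∃ λ j → toℕ j ≡ suc (toℕ i) × n ≡ lookup w j
  next (x ∷ [])    b zero    = inj₁ (refl , refl)
  next (x ∷ y ∷ w) b zero    = inj₂ (suc zero , refl , refl)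
  next (x ∷ w)     b (suc i) with next w b i
  ... | inj₁ (last , n≡b)   = inj₁ (cong suc last , n≡b)
  ... | inj₂ (j , j≡ , n≡)  = inj₂ (suc j , cong suc j≡ , n≡)

  module _ {a} {A : Set a} (R : A → A → Set) {k} (σ : Vec A k) (i : Fin k) where

    -- Neighbours are described by equations between positions, so at the two ends the condition is
    -- vacuous, in accordance with the boundary conventions. Extremality on one side already implies
    -- the comparison with the neighbour on that side, so the last two notions keep only the other
    -- neighbour.
    Consecutive LeftToRight RightToLeft : Set
    Consecutive = (∀ j → suc (toℕ j) ≡ toℕ i → R (lookup σ j) (lookup σ i)) ×
                  (∀ j → toℕ j ≡ suc (toℕ i) → R (lookup σ i) (lookup σ j))
    LeftToRight = (∀ j → j < i → R (lookup σ j) (lookup σ i)) ×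
                  (∀ j → toℕ j ≡ suc (toℕ i) → R (lookup σ i) (lookup σ j))
    RightToLeft = (∀ j → i < j → R (lookup σ i) (lookup σ j)) ×
                  (∀ j → suc (toℕ j) ≡ toℕ i → R (lookup σ j) (lookup σ i))

    LeftToRight⇔ : (Consecutive × (∀ j → j < i → R (lookup σ j) (lookup σ i))) ⇔ LeftToRight
    LeftToRight⇔ = mk⇔ (λ ((_ , after) , extremal) → extremal , after)
      (λ (extremal , after) → ((λ j j≡ → extremal j (ℕₚ.≤-reflexive j≡)) , after) , extremal)

    RightToLeft⇔ : (Consecutive × (∀ j → i < j → R (lookup σ i) (lookup σ j))) ⇔ RightToLeft
    RightToLeft⇔ = mk⇔ (λ ((before , _) , extremal) → extremal , before)
      (λ (extremal , before) → (before , (λ j j≡ → extremal j (ℕₚ.≤-reflexive (sym j≡)))) , extremal)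

  -- The boundary values are related to every entry, so the comparisons with them hold for free.
  -- Taking `R` arbitrary treats ascents and descents together.
  consecutive⇔ : ∀ (R : ℕ → ℕ → Set) {k} a b (w : Vec ℕ k) i →
    (∀ i → R a (lookup w i)) → (∀ i → R (lookup w i) b) → let e = a ∷ (w Vec.∷ʳ b) in
    (R (lookup e (inject₁ (inject₁ i))) (lookup e (inject₁ (suc i))) ×
     R (lookup e (inject₁ (suc i))) (lookup e (suc (suc i)))) ⇔ Consecutive R w i
  consecutive⇔ R a b w i aRw wRb
    rewrite lookup-∷ʳ-inject₁ w b i = mk⇔
    (λ (pRw , wRn) → before (previous a w b i) pRw , after (next w b i) wRn)
    (λ (wRw , wRw′) → before′ (previous a w b i) wRw , after′ (next w b i) wRw′)
    where
    P = lookup (a ∷ (w Vec.∷ʳ b)) (inject₁ (inject₁ i))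
    N = lookup (w Vec.∷ʳ b) (suc i)
    Previous = (toℕ i ≡ 0 × P ≡ a) ⊎ ∃ λ j → suc (toℕ j) ≡ toℕ i × P ≡ lookup w j
    Next = (suc (toℕ i) ≡ _ × N ≡ b) ⊎ ∃ λ j → toℕ j ≡ suc (toℕ i) × N ≡ lookup w j
    before : Previous → R P (lookup w i) → ∀ j → suc (toℕ j) ≡ toℕ i → R (lookup w j) (lookup w i)
    before (inj₁ (i≡0 , _))      pRw j j≡ with () ← trans j≡ i≡0
    before (inj₂ (j′ , j′≡ , P≡)) pRw j j≡
      rewrite Finₚ.toℕ-injective {i = j} {j′} (ℕₚ.suc-injective (trans j≡ (sym j′≡))) = subst (λ x → R x _) P≡ pRw
    after : Next → R (lookup w i) N → ∀ j → toℕ j ≡ suc (toℕ i) → R (lookup w i) (lookup w j)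
    after (inj₁ (last , _))     wRn j j≡ = contradiction (trans j≡ last) (ℕₚ.<⇒≢ (Finₚ.toℕ<n j))
    after (inj₂ (j′ , j′≡ , N≡)) wRn j j≡
      rewrite Finₚ.toℕ-injective {i = j} {j′} (trans j≡ (sym j′≡)) = subst (R _) N≡ wRn
    before′ : Previous → (∀ j → suc (toℕ j) ≡ toℕ i → R (lookup w j) (lookup w i)) → R P (lookup w i)
    before′ (inj₁ (_ , P≡))      _      = subst (λ x → R x _) (sym P≡) (aRw i)
    before′ (inj₂ (j , j≡ , P≡)) before = subst (λ x → R x _) (sym P≡) (before j j≡)
    after′ : Next → (∀ j → toℕ j ≡ suc (toℕ i) → R (lookup w i) (lookup w j)) → R (lookup w i) N
    after′ (inj₁ (_ , N≡))      _     = subst (R _) (sym N≡) (wRb i)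
    after′ (inj₂ (j , j≡ , N≡)) after = subst (R _) (sym N≡) (after j j≡)

  module _ {m : ℕ} (σ : Word m) where

    private
      w : Vec ℕ m
      w = Vec.map (suc ∘ toℕ) σ
      w≡ : ∀ i → lookup w i ≡ suc (toℕ (lookup σ i))
      w≡ i = Vecₚ.lookup-map i (suc ∘ toℕ) σ
      0<w : ∀ i → 0 ℕ.< lookup w i
      0<w i rewrite w≡ i = ℕ.z<s
      w<1+m : ∀ i → lookup w i ℕ.< suc m
      w<1+m i rewrite w≡ i = ℕ.s≤s (Finₚ.toℕ<n (lookup σ i))
      lower : ∀ i j → lookup w i ℕ.< lookup w j → lookup σ i < lookup σ j
      lower i j lt rewrite w≡ i | w≡ j = ℕ.s≤s⁻¹ lt
      raise : ∀ i j → lookup σ i < lookup σ j → lookup w i ℕ.< lookup w j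
      raise i j lt rewrite w≡ i | w≡ j = ℕ.s≤s lt

    doubleAscent⇔ : ∀ i → let e = extend 0 (suc m) σ in
      (lookup e (inject₁ (inject₁ i)) ℕ.< lookup e (inject₁ (suc i)) ×
       lookup e (inject₁ (suc i)) ℕ.< lookup e (suc (suc i))) ⇔ Consecutive _<_ σ i
    doubleAscent⇔ i = mk⇔
      (λ da → let b , a = to E da in (λ j j≡ → lower j i (b j j≡)) , λ j j≡ → lower i j (a j j≡))
      (λ (b , a) → from E ((λ j j≡ → raise j i (b j j≡)) , λ j j≡ → raise i j (a j j≡)))
      where E = consecutive⇔ ℕ._<_ 0 (suc m) w i 0<w w<1+m

    doubleDescent⇔ : ∀ i → let e = extend (suc m) 0 σ in
      (lookup e (inject₁ (inject₁ i)) ℕ.> lookup e (inject₁ (suc i)) ×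
       lookup e (inject₁ (suc i)) ℕ.> lookup e (suc (suc i))) ⇔ Consecutive Fin._>_ σ i
    doubleDescent⇔ i = mk⇔
      (λ da → let b , a = to E da in (λ j j≡ → lower i j (b j j≡)) , λ j j≡ → lower j i (a j j≡))
      (λ (b , a) → from E ((λ j j≡ → raise i j (b j j≡)) , λ j j≡ → raise j i (a j j≡)))
      where E = consecutive⇔ ℕ._>_ (suc m) 0 w i w<1+m 0<w

    module _ (i : Fin m) where
      fmax⇔ : (_ × (∀ j → j < i → lookup σ j < lookup σ i)) ⇔ LeftToRight _<_ σ i
      fmax⇔ = LeftToRight⇔ _<_ σ i ⇔-∘ (doubleAscent⇔ i ×-⇔ ⇔-id _)
      fmin⇔ : (_ × (∀ j → j < i → lookup σ i < lookup σ j)) ⇔ LeftToRight Fin._>_ σ i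
      fmin⇔ = LeftToRight⇔ Fin._>_ σ i ⇔-∘ (doubleDescent⇔ i ×-⇔ ⇔-id _)
      amin⇔ : (_ × (∀ j → i < j → lookup σ i < lookup σ j)) ⇔ RightToLeft _<_ σ i
      amin⇔ = RightToLeft⇔ _<_ σ i ⇔-∘ (doubleAscent⇔ i ×-⇔ ⇔-id _)
      amax⇔ : (_ × (∀ j → i < j → lookup σ j < lookup σ i)) ⇔ RightToLeft Fin._>_ σ i
      amax⇔ = RightToLeft⇔ Fin._>_ σ i ⇔-∘ (doubleDescent⇔ i ×-⇔ ⇔-id _)

  -- The condition at a single position that `fmaxFrom` counts, with the same running bound `m`.
  Peak : ∀ {v k} → ℕ → Vec (Fin v) k → Fin k → Set
  Peak m (x ∷ σ) zero    = m ℕ.≤ toℕ x × AscendsTo (toℕ x) (entries σ)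
  Peak m (x ∷ σ) (suc i) = Peak (m ⊔ suc (toℕ x)) σ i

  peak? : ∀ {v k} m (σ : Vec (Fin v) k) i → Dec (Peak m σ i)
  peak? m (x ∷ σ) zero    = (m ℕ.≤? toℕ x) ×-dec ascendsTo? (toℕ x) (entries σ)
  peak? m (x ∷ σ) (suc i) = peak? (m ⊔ suc (toℕ x)) σ i

  peak-sum : ∀ {v k} m (σ : Vec (Fin v) k) → sum (λ i → 𝟙 (peak? m σ i)) ≡ fmaxFrom m (entries σ)
  peak-sum m []      = refl
  peak-sum m (x ∷ σ) = cong (𝟙 ((m ℕ.≤? toℕ x) ×-dec ascendsTo? (toℕ x) (entries σ)) +_) (peak-sum (m ⊔ suc (toℕ x)) σ)

  LeftToRight⇒Peak : ∀ {v k} m (σ : Vec (Fin v) k) i → m ℕ.≤ toℕ (lookup σ i) → LeftToRight _<_ σ i → Peak m σ i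
  LeftToRight⇒Peak m (x ∷ [])    zero    m≤ _           = m≤ , tt
  LeftToRight⇒Peak m (x ∷ y ∷ σ) zero    m≤ (_ , after) = m≤ , after (suc zero) refl
  LeftToRight⇒Peak m (x ∷ σ)     (suc i) m≤ (extremal , after) =
    LeftToRight⇒Peak (m ⊔ suc (toℕ x)) σ i (ℕₚ.⊔-lub m≤ (extremal zero ℕ.z<s))
      ((λ j j<i → extremal (suc j) (ℕ.s<s j<i)) , λ j j≡ → after (suc j) (cong suc j≡))

  Peak⇒LeftToRight : ∀ {v k} m (σ : Vec (Fin v) k) i → Peak m σ i → m ℕ.≤ toℕ (lookup σ i) × LeftToRight _<_ σ i
  Peak⇒LeftToRight m (x ∷ σ) zero (m≤ , ascends) = m≤ , (λ _ ()) , after σ ascends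
    where
    after : ∀ {v k} {x : Fin v} (σ : Vec (Fin v) k) → AscendsTo (toℕ x) (entries σ) →
            ∀ (j : Fin (suc k)) → toℕ j ≡ 1 → x < lookup (x ∷ σ) j
    after (y ∷ σ) x<y (suc zero) _ = x<y
  Peak⇒LeftToRight m (x ∷ σ) (suc i) peak with m⊔x≤ , extremal , after ← Peak⇒LeftToRight (m ⊔ suc (toℕ x)) σ i peak =
    ℕₚ.m⊔n≤o⇒m≤o m _ m⊔x≤ ,
    (λ { zero _ → ℕₚ.m⊔n≤o⇒n≤o m _ m⊔x≤ ; (suc j) (ℕ.s≤s j<i) → extremal j j<i }) ,
    λ { (suc j) j≡ → after j (ℕₚ.suc-injective j≡) }

  fmax-entries : ∀ {m} (σ : Word m) → fmax σ ≡ fmaxFrom 0 (entries σ)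
  fmax-entries σ = trans (♯-cong (λ i → doubleAscent? σ i ×-dec leftToRightMax? σ i) (peak? 0 σ)
    (λ i → mk⇔ (LeftToRight⇒Peak 0 σ i ℕ.z≤n) (proj₂ ∘ Peak⇒LeftToRight 0 σ i) ⇔-∘ fmax⇔ σ i))
    (trans (♯-sum (peak? 0 σ)) (peak-sum 0 σ))

  -- Pattern classes as lists of words

  words-unique : ∀ v k → Uniqueᴸ (words v k)
  words-unique v zero    = [] ∷ []
  words-unique v (suc k) = Uniqueₚ.cartesianProductWith⁺ _∷_ Vecₚ.∷-injective (Uniqueₚ.allFin⁺ v) (words-unique v k)

  ∈-words : ∀ {v k} (σ : Vec (Fin v) k) → σ ∈ words v k
  ∈-words []      = here refl
  ∈-words (x ∷ σ) = ∈-cartesianProductWith⁺ _∷_ (∈-allFin x) (∈-words σ)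

  module _ {k m : ℕ} (τ : Vec ℕ k) where

    𝔖-unique : Uniqueᴸ (𝔖 m τ)
    𝔖-unique = Uniqueₚ.filter⁺ (λ σ → isPermutation? σ ×-dec ¬? (contains? τ σ)) (words-unique m m)

    ∈-𝔖⁺ : ∀ {σ : Word m} → IsPermutation σ → ¬ Contains τ σ → σ ∈ 𝔖 m τ
    ∈-𝔖⁺ σ! avoids = ∈-filter⁺ (λ σ → isPermutation? σ ×-dec ¬? (contains? τ σ)) (∈-words _) (σ! , avoids)

    ∈-𝔖⁻ : ∀ {σ : Word m} → σ ∈ 𝔖 m τ → IsPermutation σ × ¬ Contains τ σ
    ∈-𝔖⁻ σ∈ = proj₂ (∈-filter⁻ (λ σ → isPermutation? σ ×-dec ¬? (contains? τ σ)) {xs = words m m} σ∈)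

  set⇒↭ : ∀ {a} {A : Set a} {xs ys : List A} → Uniqueᴸ xs → Uniqueᴸ ys →
          (∀ {x} → x ∈ xs → x ∈ ys) → (∀ {x} → x ∈ ys → x ∈ xs) → xs ↭ ys
  set⇒↭ xs! ys! xs⊆ys ys⊆xs = ∼bag⇒↭ (unique∧set⇒bag xs! ys! (mk⇔ xs⊆ys ys⊆xs))

  -- The pigeonhole principle: distinct members of `ys`, as many as `ys` is long, exhaust it. It
  -- shows that the distinct entries of a permutation are all the numbers below m.
  ⊆∧length⇒↭ : ∀ {a} {A : Set a} (xs : List A) {ys} → Uniqueᴸ xs → (∀ {x} → x ∈ xs → x ∈ ys) →
               length ys ≡ length xs → xs ↭ ys
  ⊆∧length⇒↭ []       {[]} _          _     _       = ↭-refl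
  ⊆∧length⇒↭ (x ∷ xs) {ys} (x∉xs ∷ xs!) x∷xs⊆ys |ys|≡ with as , bs , refl ← ∈-∃++ (x∷xs⊆ys (here refl)) =
    ↭-trans (↭-prep x (⊆∧length⇒↭ xs xs! xs⊆as++bs
      (ℕₚ.suc-injective (trans (sym (↭-length (shift x as bs))) |ys|≡)))) (↭-sym (shift x as bs))
    where
    xs⊆as++bs : ∀ {y} → y ∈ xs → y ∈ as ++ bs
    xs⊆as++bs y∈xs with ∈-resp-↭ (shift x as bs) (x∷xs⊆ys (there y∈xs))
    ... | here refl = contradiction refl (All.lookup x∉xs y∈xs)
    ... | there y∈  = y∈

  entries-injective : ∀ {v k} {σ σ′ : Vec (Fin v) k} → entries σ ≡ entries σ′ → σ ≡ σ′
  entries-injective {σ = []}    {[]}      _  = refl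
  entries-injective {σ = x ∷ σ} {x′ ∷ σ′} eq with x≡ , σ≡ ← Listₚ.∷-injective eq =
    cong₂ _∷_ (Finₚ.toℕ-injective x≡) (entries-injective σ≡)

  length-entries : ∀ {v k} (σ : Vec (Fin v) k) → length (entries σ) ≡ k
  length-entries []      = refl
  length-entries (x ∷ σ) = cong suc (length-entries σ)

  entries-< : ∀ {v k} (σ : Vec (Fin v) k) → All (ℕ._< v) (entries σ)
  entries-< []      = []
  entries-< (x ∷ σ) = Finₚ.toℕ<n x ∷ entries-< σ

  All-entries⁺ : ∀ {v k} {P : ℕ → Set} (σ : Vec (Fin v) k) → (∀ i → P (toℕ (lookup σ i))) → All P (entries σ)
  All-entries⁺ []      P = []
  All-entries⁺ (x ∷ σ) P = P 0F ∷ All-entries⁺ σ (P ∘ suc)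

  All-entries⁻ : ∀ {v k} {P : ℕ → Set} (σ : Vec (Fin v) k) → All P (entries σ) → ∀ i → P (toℕ (lookup σ i))
  All-entries⁻ (x ∷ σ) (p ∷ ps) zero    = p
  All-entries⁻ (x ∷ σ) (p ∷ ps) (suc i) = All-entries⁻ σ ps i

  AllPairs-entries⁺ : ∀ {v k} {R : ℕ → ℕ → Set} (σ : Vec (Fin v) k) →
    (∀ {i j} → i < j → R (toℕ (lookup σ i)) (toℕ (lookup σ j))) → AllPairs R (entries σ)
  AllPairs-entries⁺ []      R = []
  AllPairs-entries⁺ (x ∷ σ) R = All-entries⁺ σ (λ i → R {0F} {suc i} ℕ.z<s) ∷
    AllPairs-entries⁺ σ (λ i<j → R (ℕ.s<s i<j))

  AllPairs-entries⁻ : ∀ {v k} {R : ℕ → ℕ → Set} (σ : Vec (Fin v) k) → AllPairs R (entries σ) →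
    ∀ {i j} → i < j → R (toℕ (lookup σ i)) (toℕ (lookup σ j))
  AllPairs-entries⁻ (x ∷ σ) (r ∷ rs) {zero}  {suc j} _           = All-entries⁻ σ r j
  AllPairs-entries⁻ (x ∷ σ) (r ∷ rs) {suc i} {suc j} (ℕ.s<s i<j) = AllPairs-entries⁻ σ rs i<j

  Avoids-entries⁺ : ∀ {v n} {P : ℕ → ℕ → ℕ → Set} (σ : Vec (Fin v) n) →
    (∀ {i j k} → i < j → j < k → P (toℕ (lookup σ i)) (toℕ (lookup σ j)) (toℕ (lookup σ k))) → Avoids P (entries σ)
  Avoids-entries⁺ []      P = tt
  Avoids-entries⁺ (x ∷ σ) P = AllPairs-entries⁺ σ (λ i<j → P {0F} ℕ.z<s (ℕ.s<s i<j)) ,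
    Avoids-entries⁺ σ (λ i<j j<k → P (ℕ.s<s i<j) (ℕ.s<s j<k))

  Avoids-entries⁻ : ∀ {v n} {P : ℕ → ℕ → ℕ → Set} (σ : Vec (Fin v) n) → Avoids P (entries σ) →
    ∀ {i j k} → i < j → j < k → P (toℕ (lookup σ i)) (toℕ (lookup σ j)) (toℕ (lookup σ k))
  Avoids-entries⁻ (x ∷ σ) (p , ps) {zero}  {suc j} {suc k} _           (ℕ.s<s j<k) = AllPairs-entries⁻ σ p j<k
  Avoids-entries⁻ (x ∷ σ) (p , ps) {suc i} {suc j} {suc k} (ℕ.s<s i<j) (ℕ.s<s j<k) = Avoids-entries⁻ σ ps i<j j<k

  Unique-tabulate⁻ : ∀ {a} {A : Set a} {k} (σ : Vec A k) →
    (∀ {i j} → i < j → lookup σ i ≢ lookup σ j) → Unique σ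
  Unique-tabulate⁻ []      distinct = []
  Unique-tabulate⁻ (x ∷ σ) distinct = Allᵛₚ.lookup⁻ (λ i → distinct {0F} {suc i} ℕ.z<s) ∷
    Unique-tabulate⁻ σ (λ i<j → distinct (ℕ.s<s i<j))

  permutation⇒↭ : ∀ {m} {σ : Word m} → IsPermutation σ → entries σ ↭ interval 0 m
  permutation⇒↭ {m} {σ} σ! = ⊆∧length⇒↭ (entries σ)
    (AllPairs-entries⁺ σ (λ i<j eq → Finₚ.<⇒≢ i<j (Uniqueᵛₚ.lookup-injective σ! _ _ (Finₚ.toℕ-injective eq))))
    (λ x∈ → ∈-interval⁺ 0 m ℕ.z≤n (All.lookup (entries-< σ) x∈))
    (trans (Listₚ.length-iterate suc 0 m) (sym (length-entries σ)))
    where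
    ∈-interval⁺ : ∀ o n {x} → o ℕ.≤ x → x ℕ.< o + n → x ∈ interval o n
    ∈-interval⁺ o zero    o≤x x<o = contradiction (ℕₚ.<-≤-trans x<o (ℕₚ.≤-reflexive (ℕₚ.+-identityʳ o))) (ℕₚ.≤⇒≯ o≤x)
    ∈-interval⁺ o (suc n) {x} o≤x x<o+1+n with x ℕ.≟ o
    ... | yes x≡o = here x≡o
    ... | no  x≢o = there (∈-interval⁺ (suc o) n (ℕₚ.≤∧≢⇒< o≤x (x≢o ∘ sym))
                      (ℕₚ.<-≤-trans x<o+1+n (ℕₚ.≤-reflexive (ℕₚ.+-suc o n))))

  interval-unique : ∀ o n → Uniqueᴸ (interval o n)
  interval-unique o zero    = []
  interval-unique o (suc n) = All.tabulate (λ x∈ → ℕₚ.<⇒≢ (proj₁ (∈-interval (suc o) n x∈))) ∷ interval-unique (suc o) n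

  fromEntries : ∀ {v} k l → length l ≡ k → All (ℕ._< v) l → ∃ λ (σ : Vec (Fin v) k) → entries σ ≡ l
  fromEntries zero    []      _    _          = [] , refl
  fromEntries (suc k) (x ∷ l) |l|≡ (x<v ∷ l<v) with σ , σ≡ ← fromEntries k l (ℕₚ.suc-injective |l|≡) l<v =
    fromℕ< x<v ∷ σ , cong₂ _∷_ (Finₚ.toℕ-fromℕ< x<v) σ≡

  ↭⇒permutation : ∀ m {l} → l ↭ interval 0 m → ∃ λ (σ : Word m) → IsPermutation σ × entries σ ≡ l
  ↭⇒permutation m {l} l↭ with σ , refl ← fromEntries m l (trans (↭-length l↭) (Listₚ.length-iterate suc 0 m))
      (All.tabulate (λ x∈ → proj₂ (∈-interval 0 m (∈-resp-↭ l↭ x∈)))) =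
    σ , Unique-tabulate⁻ σ (λ i<j eq → AllPairs-entries⁻ σ (Unique-resp-↭ (≡.setoid ℕ) (↭⇒↭ₛ (↭-sym l↭)) (interval-unique 0 m)) i<j (cong toℕ eq)) , refl

  Describes : (ℕ → ℕ → ℕ → Set) → ∀ {k} → Vec ℕ k → Set
  Describes P τ = ∀ {m} (σ : Word m) → (¬ Contains τ σ) ⇔ Avoids P (entries σ)

  𝔖-entries-↭ : ∀ m {k} (τ : Vec ℕ k) P {ls : List (List ℕ)} → Describes P τ → Uniqueᴸ ls →
                (∀ {l} → l ∈ ls ⇔ (l ↭ interval 0 m × Avoids P l)) → List.map entries (𝔖 m τ) ↭ ls
  𝔖-entries-↭ m τ P {ls} describes ls! ∈ls = set⇒↭ (Uniqueₚ.map⁺ entries-injective (𝔖-unique τ)) ls! ⊆ ⊇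
    where
    ⊆ : ∀ {l} → l ∈ List.map entries (𝔖 m τ) → l ∈ ls
    ⊆ l∈ = let σ , σ∈ , l≡ = ∈-map⁻ entries l∈ ; σ! , avoids = ∈-𝔖⁻ τ σ∈ in
      subst (_∈ ls) (sym l≡) (from ∈ls (permutation⇒↭ σ! , to (describes σ) avoids))
    ⊇ : ∀ {l} → l ∈ ls → l ∈ List.map entries (𝔖 m τ)
    ⊇ l∈ = let l↭ , avoids = to ∈ls l∈ ; σ , σ! , σ≡ = ↭⇒permutation m l↭ in
      subst (_∈ List.map entries (𝔖 m τ)) σ≡
        (∈-map⁺ entries (∈-𝔖⁺ τ σ! (from (describes σ) (subst (Avoids P) (sym σ≡) avoids))))

  pattern-321 pattern-231 : Vec ℕ 3
  pattern-321 = 3 ∷ 2 ∷ 1 ∷ []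
  pattern-231 = 2 ∷ 3 ∷ 1 ∷ []

  Concordant : ∀ {k m} → Vec ℕ k → Word m → Vec (Fin m) k → Fin k → Fin k → Set
  Concordant τ σ ι a b = (lookup τ a ℕ.< lookup τ b × lookup σ (lookup ι a) < lookup σ (lookup ι b)) ⊎
                         (lookup τ b ℕ.< lookup τ a × lookup σ (lookup ι b) < lookup σ (lookup ι a))

  -- `Concordant` is symmetric in its two indices and decides both comparisons at once, so the pairs
  -- with a < b suffice.
  concordant⇒occurrence : ∀ {k m} (τ : Vec ℕ k) (σ : Word m) ι →
    (∀ a b → a < b → lookup ι a < lookup ι b × Concordant τ σ ι a b) → Occurrence τ σ ι
  concordant⇒occurrence τ σ ι ordered a b with Finₚ.<-cmp a b
  ... | tri< a<b _ _ with ordered a b a<b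
  ...   | ιa<ιb , inj₁ (τa<τb , σa<σb) = (λ _ → ιa<ιb) , (λ _ → σa<σb) , λ _ → τa<τb
  ...   | ιa<ιb , inj₂ (τb<τa , σb<σa) =
    (λ _ → ιa<ιb) , (λ τa<τb → contradiction τa<τb (ℕₚ.<-asym τb<τa)) , λ σa<σb → contradiction σa<σb (ℕₚ.<-asym σb<σa)
  concordant⇒occurrence τ σ ι ordered a .a | tri≈ a≮a refl _ =
    (λ a<a → contradiction a<a a≮a) , (λ lt → contradiction lt (ℕₚ.<-irrefl refl)) , λ lt → contradiction lt (ℕₚ.<-irrefl refl)
  concordant⇒occurrence τ σ ι ordered a b | tri> a≮b _ b<a with proj₂ (ordered b a b<a)
  ... | inj₁ (τb<τa , σb<σa) =
    (λ a<b → contradiction a<b a≮b) , (λ lt → contradiction lt (ℕₚ.<-asym τb<τa)) , λ lt → contradiction lt (ℕₚ.<-asym σb<σa)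
  ... | inj₂ (τa<τb , σa<σb) = (λ a<b → contradiction a<b a≮b) , (λ _ → σa<σb) , λ _ → τa<τb

  three-positions : ∀ {m} (τ : Vec ℕ 3) (σ : Word m) {i j k} → i < j → j < k → let ι = i ∷ j ∷ k ∷ [] in
    Concordant τ σ ι 0F 1F → Concordant τ σ ι 0F 2F → Concordant τ σ ι 1F 2F → Contains τ σ
  three-positions τ σ {i} {j} {k} i<j j<k c₀₁ c₀₂ c₁₂ = i ∷ j ∷ k ∷ [] , concordant⇒occurrence τ σ (i ∷ j ∷ k ∷ []) λ where
    0F 1F _ → i<j , c₀₁
    0F 2F _ → ℕₚ.<-trans i<j j<k , c₀₂
    1F 2F _ → j<k , c₁₂
    (suc 0F) (suc 0F) (ℕ.s<s ())
    2F (suc 0F) (ℕ.s<s ())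
    2F 2F (ℕ.s<s (ℕ.s<s ()))

  describes-321 : Describes Not321 pattern-321
  describes-321 σ = mk⇔
    (λ avoids → Avoids-entries⁺ σ (λ i<j j<k (k<j , j<i) → avoids (three-positions pattern-321 σ i<j j<k
      (inj₂ (ℕₚ.≤-refl , j<i)) (inj₂ (ℕ.s≤s (ℕ.s≤s ℕ.z≤n) , ℕₚ.<-trans k<j j<i)) (inj₂ (ℕₚ.≤-refl , k<j)))))
    (λ avoids (_ , occ) → Avoids-entries⁻ σ avoids (proj₁ (occ 0F 1F) ℕ.z<s) (proj₁ (occ 1F 2F) (ℕ.s<s ℕ.z<s))
      (proj₁ (proj₂ (occ 2F 1F)) ℕₚ.≤-refl , proj₁ (proj₂ (occ 1F 0F)) ℕₚ.≤-refl))

  describes-231 : Describes Not231 pattern-231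
  describes-231 σ = mk⇔
    (λ avoids → Avoids-entries⁺ σ (λ i<j j<k (k<i , i<j′) → avoids (three-positions pattern-231 σ i<j j<k
      (inj₁ (ℕₚ.≤-refl , i<j′)) (inj₂ (ℕₚ.≤-refl , k<i)) (inj₂ (ℕ.s≤s (ℕ.s≤s ℕ.z≤n) , ℕₚ.<-trans k<i i<j′)))))
    (λ avoids (_ , occ) → Avoids-entries⁻ σ avoids (proj₁ (occ 0F 1F) ℕ.z<s) (proj₁ (occ 1F 2F) (ℕ.s<s ℕ.z<s))
      (proj₁ (proj₂ (occ 2F 0F)) ℕₚ.≤-refl , proj₁ (proj₂ (occ 0F 1F)) ℕₚ.≤-refl))

  -- Reversal and complement

  opposite-injective : ∀ {n} {i j : Fin n} → opposite i ≡ opposite j → i ≡ j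
  opposite-injective {i = i} {j} eq = trans (sym (Finₚ.opposite-involutive i))
    (trans (cong opposite eq) (Finₚ.opposite-involutive j))

  -- In this additive form the order lemmas about `opposite` follow by cancellation, without
  -- truncated subtraction.
  opposite-+ : ∀ {n} (i : Fin n) → suc (toℕ (opposite i) + toℕ i) ≡ n
  opposite-+ {n} i = trans (cong (λ k → suc (k + toℕ i)) (Finₚ.opposite-prop i))
    (trans (sym (ℕₚ.+-suc _ (toℕ i))) (ℕₚ.m∸n+n≡m (Finₚ.toℕ<n i)))

  opposite-< : ∀ {n} {i j : Fin n} → i < j → opposite j < opposite i
  opposite-< {n} {i} {j} i<j = ℕₚ.+-cancelʳ-< (toℕ i) _ _ (ℕₚ.<-≤-trans
    (ℕₚ.+-monoʳ-< (toℕ (opposite j)) i<j)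
    (ℕₚ.≤-reflexive (ℕₚ.suc-injective (trans (opposite-+ j) (sym (opposite-+ i))))))

  opposite-<⁻ : ∀ {n} {i j : Fin n} → opposite i < opposite j → j < i
  opposite-<⁻ {i = i} {j} lt =
    subst₂ _<_ (Finₚ.opposite-involutive j) (Finₚ.opposite-involutive i) (opposite-< lt)

  <⇔opposite : ∀ {n} {i j : Fin n} → i < j ⇔ opposite j < opposite i
  <⇔opposite = mk⇔ opposite-< opposite-<⁻

  opposite-suc′ : ∀ {n} {i j : Fin n} → toℕ j ≡ suc (toℕ i) → suc (toℕ (opposite j)) ≡ toℕ (opposite i)
  opposite-suc′ {i = i} {j} j≡ = ℕₚ.+-cancelʳ-≡ (toℕ i) _ _ (ℕₚ.suc-injective (trans
    (cong suc (trans (sym (ℕₚ.+-suc (toℕ (opposite j)) (toℕ i))) (cong (toℕ (opposite j) +_) (sym j≡))))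
    (trans (opposite-+ j) (sym (opposite-+ i)))))

  opposite-inject₁ : ∀ {n} (i : Fin n) → opposite (inject₁ i) ≡ suc (opposite i)
  opposite-inject₁ zero    = refl
  opposite-inject₁ (suc i) = cong inject₁ (opposite-inject₁ i)

  complement reversal : ∀ {m} → Word m → Word m
  complement σ = Vec.map opposite σ
  reversal σ = Vec.tabulate (λ i → lookup σ (opposite i))

  lookup-complement : ∀ {m} (σ : Word m) i → lookup (complement σ) i ≡ opposite (lookup σ i)
  lookup-complement σ i = Vecₚ.lookup-map i opposite σ

  lookup-reversal : ∀ {m} (σ : Word m) i → lookup (reversal σ) i ≡ lookup σ (opposite i)
  lookup-reversal σ i = Vecₚ.lookup∘tabulate _ i

  complement-involutive : ∀ {m} (σ : Word m) → complement (complement σ) ≡ σ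
  complement-involutive σ = trans (sym (Vecₚ.map-∘ opposite opposite σ))
    (trans (Vecₚ.map-cong Finₚ.opposite-involutive σ) (Vecₚ.map-id σ))

  reversal-involutive : ∀ {m} (σ : Word m) → reversal (reversal σ) ≡ σ
  reversal-involutive σ = trans
    (Vecₚ.tabulate-cong (λ i → trans (lookup-reversal σ (opposite i)) (cong (lookup σ) (Finₚ.opposite-involutive i))))
    (Vecₚ.tabulate∘lookup σ)

  record Symmetry (φ : ∀ {m} → Word m → Word m) : Set where
    field
      involutive  : ∀ {m} (σ : Word m) → φ (φ σ) ≡ σ
      permutation : ∀ {m} {σ : Word m} → IsPermutation σ → IsPermutation (φ σ)

    injective : ∀ {m} {σ σ′ : Word m} → φ σ ≡ φ σ′ → σ ≡ σ′
    injective {σ = σ} {σ′} eq = trans (sym (involutive σ)) (trans (cong φ eq) (involutive σ′))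

  complement-symmetry : Symmetry complement
  complement-symmetry = record
    { involutive  = complement-involutive
    ; permutation = Uniqueᵛₚ.map⁺ opposite-injective
    }

  reversal-symmetry : Symmetry reversal
  reversal-symmetry = record
    { involutive  = reversal-involutive
    ; permutation = λ σ! → Uniqueᵛₚ.tabulate⁺ (λ eq → opposite-injective (Uniqueᵛₚ.lookup-injective σ! _ _ eq))
    }

  Transports : (∀ {m} → Word m → Word m) → Vec ℕ 3 → Vec ℕ 3 → Set
  Transports φ τ τ′ = ∀ {m} (σ : Word m) → Contains τ σ → Contains τ′ (φ σ)

  -- Avoidance is carried over by contraposition: each inclusion uses that an occurrence in the
  -- image can be sent back by the involution, hence the two transports.
  𝔖-symmetry : ∀ {φ : ∀ {m} → Word m → Word m} {τ τ′} → Symmetry φ → Transports φ τ τ′ → Transports φ τ′ τ →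
               ∀ m → List.map φ (𝔖 m τ) ↭ 𝔖 m τ′
  𝔖-symmetry {φ} {τ} {τ′} symmetry τ⇒τ′ τ′⇒τ m =
    set⇒↭ (Uniqueₚ.map⁺ injective (𝔖-unique τ)) (𝔖-unique τ′) ⊆ ⊇
    where
    open Symmetry symmetry
    ⊆ : ∀ {σ} → σ ∈ List.map φ (𝔖 m τ) → σ ∈ 𝔖 m τ′
    ⊆ σ∈ = let ρ , ρ∈ , σ≡ = ∈-map⁻ φ σ∈ ; ρ! , avoids = ∈-𝔖⁻ τ ρ∈ in
      subst (_∈ 𝔖 m τ′) (sym σ≡) (∈-𝔖⁺ τ′ (permutation ρ!)
        (λ contains → avoids (subst (Contains τ) (involutive ρ) (τ′⇒τ (φ ρ) contains))))
    ⊇ : ∀ {σ} → σ ∈ 𝔖 m τ′ → σ ∈ List.map φ (𝔖 m τ)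
    ⊇ {σ} σ∈ = let σ! , avoids = ∈-𝔖⁻ τ′ σ∈ in
      subst (_∈ List.map φ (𝔖 m τ)) (involutive σ) (∈-map⁺ φ (∈-𝔖⁺ τ (permutation σ!)
        (λ contains → avoids (subst (Contains τ′) (involutive σ) (τ⇒τ′ (φ σ) contains)))))

  -- Only the relative order of the pattern letters matters, and on three indices these conditions
  -- are decidable; for the concrete patterns they are settled by evaluation.
  OppositeOrder MirroredOrder : Vec ℕ 3 → Vec ℕ 3 → Set
  OppositeOrder τ τ′ = ∀ a b → (lookup τ′ a ℕ.< lookup τ′ b → lookup τ b ℕ.< lookup τ a) ×
                               (lookup τ b ℕ.< lookup τ a → lookup τ′ a ℕ.< lookup τ′ b)
  MirroredOrder τ τ′ = ∀ a b → (lookup τ′ a ℕ.< lookup τ′ b → lookup τ (opposite a) ℕ.< lookup τ (opposite b)) ×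
                               (lookup τ (opposite a) ℕ.< lookup τ (opposite b) → lookup τ′ a ℕ.< lookup τ′ b)

  oppositeOrder? : ∀ τ τ′ → Dec (OppositeOrder τ τ′)
  oppositeOrder? τ τ′ = Finₚ.all? λ a → Finₚ.all? λ b →
    ((_ ℕ.<? _) →-dec (_ ℕ.<? _)) ×-dec ((_ ℕ.<? _) →-dec (_ ℕ.<? _))

  mirroredOrder? : ∀ τ τ′ → Dec (MirroredOrder τ τ′)
  mirroredOrder? τ τ′ = Finₚ.all? λ a → Finₚ.all? λ b →
    ((_ ℕ.<? _) →-dec (_ ℕ.<? _)) ×-dec ((_ ℕ.<? _) →-dec (_ ℕ.<? _))

  complement-transports : ∀ τ τ′ → OppositeOrder τ τ′ → Transports complement τ τ′
  complement-transports τ τ′ order σ (ι , occ) = ι , λ a b →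
    let ι-mono , _ = occ a b ; _ , σ-mono , σ-reflect = occ b a in
    ι-mono ,
    (λ lt → subst₂ _<_ (sym (lookup-complement σ (lookup ι a))) (sym (lookup-complement σ (lookup ι b)))
      (opposite-< (σ-mono (proj₁ (order a b) lt)))) ,
    (λ lt → proj₂ (order a b) (σ-reflect (opposite-<⁻
      (subst₂ _<_ (lookup-complement σ (lookup ι a)) (lookup-complement σ (lookup ι b)) lt))))

  reversal-transports : ∀ τ τ′ → MirroredOrder τ τ′ → Transports reversal τ τ′
  reversal-transports τ τ′ order {m} σ (ι , occ) = ι′ , λ a b →
    let _ , σ-mono , σ-reflect = occ (opposite a) (opposite b) ; ι-mono , _ = occ (opposite b) (opposite a) in
    (λ a<b → subst₂ _<_ (sym (ι′≡ a)) (sym (ι′≡ b)) (opposite-< (ι-mono (opposite-< a<b)))) ,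
    (λ lt → subst₂ _<_ (sym (σ′≡ a)) (sym (σ′≡ b)) (σ-mono (proj₁ (order a b) lt))) ,
    (λ lt → proj₂ (order a b) (σ-reflect (subst₂ _<_ (σ′≡ a) (σ′≡ b) lt)))
    where
    ι′ : Vec (Fin m) 3
    -- Each position is reflected, and the list of positions is read backwards so that it increases
    -- again.
    ι′ = Vec.tabulate (λ a → opposite (lookup ι (opposite a)))
    ι′≡ : ∀ a → lookup ι′ a ≡ opposite (lookup ι (opposite a))
    ι′≡ a = Vecₚ.lookup∘tabulate (λ b → opposite (lookup ι (opposite b))) a
    σ′≡ : ∀ a → lookup (reversal σ) (lookup ι′ a) ≡ lookup σ (lookup ι (opposite a))
    σ′≡ a = trans (cong (lookup (reversal σ)) (ι′≡ a))
      (trans (lookup-reversal σ _) (cong (lookup σ) (Finₚ.opposite-involutive (lookup ι (opposite a)))))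

  complement-< : ∀ {m} (σ : Word m) i j → lookup (complement σ) i < lookup (complement σ) j ⇔ lookup σ j < lookup σ i
  complement-< σ i j rewrite lookup-complement σ i | lookup-complement σ j = ⇔-sym <⇔opposite

  reversal-< : ∀ {m} (σ : Word m) i j →
               lookup (reversal σ) i < lookup (reversal σ) j ⇔ lookup σ (opposite i) < lookup σ (opposite j)
  reversal-< σ i j rewrite lookup-reversal σ i | lookup-reversal σ j = mk⇔ id id

  asc-complement : ∀ {m} (σ : Word m) → asc (complement σ) ≡ des σ
  asc-complement {zero}  σ = refl
  asc-complement {suc k} σ = ♯-cong _ _ (λ i → complement-< σ (inject₁ i) (suc i))

  des-complement : ∀ {m} (σ : Word m) → des (complement σ) ≡ asc σ
  des-complement {zero}  σ = refl
  des-complement {suc k} σ = ♯-cong _ _ (λ i → complement-< σ (suc i) (inject₁ i))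

  -- Reversal sends the adjacent pair with index i to the one with index `opposite i` and exchanges
  -- its two members. The member `suc i` is handled by computation, the member `inject₁ i` by
  -- `opposite-inject₁`.
  reversed-descent : ∀ {k} (σ : Word (suc k)) i → lookup (reversal σ) (inject₁ i) < lookup (reversal σ) (suc i) ⇔
                     lookup σ (suc (opposite i)) < lookup σ (inject₁ (opposite i))
  reversed-descent σ i rewrite sym (opposite-inject₁ i) = reversal-< σ (inject₁ i) (suc i)

  asc-reversal : ∀ {m} (σ : Word m) → asc (reversal σ) ≡ des σ
  asc-reversal {zero}  σ = refl
  asc-reversal {suc k} σ = trans (♯-cong _ (λ i → D? (opposite i)) (λ i → reversed-descent σ i)) (♯-opposite D?)
    where
    D? = λ (i : Fin k) → lookup σ (suc i) <? lookup σ (inject₁ i)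

  complement-between : ∀ {m} (σ : Word m) {A : Set} i j k →
    (A × lookup (complement σ) i < lookup (complement σ) j × lookup (complement σ) j < lookup (complement σ) k) ⇔
    (A × lookup σ k < lookup σ j × lookup σ j < lookup σ i)
  complement-between σ i j k = mk⇔
    (λ (a , i<j , j<k) → a , to (complement-< σ j k) j<k , to (complement-< σ i j) i<j)
    (λ (a , k<j , j<i) → a , from (complement-< σ i j) j<i , from (complement-< σ j k) k<j)

  [13-2]-complement : ∀ {m} (σ : Word m) → [13-2] (complement σ) ≡ [31-2] σ
  [13-2]-complement {zero}  σ = refl
  [13-2]-complement {suc k} σ = ♯₂-cong _ _ (λ i j → complement-between σ (inject₁ i) j (suc i))

  [2-31]-complement : ∀ {m} (σ : Word m) → [2-31] (complement σ) ≡ [2-13] σ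
  [2-31]-complement {zero}  σ = refl
  [2-31]-complement {suc k} σ = ♯₂-cong _ _ (λ i j → complement-between σ (suc i) j (inject₁ i))

  [2-13]-reversal : ∀ {m} (σ : Word m) → [2-13] (reversal σ) ≡ [31-2] σ
  [2-13]-reversal {zero}  σ = refl
  [2-13]-reversal {suc k} σ = trans (♯₂-cong _ (λ i j → D? (opposite i) (opposite j)) reversed) (♯₂-opposite D?)
    where
    D? = λ (i : Fin k) (j : Fin (suc k)) →
      (suc i <? j) ×-dec (lookup σ (suc i) <? lookup σ j) ×-dec (lookup σ j <? lookup σ (inject₁ i))
    ρ = lookup (reversal σ)
    reversed : ∀ (i : Fin k) (j : Fin (suc k)) →
      (j < inject₁ i × ρ (inject₁ i) < ρ j × ρ j < ρ (suc i)) ⇔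
      (suc (opposite i) < opposite j × lookup σ (suc (opposite i)) < lookup σ (opposite j) ×
       lookup σ (opposite j) < lookup σ (inject₁ (opposite i)))
    reversed i j = subst (λ p → (j < inject₁ i × ρ (inject₁ i) < ρ j × ρ j < ρ (suc i)) ⇔
        (p < opposite j × lookup σ p < lookup σ (opposite j) × lookup σ (opposite j) < lookup σ (inject₁ (opposite i))))
      (opposite-inject₁ i) (<⇔opposite ×-⇔ reversal-< σ (inject₁ i) j ×-⇔ reversal-< σ j (suc i))

  fmin-complement : ∀ {m} (σ : Word m) → fmin (complement σ) ≡ fmax σ
  fmin-complement σ = ♯-cong _ _ (λ i → ⇔-sym (fmax⇔ σ i) ⇔-∘ (mirror i ⇔-∘ fmin⇔ (complement σ) i))
    where
    mirror : ∀ i → LeftToRight Fin._>_ (complement σ) i ⇔ LeftToRight _<_ σ i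
    mirror i = mk⇔
      (λ (extremal , after) → (λ j j<i → to (complement-< σ i j) (extremal j j<i)) , λ j j≡ → to (complement-< σ j i) (after j j≡))
      (λ (extremal , after) → (λ j j<i → from (complement-< σ i j) (extremal j j<i)) , λ j j≡ → from (complement-< σ j i) (after j j≡))

  amin-complement : ∀ {m} (σ : Word m) → amin (complement σ) ≡ amax σ
  amin-complement σ = ♯-cong _ _ (λ i → ⇔-sym (amax⇔ σ i) ⇔-∘ (mirror i ⇔-∘ amin⇔ (complement σ) i))
    where
    mirror : ∀ i → RightToLeft _<_ (complement σ) i ⇔ RightToLeft Fin._>_ σ i
    mirror i = mk⇔
      (λ (extremal , before) → (λ j i<j → to (complement-< σ i j) (extremal j i<j)) , λ j j≡ → to (complement-< σ j i) (before j j≡))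
      (λ (extremal , before) → (λ j i<j → from (complement-< σ i j) (extremal j i<j)) , λ j j≡ → from (complement-< σ j i) (before j j≡))

  amax-reversal : ∀ {m} (σ : Word m) → amax (reversal σ) ≡ fmax σ
  amax-reversal σ = trans (♯-cong _ (M? ∘ opposite) (λ i → ⇔-sym (fmax⇔ σ (opposite i)) ⇔-∘ (mirror i ⇔-∘ amax⇔ (reversal σ) i)))
    (♯-opposite M?)
    where
    M? = λ i → doubleAscent? σ i ×-dec leftToRightMax? σ i
    oo = Finₚ.opposite-involutive
    mirror : ∀ i → RightToLeft Fin._>_ (reversal σ) i ⇔ LeftToRight _<_ σ (opposite i)
    mirror i = mk⇔
      (λ (extremal , before) →
        (λ j j<oi → subst (λ p → lookup σ p < _) (oo j) (to (reversal-< σ (opposite j) i)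
          (extremal (opposite j) (opposite-<⁻ (subst (_< opposite i) (sym (oo j)) j<oi))))) ,
        (λ j j≡ → subst (λ p → _ < lookup σ p) (oo j) (to (reversal-< σ i (opposite j))
          (before (opposite j) (trans (opposite-suc′ j≡) (cong toℕ (oo i)))))))
      (λ (extremal , after) →
        (λ j i<j → from (reversal-< σ j i) (extremal (opposite j) (opposite-< i<j))) ,
        (λ j j≡ → from (reversal-< σ i j) (after (opposite j) (sym (opposite-suc′ (sym j≡))))))

open Permutations

-- The classes of 321 and 231 matched with their enumerations

𝔖-321 : ∀ m {k} (τ : Vec ℕ k) → Describes Not321 τ → List.map entries (𝔖 m τ) ↭ arrangements [] 0 m
𝔖-321 m τ describes = 𝔖-entries-↭ m τ Not321 describes (arrangements-unique [] 0 m empty) (mk⇔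
  (λ l∈ → let l↭ , _ , avoids = arrangements-sound [] 0 m empty l∈ in l↭ , avoids)
  (λ (l↭ , avoids) → arrangements-complete [] 0 m _ empty l↭ (nothing-below-0 _ , avoids)))
  where
  empty : Queue [] 0
  empty = [] , All.[]
  -- At the start the queue is empty and m = 0, so the auxiliary leading letter imposes no
  -- condition.
  nothing-below-0 : ∀ l → AllPairs.AllPairs (Not321 0) l
  nothing-below-0 []      = []
  nothing-below-0 (x ∷ l) = All.universal (λ _ ()) l AllPairs.∷ nothing-below-0 l

𝔖-231 : ∀ m {k} (τ : Vec ℕ k) → Describes Not231 τ → List.map entries (𝔖 m τ) ↭ List.map (word 0) (trees m)
𝔖-231 m τ describes = 𝔖-entries-↭ m τ Not231 describes (Uniqueₚ.map⁺ (word-injective 0 _ _) (treesWithin-unique m m)) (mk⇔ sound complete)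
  where
  sound : ∀ {l} → l ∈ List.map (word 0) (trees m) → l ↭ interval 0 m × Avoids Not231 l
  sound l∈ with t , t∈ , refl ← ∈-map⁻ (word 0) l∈ with refl ← ∈-trees⇒size m t∈ = word-↭ 0 t , word-avoids 0 t
  complete : ∀ {l} → l ↭ interval 0 m × Avoids Not231 l → l ∈ List.map (word 0) (trees m)
  complete (l↭ , avoids) with t , refl ← word-complete m 0 m _ ℕₚ.≤-refl l↭ avoids =
    ∈-map⁺ (word 0) (subst (λ k → t ∈ trees k) size≡m (∈-trees⁺ t))
    where
    size≡m : size t ≡ m
    size≡m = trans (sym (length-word 0 t)) (trans (↭-length l↭) (Listₚ.length-iterate suc 0 m))

-- The common series of the five quadruples and the two identities

module Identities {c ℓ} (R : CommutativeRing c ℓ) where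
  open CommutativeRing R
    using (Carrier; 1#; _≈_; _*_; setoid; *-congˡ; *-congʳ; *-cong; *-identityʳ; *-identityˡ; *-assoc; +-identityˡ)
    renaming (_+_ to _⊕_; *-comm to ⊗-comm; refl to ≈-refl; trans to ≈-trans)
  open GeneratingFunctions R using (_^_; N)
  open import Data.Nat using (_+_)
  open PowerSeries R
  open FunctionalEquations R
  open Sums R
  open TreeSeries R
  open Sum321 R
  open Sum231 R
  open SetoidReasoning setoid

  -- Parameters such as `t * q⁻¹ * q` and `t` agree only up to the equality of the ring, so
  -- replacing one by the other has to be justified tree by tree.
  weightS-cong : ∀ q {u v} → u ≈ v → ∀ t → weightS q u t ≈ weightS q v t
  weightT-cong : ∀ q {u v} → u ≈ v → ∀ t → weightT q u t ≈ weightT q v t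
  weightS-cong q u≈v leaf       = ≈-refl
  weightS-cong q u≈v (node s t) = *-cong u≈v (*-cong (weightS-cong q u≈v s) (weightT-cong q u≈v t))
  weightT-cong q u≈v leaf       = ≈-refl
  weightT-cong q u≈v (node s t) = *-congˡ (*-cong (weightT-cong q u≈v t) (*-congˡ (weightS-cong q u≈v s)))

  weightF-cong : ∀ q {u v} → u ≈ v → ∀ r t → weightF q u r t ≈ weightF q v r t
  weightF-cong q u≈v r leaf                  = ≈-refl
  weightF-cong q u≈v r (node leaf t)         = *-congˡ (weightF-cong q u≈v r t)
  weightF-cong q u≈v r (node s@(node _ _) t) = *-cong (weightS-cong q u≈v s) (weightF-cong q u≈v r t)

  seriesF-cong : ∀ q {u v} → u ≈ v → ∀ r → seriesF q u r ≋ seriesF q v r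
  seriesF-cong q u≈v r n = ∑-cong (trees n) (weightF-cong q u≈v r)

  record HasSeries (Q : Quadruple) : Set (c Level.⊔ ℓ) where
    open Quadruple Q
    field
      series : ∀ t q r n →
        ∑ (𝔖 n τ) (λ σ → t ^ stat₁ σ * q ^ stat₂ σ * r ^ stat₃ σ) ≈ seriesF q (t * q) r n

  open HasSeries public

  ^-cong₃ : ∀ t q r {a b c a′ b′ c′} → a ≡ a′ → b ≡ b′ → c ≡ c′ →
            t ^ a * q ^ b * r ^ c ≈ t ^ a′ * q ^ b′ * r ^ c′
  ^-cong₃ t q r refl refl refl = ≈-refl

  ∑-entries : ∀ m {k} (τ : Vec ℕ k) {ls} → List.map entries (𝔖 m τ) ↭ ls → ∀ {f : Word m → Carrier} {g} →
              (∀ σ → f σ ≈ g (entries σ)) → ∑ (𝔖 m τ) f ≈ ∑ ls g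
  ∑-entries m τ {ls} 𝔖↭ {f} {g} f≈g = begin
    ∑ (𝔖 m τ) f                      ≈⟨ ∑-cong (𝔖 m τ) f≈g ⟩
    ∑ (𝔖 m τ) (g ∘ entries)          ≡⟨ ∑-map entries (𝔖 m τ) g ⟨
    ∑ (List.map entries (𝔖 m τ)) g   ≈⟨ ∑-↭ g 𝔖↭ ⟩
    ∑ ls g                           ∎

  Q-321 Q-231 Q-132 Q-312 Q-213 : Quadruple
  Q-321 = quadruple pattern-321 exc inv fix
  Q-231 = quadruple pattern-231 des (λ σ → des σ + [31-2] σ) fmax
  Q-132 = quadruple (1 ∷ 3 ∷ 2 ∷ []) asc (λ σ → asc σ + [2-13] σ) amax
  Q-312 = quadruple (3 ∷ 1 ∷ 2 ∷ []) des (λ σ → des σ + [2-31] σ) amin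
  Q-213 = quadruple (2 ∷ 1 ∷ 3 ∷ []) asc (λ σ → asc σ + [13-2] σ) fmin

  ∑-321 : ∀ {k} (τ : Vec ℕ k) → Describes Not321 τ → ∀ t q r n →
    ∑ (𝔖 n τ) (λ σ → t ^ exc σ * q ^ inv σ * r ^ fix σ) ≈ seriesF q (t * q) r n
  ∑-321 τ describes t q r n = begin
    ∑ (𝔖 n τ) (λ σ → t ^ exc σ * q ^ inv σ * r ^ fix σ)
      ≈⟨ ∑-entries n τ (𝔖-321 n τ describes) (λ σ → ^-cong₃ t q r (exc-entries σ) (inv-entries σ) (fix-entries σ)) ⟩
    ∑ (arrangements [] 0 n) (weight321 t q r 0)
      ≈⟨ arrangements-sum t q r [] 0 n 0 ([] , All.[]) tt refl ⟩
    seriesF q (t * (q * 1#)) r n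
      ≈⟨ seriesF-cong q (*-congˡ (*-identityʳ q)) r n ⟩
    seriesF q (t * q) r n ∎

  ∑-231 : ∀ {k} (τ : Vec ℕ k) → Describes Not231 τ → ∀ t q r n →
    ∑ (𝔖 n τ) (λ σ → t ^ des σ * q ^ (des σ + [31-2] σ) * r ^ fmax σ) ≈ seriesF q (t * q) r n
  ∑-231 τ describes t q r n = begin
    ∑ (𝔖 n τ) (λ σ → t ^ des σ * q ^ (des σ + [31-2] σ) * r ^ fmax σ)
      ≈⟨ ∑-entries n τ (𝔖-231 n τ describes) (λ σ → ^-cong₃ t q r (des-entries σ)
           (cong₂ _+_ (des-entries σ) ([31-2]-entries σ)) (fmax-entries σ)) ⟩
    ∑ (List.map (word 0) (trees n)) (weight231 t q r)
      ≡⟨ ∑-map (word 0) (trees n) (weight231 t q r) ⟩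
    ∑ (trees n) (weight231 t q r ∘ word 0)
      ≈⟨ ∑-cong (trees n) (weight231-word t q r 0) ⟩
    seriesF q (t * q) r n ∎

  transport-series : ∀ {φ : ∀ {m} → Word m → Word m} → Symmetry φ → ∀ Q Q′ →
    let open Quadruple Q
        open Quadruple Q′ renaming (τ to τ′; stat₁ to stat₁′; stat₂ to stat₂′; stat₃ to stat₃′)
    in
    Transports φ τ τ′ → Transports φ τ′ τ →
    (∀ {m} (σ : Word m) → stat₁′ (φ σ) ≡ stat₁ σ) → (∀ {m} (σ : Word m) → stat₂′ (φ σ) ≡ stat₂ σ) →
    (∀ {m} (σ : Word m) → stat₃′ (φ σ) ≡ stat₃ σ) → HasSeries Q → HasSeries Q′
  transport-series {φ} symmetry Q Q′ τ⇒τ′ τ′⇒τ stat₁≡ stat₂≡ stat₃≡ hasSeries .series t q r n = begin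
    ∑ (𝔖 n τ′) w′               ≈⟨ ∑-↭ w′ (𝔖-symmetry {φ} {τ} {τ′} symmetry τ⇒τ′ τ′⇒τ n) ⟨
    ∑ (List.map φ (𝔖 n τ)) w′   ≡⟨ ∑-map φ (𝔖 n τ) w′ ⟩
    ∑ (𝔖 n τ) (w′ ∘ φ)          ≈⟨ ∑-cong (𝔖 n τ) (λ σ → ^-cong₃ t q r (stat₁≡ σ) (stat₂≡ σ) (stat₃≡ σ)) ⟩
    ∑ (𝔖 n τ) w                 ≈⟨ hasSeries .series t q r n ⟩
    seriesF q (t * q) r n       ∎
    where
    open Quadruple Q
    open Quadruple Q′ renaming (τ to τ′; stat₁ to stat₁′; stat₂ to stat₂′; stat₃ to stat₃′)
    w w′ : Word n → Carrier
    w σ = t ^ stat₁ σ * q ^ stat₂ σ * r ^ stat₃ σ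
    w′ σ = t ^ stat₁′ σ * q ^ stat₂′ σ * r ^ stat₃′ σ

  private
    τ = Quadruple.τ

  series-321 : HasSeries Q-321
  series-321 .series = ∑-321 (τ Q-321) describes-321

  series-231 : HasSeries Q-231
  series-231 .series = ∑-231 (τ Q-231) describes-231

  series-132 : HasSeries Q-132
  series-132 = transport-series reversal-symmetry Q-231 Q-132
    (reversal-transports (τ Q-231) (τ Q-132) (from-yes (mirroredOrder? (τ Q-231) (τ Q-132))))
    (reversal-transports (τ Q-132) (τ Q-231) (from-yes (mirroredOrder? (τ Q-132) (τ Q-231))))
    asc-reversal (λ σ → cong₂ _+_ (asc-reversal σ) ([2-13]-reversal σ)) amax-reversal series-231

  series-312 : HasSeries Q-312
  -- The pattern 312 is the complement of 132, which is already known as the reversal of 231; so no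
  -- statistic has to be followed through both symmetries at once.
  series-312 = transport-series complement-symmetry Q-132 Q-312
    (complement-transports (τ Q-132) (τ Q-312) (from-yes (oppositeOrder? (τ Q-132) (τ Q-312))))
    (complement-transports (τ Q-312) (τ Q-132) (from-yes (oppositeOrder? (τ Q-312) (τ Q-132))))
    des-complement (λ σ → cong₂ _+_ (des-complement σ) ([2-31]-complement σ)) amin-complement series-132

  series-213 : HasSeries Q-213
  series-213 = transport-series complement-symmetry Q-231 Q-213
    (complement-transports (τ Q-231) (τ Q-213) (from-yes (oppositeOrder? (τ Q-231) (τ Q-213))))
    (complement-transports (τ Q-213) (τ Q-231) (from-yes (oppositeOrder? (τ Q-213) (τ Q-231))))
    asc-complement (λ σ → cong₂ _+_ (asc-complement σ) ([13-2]-complement σ)) fmin-complement series-231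

  hasSeries : ∀ Q → Q ∈ quadruples → HasSeries Q
  hasSeries _ (here refl)                                 = series-321
  hasSeries _ (there (here refl))                         = series-231
  hasSeries _ (there (there (here refl)))                 = series-132
  hasSeries _ (there (there (there (here refl))))         = series-312
  hasSeries _ (there (there (there (there (here refl))))) = series-213

  N-series : ∀ t q r n → N n t q r ≈ seriesF q (t * q) r n
  N-series t q r n = ∑-321 (3 ∷ 2 ∷ 1 ∷ []) describes-321 t q r n

  shifted-coefficient : ∀ {f g} → f ≋ ι 1# ⊞ z ⊛ g → ∀ n → f (suc n) ≈ g n
  shifted-coefficient {g = g} f≋ n = ≈-trans (f≋ (suc n)) (≈-trans (+-identityˡ _) (z⊛-suc g n))

  first-identity : ∀ n t q q⁻¹ → q * q⁻¹ ≈ 1# →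
    N (suc n) (t * q⁻¹) q 1# ≈ seriesF q (t * q) (1# ⊕ t) n
  first-identity n t q q⁻¹ qq⁻¹≈1 = begin
    N (suc n) (t * q⁻¹) q 1#              ≈⟨ N-series (t * q⁻¹) q 1# (suc n) ⟩
    seriesF q (t * q⁻¹ * q) 1# (suc n)    ≈⟨ seriesF-cong q tq⁻¹q≈t 1# (suc n) ⟩
    seriesF q t 1# (suc n)                ≈⟨ shifted-coefficient (first-contraction ≈-refl
      (stieltjesPair q t) (stieltjesPair q (t * q)) (seriesF-weighted q t 1#) (seriesF-weighted q (t * q) (1# ⊕ t))) n ⟩
    seriesF q (t * q) (1# ⊕ t) n          ∎
    where
    tq⁻¹q≈t : t * q⁻¹ * q ≈ t
    tq⁻¹q≈t = ≈-trans (*-assoc t q⁻¹ q) (≈-trans (*-congˡ (≈-trans (⊗-comm q⁻¹ q) qq⁻¹≈1)) (*-identityʳ t))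

  second-identity : ∀ n t q t⁻¹ → t * t⁻¹ ≈ 1# →
    N (suc n) t q t ≈ t ^ suc n * seriesF q (q * t⁻¹ * q) (1# ⊕ q * t⁻¹) n
  second-identity n t q t⁻¹ tt⁻¹≈1 = begin
    N (suc n) t q t                       ≈⟨ N-series t q t (suc n) ⟩
    seriesF q (t * q) t (suc n)           ≈⟨ shifted-coefficient (second-contraction ≈-refl tp≈qq tt⁻¹≈1
      (stieltjesPair q t) (stieltjesPair q (t * q)) (stieltjesPair q p)
      (seriesF-weighted q (t * q) t) (seriesF-weighted q p (1# ⊕ q * t⁻¹))) n ⟩
    -- The prefactor of the identity arises here: t ^ n from the substitution of t z for z, and one
    -- more t from the coefficient in the equation of S.
    (ι t ⊛ δ t F) n                       ≈⟨ ι⊛ t (δ t F) n ⟩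
    t * (t ^ n * F n)                     ≈⟨ *-assoc t (t ^ n) (F n) ⟨
    t ^ suc n * F n                       ∎
    where
    -- The quadruples have the series F(t q, r); with q / t in place of t the parameter is q² / t.
    p = q * t⁻¹ * q
    F = seriesF q p (1# ⊕ q * t⁻¹)
    tp≈qq : t * p ≈ q * q
    tp≈qq = begin
      t * (q * t⁻¹ * q)   ≈⟨ *-congˡ (≈-trans (*-congʳ (⊗-comm q t⁻¹)) (*-assoc t⁻¹ q q)) ⟩
      t * (t⁻¹ * (q * q)) ≈⟨ *-assoc t t⁻¹ (q * q) ⟨
      t * t⁻¹ * (q * q)   ≈⟨ *-congʳ tt⁻¹≈1 ⟩
      1# * (q * q)        ≈⟨ *-identityˡ (q * q) ⟩
      q * q               ∎

theorem3p12 : ∀ {c ℓ} (R : CommutativeRing c ℓ) →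
    let open CommutativeRing R
        open GeneratingFunctions R
    in
    (n : ℕ) → 1 ≤ n →
    (Q : Quadruple) → Q ∈ quadruples →
    let open Quadruple Q in
    ((t q q⁻¹ : Carrier) → q * q⁻¹ ≈ 1# →
      N n (t * q⁻¹) q 1# ≈
        ∑ (𝔖 (n ∸ 1) τ) (λ σ → t ^ stat₁ σ * q ^ stat₂ σ * (1# + t) ^ stat₃ σ))
    ×
    ((t q t⁻¹ : Carrier) → t * t⁻¹ ≈ 1# →
      N n t q t ≈
        t ^ n * ∑ (𝔖 (n ∸ 1) τ) (λ σ → (q * t⁻¹) ^ stat₁ σ * q ^ stat₂ σ * (1# + q * t⁻¹) ^ stat₃ σ))
theorem3p12 R (suc n) _ Q Q∈ =
  (λ t q q⁻¹ qq⁻¹≈1 → ≈-trans (first-identity n t q q⁻¹ qq⁻¹≈1) (≈-sym (hasSeries Q Q∈ .series t q (1# + t) (suc n ∸ 1)))) ,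
  (λ t q t⁻¹ tt⁻¹≈1 → ≈-trans (second-identity n t q t⁻¹ tt⁻¹≈1)
    (*-congˡ (≈-sym (hasSeries Q Q∈ .series (q * t⁻¹) q (1# + q * t⁻¹) (suc n ∸ 1)))))
  where
  open CommutativeRing R using (1#; _+_; _*_; *-congˡ) renaming (sym to ≈-sym; trans to ≈-trans)
  open Identities R
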